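{- Let $G$ be a finite, simple, connected graph such that $\mathrm{EV}(G)$ is a subgraph of a graph in $\mathcal{G}$. Then either $\mathrm{pn}(G)\le\lfloor |V(G)|/2\rfloor$ (i.e. $G$ is a Gallai graph), or $G$ is a SET graph.
   Context: All graphs are finite and simple. A path decomposition of a graph $G$ is a collection of edge-disjoint paths of $G$ whose union covers $E(G)$; $\mathrm{pn}(G)$ is the minimum cardinality of a path decomposition of $G$. A graph $G$ on $n$ vertices is a Gallai graph if $\mathrm{pn}(G)\le\lfloor n/2\rfloor$. The E-subgraph $\mathrm{EV}(G)$ is the subgraph of $G$ induced by the vertices of even degree in $G$. A vertex is even (odd) if its degree in $G$ is even (odd). A graph $G$ is a SET graph (single even triangle graph) if $\mathrm{EV}(G)$ is a triangle and every odd vertex of $G$ has at least two even neighbors. A block of a graph is a maximal 2-connected subgraph. $\mathcal{G}$ denotes the family of graphs $H$ such that (i) each block of $H$ has maximum degree at most $3$, and (ii) each connected component of $H$ either has maximum degree at most $3$ or has at most one block that contains a triangle. -}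

module Defs where

open import Data.Nat using (ℕ; zero; suc; _+_; _≤_; _/_)
open import Data.Nat.Divisibility using (_∣_)
open import Data.Bool using (Bool; true; false; if_then_else_; _∧_)
open import Data.Fin using (Fin)
open import Data.Fin.Subset using (Subset; _∈_; _⊆_; _-_; ∣_∣; Nonempty)
open import Data.List using (List; []; _∷_; length; map; allFin; lookup)
open import Data.Nat.ListAction using (sum)
open import Data.List.Relation.Unary.All using (All)
open import Data.List.Relation.Unary.Unique.Propositional using (Unique)
open import Data.Vec using (Vec)
import Data.Vec as Vec
open import Data.Product using (Σ; ∃; _×_; _,_)
open import Data.Sum using (_⊎_)
open import Relation.Nullary using (¬_)
open import Relation.Binary.PropositionalEquality using (_≡_)

record Graph (n : ℕ) : Set where
  field
    adj    : Fin n → Fin n → Bool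
    sym    : ∀ u v → adj u v ≡ adj v u
    irrefl : ∀ u → adj u u ≡ false
open Graph public

Adj : ∀ {n} → Graph n → Fin n → Fin n → Set
Adj G u v = adj G u v ≡ true

deg : ∀ {n} → Graph n → Fin n → ℕ
deg {n} G v = sum (map (λ u → if adj G v u then 1 else 0) (allFin n))

degIn : ∀ {n} → Graph n → Subset n → Fin n → ℕ
degIn {n} G S v =
  sum (map (λ u → if adj G v u ∧ Vec.lookup S u then 1 else 0) (allFin n))

EvenV : ∀ {n} → Graph n → Fin n → Set
EvenV G v = 2 ∣ deg G v

data Walk {n} (G : Graph n) (S : Subset n) : Fin n → Fin n → Set where
  nil  : ∀ {u} → u ∈ S → Walk G S u u
  cons : ∀ {u w v} → u ∈ S → Adj G u w → Walk G S w v → Walk G S u v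

ConnectedSet : ∀ {n} → Graph n → Subset n → Set
ConnectedSet G S = ∀ u v → u ∈ S → v ∈ S → Walk G S u v

Connected : ∀ {n} → Graph n → Set
Connected G = ∀ u v → Walk G (Vec.replicate _ true) u v

TwoConnected : ∀ {n} → Graph n → Subset n → Set
TwoConnected G S =
  (3 ≤ ∣ S ∣) × ConnectedSet G S × (∀ x → x ∈ S → ConnectedSet G (S - x))

-- block: maximal 2-connected subgraph (such a subgraph is induced,
-- hence determined by its vertex set)
Block : ∀ {n} → Graph n → Subset n → Set
Block G B = TwoConnected G B × (∀ T → B ⊆ T → TwoConnected G T → T ≡ B)

Component : ∀ {n} → Graph n → Subset n → Set
Component G C =
  Nonempty C × ConnectedSet G C × (∀ T → C ⊆ T → ConnectedSet G T → T ≡ C)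

HasTriangle : ∀ {n} → Graph n → Subset n → Set
HasTriangle G S = Σ _ λ a → Σ _ λ b → Σ _ λ c →
  a ∈ S × b ∈ S × c ∈ S × Adj G a b × Adj G b c × Adj G a c

InFamily : ∀ {m} → Graph m → Set
InFamily H =
  (∀ B → Block H B → ∀ v → v ∈ B → degIn H B v ≤ 3)
  × (∀ C → Component H C →
       (∀ v → v ∈ C → deg H v ≤ 3)
       ⊎ (∀ B B′ → Block H B → B ⊆ C → HasTriangle H B
                 → Block H B′ → B′ ⊆ C → HasTriangle H B′ → B ≡ B′))

EVSubgraphOfFamily : ∀ {n} → Graph n → Set
EVSubgraphOfFamily {n} G =
  Σ ℕ λ m → Σ (Graph m) λ H → InFamily H ×
  Σ (Fin n → Fin m) λ f →
    (∀ u v → EvenV G u → EvenV G v → f u ≡ f v → u ≡ v)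
    × (∀ u v → EvenV G u → EvenV G v → Adj G u v → Adj H (f u) (f v))

data EdgeIn {n} : List (Fin n) → Fin n → Fin n → Set where
  here  : ∀ {x y xs} → EdgeIn (x ∷ y ∷ xs) x y
  here′ : ∀ {x y xs} → EdgeIn (x ∷ y ∷ xs) y x
  there : ∀ {x xs u v} → EdgeIn xs u v → EdgeIn (x ∷ xs) u v

data Linked {n} (G : Graph n) : List (Fin n) → Set where
  []  : Linked G []
  [-] : ∀ {x} → Linked G (x ∷ [])
  _∷_ : ∀ {x y xs} → Adj G x y → Linked G (y ∷ xs) → Linked G (x ∷ y ∷ xs)

IsPath : ∀ {n} → Graph n → List (Fin n) → Set
IsPath G p = Unique p × Linked G p

IsPathDecomposition : ∀ {n} → Graph n → List (List (Fin n)) → Set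
IsPathDecomposition G ps =
  All (IsPath G) ps
  × (∀ u v → Adj G u v → Σ _ λ i → EdgeIn (lookup ps i) u v)
  × (∀ i j u v → EdgeIn (lookup ps i) u v → EdgeIn (lookup ps j) u v → i ≡ j)

Gallai : ∀ {n} → Graph n → Set
Gallai {n} G = Σ _ λ ps → IsPathDecomposition G ps × length ps ≤ n / 2

SET : ∀ {n} → Graph n → Set
SET G =
  (Σ _ λ a → Σ _ λ b → Σ _ λ c →
     EvenV G a × EvenV G b × EvenV G c
     × Adj G a b × Adj G b c × Adj G a c
     × (∀ v → EvenV G v → v ≡ a ⊎ v ≡ b ⊎ v ≡ c))
  × (∀ v → ¬ EvenV G v →
       Σ _ λ x → Σ _ λ y → ¬ x ≡ y × EvenV G x × EvenV G y
                 × Adj G v x × Adj G v y)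

{-# OPTIONS --safe #-}
module Submission where

-- Idea.  Write D(v) for the number of ends of paths of a decomposition at v; D(v) has the parity of
-- the degree of v, so D(v) ≥ 1 when v is odd.  If an edge a x is missing, x is an end of some path
-- and all (other) neighbours of a are ends too, then a x can be added without a new path: extend the
-- path ending at x to a or, if that path already runs through a, reverse its segment before a; this
-- frees another edge at a, and one continues with that edge.  Counting ends shows that among several
-- candidates x one succeeds as soon as they carry more ends than there are neighbours of a carrying none.
--
-- Induct on the number of edges: delete a few edges, so that even vertices become odd, decompose the
-- rest, and add the edges again.  In the subgraph EV induced by the even vertices this removes
-- vertices of degree 1, adjacent vertices of degree 2 outside triangles, and vertices of degree 3 with
-- at most one neighbour of larger degree; if EV has a vertex of degree at least 4, the family
-- condition yields a triangle-free part of EV, of degree at most 3 and attached at one vertex, where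
-- such a step is possible.  When only isolated vertices and disjoint triangles are left in EV, one
-- works around an odd vertex that meets several components of EV, or along an edge that leaves the
-- neighbourhood of a triangle.  The case without even vertices of positive degree is Lovász's theorem.
--
-- Deletion may disconnect the graph.  A triangle of EV is called bad if it spans a SET component:
-- its vertices and the odd vertices with two neighbours on it are closed under adjacency.  The
-- induction runs over all graphs without bad triangles, and a deletion creates one only next to a
-- diamond of EV, where deleting the three edges at a vertex of the diamond works instead.

open import Defs
open import Data.Bool using (Bool; true; false; if_then_else_; _∧_; _∨_; _xor_; not)
open import Data.Bool.Properties using (∧-comm; ∨-comm; not-involutive; xor-comm; xor-assoc; xor-same; xor-identityʳ) renaming (_≟_ to _≟ᵇ_)
open import Data.Empty using (⊥; ⊥-elim)
open import Data.Fin using (Fin; zero; suc; _≟_)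
open import Data.Fin.Properties using (any?; all?)
open import Data.Fin.Subset using (Subset; ∣_∣) renaming (_∈_ to _∈ˢ_; _∉_ to _∉ˢ_; _⊆_ to _⊆ˢ_; _-_ to _-ˢ_; ⁅_⁆ to ⁅_⁆ˢ; ⊤ to ⊤ˢ)
import Data.Fin.Subset.Properties as Sub
open import Data.List using (List; []; _∷_; [_]; _++_; length; map; concatMap; reverse; allFin; filter; lookup)
open import Data.List.Properties using (map-++; concatMap-++; length-map; length-++; length-tabulate; filter-++; ++-identityʳ; reverse-involutive; unfold-reverse)
open import Data.List.Membership.Propositional using (_∈_; _∉_; find)
open import Data.List.Membership.Propositional.Properties using (∈-∃++; ∈-++⁺ˡ; ∈-++⁺ʳ; ∈-++⁻; ∈-filter⁺; ∈-filter⁻; ∈-allFin; ∈-map⁺; ∈-map⁻; ∈-lookup)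
open import Data.List.Relation.Unary.All as All using (All; []; _∷_)
import Data.List.Relation.Unary.All.Properties as Allₚ
open import Data.List.Relation.Unary.Any as Any using (Any; here; there)
import Data.List.Relation.Unary.Any.Properties as Anyₚ
open import Data.List.Relation.Unary.AllPairs using ([]; _∷_)
open import Data.List.Relation.Unary.Unique.Propositional using (Unique)
import Data.List.Relation.Unary.Unique.Propositional.Properties as Uniqueₚ
open import Data.List.Relation.Binary.Pointwise as PW using (Pointwise; []; _∷_)
open import Data.List.Relation.Binary.Permutation.Propositional as Perm using (_↭_; prep; swap; ↭-refl; ↭-sym; ↭-trans; ↭-reflexive)
open import Data.List.Relation.Binary.Permutation.Propositional.Properties using (∈-resp-↭; All-resp-↭; ↭-length; shift; ↭-reverse) renaming (map⁺ to ↭-map; ++⁺ to ↭-++; ++⁺ˡ to ↭-++ˡ; ++⁺ʳ to ↭-++ʳ; ++-comm to ↭-++-comm)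
open import Data.Nat using (ℕ; zero; suc; _+_; _*_; _∸_; _≤_; _<_; _/_; z≤n; s≤s; _≤?_)
open import Data.Nat.Properties renaming (_≟_ to _≟ℕ_)
open import Data.Nat.Divisibility using (_∣_; divides)
open import Data.Nat.DivMod using (/-mono-≤; m*n/n≡m)
open import Data.Nat.Induction using (<-wellFounded; Acc; acc)
open import Data.Nat.ListAction using (sum)
open import Data.Nat.ListAction.Properties using (sum-++; sum-↭)
open import Data.Product using (Σ; ∃; ∃₂; _×_; _,_; proj₁; proj₂)
open import Data.Sum using (_⊎_; inj₁; inj₂)
open import Data.Unit using (⊤; tt)
open import Data.Vec using (tabulate)
import Data.Vec as Vec
import Data.Vec.Properties as Vecₚ
open import Function using (_∘_; id; case_of_)
open import Relation.Nullary using (¬_; Dec; yes; no; does; contradiction)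
open import Relation.Nullary.Decidable using (dec-true; _×-dec_; _⊎-dec_; _→-dec_; ¬?; map′; decidable-stable)
open import Relation.Binary.PropositionalEquality using (_≡_; _≢_; refl; trans; cong; cong₂; subst; ≢-sym; module ≡-Reasoning) renaming (sym to symm)
open import Data.Nat.Solver using (module +-*-Solver)

-- Adding an edge never changes the number of paths, so the bookkeeping concerns ends only. Parity
-- guarantees one end at each vertex that is odd in the smaller graph, and an edge added at `a`
-- moves one end from its other endpoint to `a`. A vertex that receives several edges collects ends,
-- and these pay later for edges added at their far endpoints, where up to two neighbours may lack
-- an end: hence the recurring three ends before, and two ends after, such a step. The obstacle is
-- an odd vertex that loses an odd number of edges: it becomes even, and parity provides no end
-- there. The different ways of cutting off a triangle at a hub, and the additional edge `w z`
-- deleted next to a triangle, serve to cope with this. Each deletion makes the vertices it touches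
-- odd or leaves them no even neighbour, so the even subgraph only loses edges. The embedding into
-- the family is therefore given once, for a fixed relation `E₀` containing the edges of all even
-- subgraphs that occur.

infix 4 _∈?_

_∈?_ : ∀ {n} (v : Fin n) (xs : List (Fin n)) → Dec (v ∈ xs)
v ∈? xs = Any.any? (v ≟_) xs

-- Boolean equality and indicator values

infix 8 _==_

_==_ : ∀ {n} → Fin n → Fin n → Bool
u == v = does (u ≟ v)

b : Bool → ℕ
b x = if x then 1 else 0

==-refl : ∀ {n} (u : Fin n) → (u == u) ≡ true
==-refl u with u ≟ u
... | yes _ = refl
... | no u≢u = contradiction refl u≢u

==-≢ : ∀ {n} {u v : Fin n} → u ≢ v → (u == v) ≡ false
==-≢ {u = u} {v} u≢v with u ≟ v
... | yes u≡v = contradiction u≡v u≢v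
... | no _ = refl

==-sym : ∀ {n} (u v : Fin n) → (u == v) ≡ (v == u)
==-sym u v with u ≟ v
... | yes refl = symm (==-refl u)
... | no u≢v = symm (==-≢ (≢-sym u≢v))

true≢false : ∀ {x : Bool} → x ≡ true → x ≡ false → ⊥
true≢false refl ()

≢true : ∀ {x : Bool} → (x ≡ true → ⊥) → x ≡ false
≢true {false} _ = refl
≢true {true} f = ⊥-elim (f refl)

≢false : ∀ {x : Bool} → (x ≡ false → ⊥) → x ≡ true
≢false {true} _ = refl
≢false {false} f = ⊥-elim (f refl)

-- Parity

odd : ℕ → Bool
odd zero = false
odd (suc n) = not (odd n)

not-xor : ∀ x y → not (x xor y) ≡ (not x) xor y
not-xor true y = not-involutive y
not-xor false y = refl

odd-+ : ∀ m n → odd (m + n) ≡ odd m xor odd n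
odd-+ zero n = refl
odd-+ (suc m) n = trans (cong not (odd-+ m n)) (not-xor (odd m) (odd n))

odd-b : ∀ x → odd (b x) ≡ x
odd-b true = refl
odd-b false = refl

odd⇒≥1 : ∀ {m} → odd m ≡ true → 1 ≤ m
odd⇒≥1 {suc m} _ = s≤s z≤n

odd-*2 : ∀ q → odd (q * 2) ≡ false
odd-*2 zero = refl
odd-*2 (suc q) = trans (not-involutive _) (odd-*2 q)

even⇒2∣ : ∀ m → odd m ≡ false → 2 ∣ m
even⇒2∣ zero _ = divides 0 refl
even⇒2∣ (suc (suc m)) e with even⇒2∣ m (trans (symm (not-involutive _)) e)
... | divides q refl = divides (suc q) refl

2∣⇒even : ∀ {m} → 2 ∣ m → odd m ≡ false
2∣⇒even (divides q refl) = odd-*2 q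

-- Sums and occurrences in lists

Σ[_] : ∀ {A : Set} → List A → (A → ℕ) → ℕ
Σ[ xs ] f = sum (map f xs)

interchange : ∀ p q r s → (p + q) + (r + s) ≡ (p + r) + (q + s)
interchange p q r s = begin
  (p + q) + (r + s) ≡⟨ +-assoc p q (r + s) ⟩
  p + (q + (r + s)) ≡⟨ cong (p +_) (trans (symm (+-assoc q r s)) (trans (cong (_+ s) (+-comm q r)) (+-assoc r q s))) ⟩
  p + (r + (q + s)) ≡⟨ symm (+-assoc p r (q + s)) ⟩
  (p + r) + (q + s) ∎
  where open ≡-Reasoning

Σ-cong : ∀ {A : Set} (xs : List A) {f g : A → ℕ} → (∀ x → f x ≡ g x) → Σ[ xs ] f ≡ Σ[ xs ] g
Σ-cong [] h = refl
Σ-cong (x ∷ xs) h = cong₂ _+_ (h x) (Σ-cong xs h)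

Σ-+ : ∀ {A : Set} (xs : List A) (f g : A → ℕ) → Σ[ xs ] (λ x → f x + g x) ≡ Σ[ xs ] f + Σ[ xs ] g
Σ-+ [] f g = refl
Σ-+ (x ∷ xs) f g = trans (cong (f x + g x +_) (Σ-+ xs f g)) (interchange (f x) (g x) _ _)

Σ-0 : ∀ {A : Set} (xs : List A) {f : A → ℕ} → (∀ x → f x ≡ 0) → Σ[ xs ] f ≡ 0
Σ-0 [] h = refl
Σ-0 (x ∷ xs) h = cong₂ _+_ (h x) (Σ-0 xs h)

Σ-swap : ∀ {A B : Set} (xs : List A) (ys : List B) (f : A → B → ℕ) →
  Σ[ xs ] (λ x → Σ[ ys ] (f x)) ≡ Σ[ ys ] (λ y → Σ[ xs ] (λ x → f x y))
Σ-swap [] ys f = symm (Σ-0 ys (λ _ → refl))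
Σ-swap (x ∷ xs) ys f = trans (cong (Σ[ ys ] (f x) +_) (Σ-swap xs ys f)) (symm (Σ-+ ys (f x) _))

Σ-++ : ∀ {A : Set} (xs ys : List A) (f : A → ℕ) → Σ[ xs ++ ys ] f ≡ Σ[ xs ] f + Σ[ ys ] f
Σ-++ xs ys f = trans (cong sum (map-++ f xs ys)) (sum-++ (map f xs) (map f ys))

Σ-↭ : ∀ {A : Set} {xs ys : List A} (f : A → ℕ) → xs ↭ ys → Σ[ xs ] f ≡ Σ[ ys ] f
Σ-↭ f p = sum-↭ (↭-map f p)

Σ-concatMap : ∀ {A B : Set} (g : A → List B) (xs : List A) (f : B → ℕ) →
  Σ[ concatMap g xs ] f ≡ Σ[ xs ] (λ x → Σ[ g x ] f)
Σ-concatMap g [] f = refl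
Σ-concatMap g (x ∷ xs) f = trans (Σ-++ (g x) (concatMap g xs) f) (cong (Σ[ g x ] f +_) (Σ-concatMap g xs f))

Σ-mono : ∀ {A : Set} (xs : List A) {f g : A → ℕ} → (∀ x → f x ≤ g x) → Σ[ xs ] f ≤ Σ[ xs ] g
Σ-mono [] h = z≤n
Σ-mono (x ∷ xs) h = +-mono-≤ (h x) (Σ-mono xs h)

Σ-member : ∀ {A : Set} {x : A} {xs : List A} (f : A → ℕ) → x ∈ xs → f x ≤ Σ[ xs ] f
Σ-member f (here refl) = m≤m+n _ _
Σ-member f (there {y} x∈) = ≤-trans (Σ-member f x∈) (m≤n+m _ (f y))

Σ-positive : ∀ {A : Set} (xs : List A) (f : A → ℕ) → 1 ≤ Σ[ xs ] f → ∃ λ x → x ∈ xs × 1 ≤ f x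
Σ-positive (x ∷ xs) f h with f x in eq
... | suc m = x , here refl , subst (1 ≤_) (symm eq) (s≤s z≤n)
... | zero = let y , y∈ , q = Σ-positive xs f h in y , there y∈ , q

occ : ∀ {n} → Fin n → List (Fin n) → ℕ
occ v xs = Σ[ xs ] (λ x → b (v == x))

occ-∈ : ∀ {n} {v : Fin n} {xs} → v ∈ xs → 1 ≤ occ v xs
occ-∈ {v = v} {xs} v∈ = ≤-trans (≤-reflexive (symm (cong b (==-refl v)))) (Σ-member (λ x → b (v == x)) v∈)

∈-occ : ∀ {n} {v : Fin n} xs → 1 ≤ occ v xs → v ∈ xs
∈-occ {v = v} (x ∷ xs) h with v ≟ x
... | yes refl = here refl
... | no _ = there (∈-occ xs h)

occ-∉ : ∀ {n} {v : Fin n} {xs} → v ∉ xs → occ v xs ≡ 0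
occ-∉ {xs = []} _ = refl
occ-∉ {v = v} {x ∷ xs} v∉ = cong₂ _+_ (cong b (==-≢ (λ e → v∉ (here e)))) (occ-∉ (v∉ ∘ there))

occ-Unique : ∀ {n} {v : Fin n} {xs} → Unique xs → v ∈ xs → occ v xs ≡ 1
occ-Unique {v = v} (x∉ ∷ u) (here refl) = cong₂ _+_ (cong b (==-refl v)) (occ-∉ (λ v∈ → All.lookup x∉ v∈ refl))
occ-Unique {v = v} (x∉ ∷ u) (there v∈) =
  cong₂ _+_ (cong b (==-≢ (λ e → All.lookup x∉ v∈ (symm e)))) (occ-Unique u v∈)

occ-Unique-≤1 : ∀ {n} (v : Fin n) {xs} → Unique xs → occ v xs ≤ 1
occ-Unique-≤1 v {xs} u with v ∈? xs
... | yes v∈ = ≤-reflexive (occ-Unique u v∈)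
... | no v∉ = ≤-trans (≤-reflexive (occ-∉ v∉)) z≤n

occ≤1⇒Unique : ∀ {n} (xs : List (Fin n)) → (∀ v → occ v xs ≤ 1) → Unique xs
occ≤1⇒Unique [] h = []
occ≤1⇒Unique (x ∷ xs) h =
  All.tabulate (λ {y} y∈ x≡y → 1+n≰n (≤-trans (+-mono-≤ (≤-reflexive (symm (cong b (==-refl x)))) (occ-∈ (subst (_∈ xs) (symm x≡y) y∈))) (h x)))
  ∷ occ≤1⇒Unique xs (λ v → ≤-trans (m≤n+m _ (b (v == x))) (h v))

Unique-↭ : ∀ {A : Set} {xs ys : List A} → xs ↭ ys → Unique xs → Unique ys
Unique-↭ Perm.refl u = u
Unique-↭ (prep x p) (x∉ ∷ u) = All-resp-↭ p x∉ ∷ Unique-↭ p u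
Unique-↭ (swap x y p) ((x≢y ∷ x∉) ∷ y∉ ∷ u) =
  (≢-sym x≢y ∷ All-resp-↭ p y∉) ∷ All-resp-↭ p x∉ ∷ Unique-↭ p u
Unique-↭ (Perm.trans p q) u = Unique-↭ q (Unique-↭ p u)

Unique-++ˡ : ∀ {A : Set} (xs : List A) {ys} → Unique (xs ++ ys) → Unique xs
Unique-++ˡ [] u = []
Unique-++ˡ (x ∷ xs) (x∉ ∷ u) = Allₚ.++⁻ˡ xs x∉ ∷ Unique-++ˡ xs u

Unique-++ʳ : ∀ {A : Set} (xs : List A) {ys} → Unique (xs ++ ys) → Unique ys
Unique-++ʳ [] u = u
Unique-++ʳ (x ∷ xs) (_ ∷ u) = Unique-++ʳ xs u

Unique-++-∉ : ∀ {A : Set} (xs : List A) {ys v} → Unique (xs ++ ys) → v ∈ xs → v ∉ ys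
Unique-++-∉ (x ∷ xs) (x∉ ∷ u) (here refl) v∈ys = All.lookup (Allₚ.++⁻ʳ xs x∉) v∈ys refl
Unique-++-∉ (x ∷ xs) (_ ∷ u) (there v∈) v∈ys = Unique-++-∉ xs u v∈ v∈ys

∈⇒↭ : ∀ {A : Set} {x : A} {xs} → x ∈ xs → ∃ λ ys → xs ↭ x ∷ ys
∈⇒↭ x∈ with ys , zs , refl ← ∈-∃++ x∈ = ys ++ zs , shift _ ys zs

Unique-⊆-length : ∀ {A : Set} {xs ys : List A} → Unique xs → (∀ {x} → x ∈ xs → x ∈ ys) → length xs ≤ length ys
Unique-⊆-length [] _ = z≤n
Unique-⊆-length {xs = x ∷ xs} (x∉ ∷ u) s with ∈⇒↭ (s (here refl))
... | ys′ , p = ≤-trans (s≤s (Unique-⊆-length u sub)) (≤-reflexive (symm (↭-length p)))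
  where
  sub : ∀ {z} → z ∈ xs → z ∈ ys′
  sub z∈ with ∈-resp-↭ p (s (there z∈))
  ... | here refl = ⊥-elim (All.lookup x∉ z∈ refl)
  ... | there z∈′ = z∈′

length≤Σ : ∀ {n} (us : List (Fin n)) (P : Fin n → Bool) → Unique us → (∀ {u} → u ∈ us → P u ≡ true) →
  length us ≤ Σ[ allFin n ] (λ u → b (P u))
length≤Σ {n} us P uq h = ≤-trans (Unique-⊆-length uq (λ u∈ → ∈-filter⁺ (λ u → P u ≟ᵇ true) (∈-allFin _) (h u∈)))
                                 (≤-reflexive (len (allFin n)))
  where
  len : ∀ xs → length (filter (λ u → P u ≟ᵇ true) xs) ≡ Σ[ xs ] (λ u → b (P u))
  len [] = refl
  len (x ∷ xs) with P x
  ... | true = cong suc (len xs)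
  ... | false = len xs

Σ-indicator : ∀ {n} (v : Fin n) → Σ[ allFin n ] (λ u → b (u == v)) ≡ 1
Σ-indicator {n} v = trans (Σ-cong (allFin n) (λ u → cong b (==-sym u v))) (occ-Unique (Uniqueₚ.allFin⁺ n) (∈-allFin v))

odd-Σ-cong : ∀ {A : Set} (xs : List A) (f g : A → ℕ) → (∀ x → odd (f x) ≡ odd (g x)) → odd (Σ[ xs ] f) ≡ odd (Σ[ xs ] g)
odd-Σ-cong [] f g h = refl
odd-Σ-cong (x ∷ xs) f g h = trans (odd-+ (f x) _) (trans (cong₂ _xor_ (h x) (odd-Σ-cong xs f g h)) (symm (odd-+ (g x) _)))

-- The factor `not (x == y)` makes a degenerate pair the indicator of no edge, so that `_⊕_` yields
-- a graph without loops under no hypothesis.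
isE : ∀ {n} → Fin n → Fin n → Fin n → Fin n → Bool
isE x y u v = not (x == y) ∧ ((u == x ∧ v == y) ∨ (u == y ∧ v == x))

isE-sym : ∀ {n} (x y u v : Fin n) → isE x y u v ≡ isE x y v u
isE-sym x y u v = cong (not (x == y) ∧_) (trans (∨-comm (u == x ∧ v == y) _)
  (cong₂ _∨_ (∧-comm (u == y) _) (∧-comm (u == x) _)))

isE-swap : ∀ {n} (x y u v : Fin n) → isE x y u v ≡ isE y x u v
isE-swap x y u v = cong₂ _∧_ (cong not (==-sym x y)) (∨-comm (u == x ∧ v == y) _)

isE-ends : ∀ {n} (x y u v : Fin n) → isE x y u v ≡ true → x ≢ y × ((u ≡ x × v ≡ y) ⊎ (u ≡ y × v ≡ x))
isE-ends x y u v e with x ≟ y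
... | no x≢y with u ≟ x | v ≟ y | u ≟ y | v ≟ x
... | yes p | yes q | _ | _ = x≢y , inj₁ (p , q)
... | yes p | no _ | yes r | yes s = x≢y , inj₂ (r , s)
... | no _ | _ | yes r | yes s = x≢y , inj₂ (r , s)

isE-here : ∀ {n} {x y : Fin n} → x ≢ y → isE x y x y ≡ true
isE-here {x = x} {y} x≢y rewrite ==-≢ x≢y | ==-refl x | ==-refl y = refl

isE-irrefl : ∀ {n} (x y u : Fin n) → isE x y u u ≡ false
isE-irrefl x y u = ≢true λ e → case isE-ends x y u u e of λ where
  (x≢y , inj₁ (p , q)) → x≢y (trans (symm p) q)
  (x≢y , inj₂ (p , q)) → x≢y (trans (symm q) p)

isE-other : ∀ {n} {x y u : Fin n} → u ≢ x → u ≢ y → ∀ v → isE x y u v ≡ false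
isE-other {x = x} {y} {u} u≢x u≢y v = ≢true λ e → case isE-ends x y u v e of λ where
  (_ , inj₁ (p , _)) → u≢x p
  (_ , inj₂ (p , _)) → u≢y p

isE-b : ∀ {n} {x y : Fin n} → x ≢ y → ∀ u v → b (isE x y u v) ≡ b (u == x ∧ v == y) + b (u == y ∧ v == x)
isE-b {x = x} {y} x≢y u v rewrite ==-≢ x≢y with u ≟ x | u ≟ y
... | yes p | yes q = contradiction (trans (symm p) q) x≢y
... | no _ | no _ = refl
... | no _ | yes _ = refl
... | yes _ | no _ with v == y
...   | true = refl
...   | false = refl

Σ-∧ : ∀ {n} (c : Bool) (y : Fin n) → Σ[ allFin n ] (λ u → b (c ∧ u == y)) ≡ b c
Σ-∧ true y = Σ-indicator y
Σ-∧ {n} false y = Σ-0 (allFin n) (λ _ → refl)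

Σ-isE : ∀ {n} {x y : Fin n} → x ≢ y → ∀ v → Σ[ allFin n ] (λ u → b (isE x y v u)) ≡ b (v == x) + b (v == y)
Σ-isE {n} {x} {y} x≢y v = trans (Σ-cong (allFin n) (isE-b x≢y v))
  (trans (Σ-+ (allFin n) (λ u → b (v == x ∧ u == y)) (λ u → b (v == y ∧ u == x))) (cong₂ _+_ (Σ-∧ (v == x) y) (Σ-∧ (v == y) x)))

-- Toggling edges

Edge : ℕ → Set
Edge n = Fin n × Fin n

infixl 7 _⊕_ _⊕*_

-- Symmetric difference makes deleting and restoring an edge one operation, which is its own inverse
-- and commutes with itself. These laws are stated up to `_≈_`, since equality of graph records
-- would need extensionality.
_⊕_ : ∀ {n} → Graph n → Edge n → Graph n
adj (G ⊕ (x , y)) u v = adj G u v xor isE x y u v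
Graph.sym (G ⊕ (x , y)) u v = cong₂ _xor_ (Graph.sym G u v) (isE-sym x y u v)
irrefl (G ⊕ (x , y)) u = cong₂ _xor_ (irrefl G u) (isE-irrefl x y u)

_⊕*_ : ∀ {n} → Graph n → List (Edge n) → Graph n
G ⊕* [] = G
G ⊕* (e ∷ B) = (G ⊕* B) ⊕ e

infix 4 _≈_

_≈_ : ∀ {n} → Graph n → Graph n → Set
G ≈ G′ = ∀ u v → adj G u v ≡ adj G′ u v

≈-trans : ∀ {n} {G G′ G″ : Graph n} → G ≈ G′ → G′ ≈ G″ → G ≈ G″
≈-trans h k u v = trans (h u v) (k u v)

⊕-cong : ∀ {n} {G G′ : Graph n} (e : Edge n) → G ≈ G′ → G ⊕ e ≈ G′ ⊕ e
⊕-cong (x , y) h u v = cong (_xor isE x y u v) (h u v)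

⊕-comm : ∀ {n} (G : Graph n) (e f : Edge n) → G ⊕ e ⊕ f ≈ G ⊕ f ⊕ e
⊕-comm G (x , y) (z , w) u v = trans (xor-assoc (adj G u v) _ _)
  (trans (cong (adj G u v xor_) (xor-comm (isE x y u v) _)) (symm (xor-assoc (adj G u v) _ _)))

⊕-cancel : ∀ {n} (G : Graph n) (e : Edge n) → G ⊕ e ⊕ e ≈ G
⊕-cancel G (x , y) u v = trans (xor-assoc (adj G u v) _ _)
  (trans (cong (adj G u v xor_) (xor-same (isE x y u v))) (xor-identityʳ _))

⊕*-↭ : ∀ {n} (G : Graph n) {B B′ : List (Edge n)} → B ↭ B′ → G ⊕* B ≈ G ⊕* B′
⊕*-↭ G Perm.refl u v = refl
⊕*-↭ G {_ ∷ B} {_ ∷ B′} (prep e p) = ⊕-cong {G = G ⊕* B} {G ⊕* B′} e (⊕*-↭ G p)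
⊕*-↭ G {e ∷ f ∷ B} {_ ∷ _ ∷ B′} (swap e f p) =
  ≈-trans {G = G ⊕* B ⊕ f ⊕ e} {G ⊕* B ⊕ e ⊕ f} {G ⊕* B′ ⊕ e ⊕ f} (⊕-comm (G ⊕* B) f e)
    (⊕-cong {G = G ⊕* B ⊕ e} {G ⊕* B′ ⊕ e} f (⊕-cong {G = G ⊕* B} {G ⊕* B′} e (⊕*-↭ G p)))
⊕*-↭ G {B} {B′} (Perm.trans {ys = C} p q) = ≈-trans {G = G ⊕* B} {G ⊕* C} {G ⊕* B′} (⊕*-↭ G p) (⊕*-↭ G q)

par : ∀ {n} → Graph n → Fin n → Bool
par G v = odd (deg G v)

par-row : ∀ {n} {G G′ : Graph n} {v} → (∀ u → adj G v u ≡ adj G′ v u) → par G v ≡ par G′ v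
par-row {n} h = cong odd (Σ-cong (allFin n) (λ u → cong b (h u)))

par-≈ : ∀ {n} {G G′ : Graph n} → G ≈ G′ → ∀ v → par G v ≡ par G′ v
par-≈ {G = G} {G′} h v = par-row {G = G} {G′} (h v)

par-⊕ : ∀ {n} (G : Graph n) {x y : Fin n} → x ≢ y → ∀ v → par (G ⊕ (x , y)) v ≡ par G v xor ((v == x) xor (v == y))
par-⊕ {n} G {x} {y} x≢y v = begin
  odd (Σ[ allFin n ] (λ u → b (adj G v u xor isE x y v u)))
    ≡⟨ odd-Σ-cong (allFin n) _ (λ u → b (adj G v u) + b (isE x y v u)) (λ u → step (adj G v u) (isE x y v u)) ⟩
  odd (Σ[ allFin n ] (λ u → b (adj G v u) + b (isE x y v u)))
    ≡⟨ cong odd (Σ-+ (allFin n) (λ u → b (adj G v u)) (λ u → b (isE x y v u))) ⟩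
  odd (deg G v + Σ[ allFin n ] (λ u → b (isE x y v u))) ≡⟨ odd-+ (deg G v) _ ⟩
  par G v xor odd (Σ[ allFin n ] (λ u → b (isE x y v u))) ≡⟨ cong (par G v xor_) (cong odd (Σ-isE x≢y v)) ⟩
  par G v xor odd (b (v == x) + b (v == y))
    ≡⟨ cong (par G v xor_) (trans (odd-+ (b (v == x)) _) (cong₂ _xor_ (odd-b (v == x)) (odd-b (v == y)))) ⟩
  par G v xor ((v == x) xor (v == y)) ∎
  where
  open ≡-Reasoning
  step : ∀ p q → odd (b (p xor q)) ≡ odd (b p + b q)
  step true true = refl
  step true false = refl
  step false q = refl

-- Path decompositions: edges are counted, so that disjointness and covering become one equation

hd : ∀ {A : Set} → List A → List A
hd [] = []
hd (x ∷ _) = x ∷ []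

last′ : ∀ {A : Set} → A → List A → A
last′ x [] = x
last′ _ (y ∷ p) = last′ y p

lst : ∀ {A : Set} → List A → List A
lst [] = []
lst (x ∷ p) = last′ x p ∷ []

ends : ∀ {A : Set} → List A → List A
ends p = hd p ++ lst p

ec : ∀ {n} → Fin n → Fin n → List (Fin n) → ℕ
ec u v [] = 0
ec u v (x ∷ []) = 0
ec u v (x ∷ y ∷ p) = b (isE x y u v) + ec u v (y ∷ p)

cnt : ∀ {n} → Fin n → Fin n → List (List (Fin n)) → ℕ
cnt u v ps = Σ[ ps ] (ec u v)

Decomposes : ∀ {n} → Graph n → List (List (Fin n)) → Set
Decomposes G ps = All Unique ps × (∀ u v → cnt u v ps ≡ b (adj G u v))

endsOf : ∀ {n} → List (List (Fin n)) → List (Fin n)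
endsOf = concatMap ends

-- An inner vertex lies on two edges of the path. In the recursion `y` is counted once for the first
-- edge and once as the first end of the tail, and the two cancel modulo 2.
odd-path : ∀ {n} (v : Fin n) {p} → Unique p → odd (Σ[ allFin n ] (λ u → ec v u p)) ≡ odd (occ v (ends p))
odd-path {n} v {[]} _ = cong odd (Σ-0 (allFin n) (λ _ → refl))
odd-path {n} v {x ∷ []} _ = trans (cong odd (Σ-0 (allFin n) (λ _ → refl))) (symm (lemma (b (v == x))))
  where
  lemma : ∀ m → odd (m + (m + 0)) ≡ false
  lemma m = trans (odd-+ m (m + 0)) (trans (cong (λ k → odd m xor odd k) (+-identityʳ m)) (xor-same (odd m)))
odd-path {n} v {x ∷ y ∷ p} ((x≢y ∷ _) ∷ u) = begin
  odd (Σ[ allFin n ] (λ w → b (isE x y v w) + ec v w (y ∷ p))) ≡⟨ cong odd (Σ-+ (allFin n) (λ w → b (isE x y v w)) _) ⟩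
  odd (Σ[ allFin n ] (λ w → b (isE x y v w)) + rest) ≡⟨ cong (λ k → odd (k + rest)) (Σ-isE x≢y v) ⟩
  odd (b (v == x) + b (v == y) + rest) ≡⟨ odd-+ (b (v == x) + b (v == y)) rest ⟩
  odd (b (v == x) + b (v == y)) xor odd rest ≡⟨ cong₂ _xor_ (odd-+ (b (v == x)) _) (trans (odd-path v u) (odd-+ (b (v == y)) _)) ⟩
  (odd (b (v == x)) xor odd (b (v == y))) xor (odd (b (v == y)) xor odd (b (v == last′ y p) + 0))
    ≡⟨ cancel (odd (b (v == x))) (odd (b (v == y))) _ ⟩
  odd (b (v == x)) xor odd (b (v == last′ y p) + 0) ≡⟨ symm (odd-+ (b (v == x)) _) ⟩
  odd (b (v == x) + (b (v == last′ y p) + 0)) ∎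
  where
  open ≡-Reasoning
  rest = Σ[ allFin n ] (λ w → ec v w (y ∷ p))
  cancel : ∀ p q r → (p xor q) xor (q xor r) ≡ p xor r
  cancel true true r = refl
  cancel true false r = refl
  cancel false true r = not-involutive r
  cancel false false r = refl

odd-ends : ∀ {n} {G : Graph n} {ps} → Decomposes G ps → ∀ v → odd (occ v (endsOf ps)) ≡ par G v
odd-ends {n} {G} {ps} (us , c) v = symm (begin
  odd (Σ[ allFin n ] (λ u → b (adj G v u))) ≡⟨ cong odd (Σ-cong (allFin n) (λ u → symm (c v u))) ⟩
  odd (Σ[ allFin n ] (λ u → Σ[ ps ] (ec v u))) ≡⟨ cong odd (Σ-swap (allFin n) ps (ec v)) ⟩
  odd (Σ[ ps ] (λ p → Σ[ allFin n ] (λ u → ec v u p))) ≡⟨ go us ⟩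
  odd (Σ[ ps ] (λ p → occ v (ends p))) ≡⟨ cong odd (symm (Σ-concatMap ends ps _)) ⟩
  odd (occ v (endsOf ps)) ∎)
  where
  open ≡-Reasoning
  go : ∀ {qs} → All Unique qs → odd (Σ[ qs ] (λ p → Σ[ allFin n ] (λ u → ec v u p))) ≡ odd (Σ[ qs ] (λ p → occ v (ends p)))
  go [] = refl
  go {q ∷ qs} (u ∷ us) = trans (odd-+ (Σ[ allFin n ] (λ w → ec v w q)) _)
    (trans (cong₂ _xor_ (odd-path v u) (go us)) (symm (odd-+ (occ v (ends q)) _)))

ec⇒EdgeIn : ∀ {n} {u v : Fin n} p → 1 ≤ ec u v p → EdgeIn p u v
ec⇒EdgeIn {u = u} {v} (x ∷ y ∷ p) h = first (isE x y u v) refl h (ec⇒EdgeIn (y ∷ p))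
  where
  first : ∀ c → isE x y u v ≡ c → 1 ≤ b c + ec u v (y ∷ p) → (1 ≤ ec u v (y ∷ p) → EdgeIn (y ∷ p) u v) → EdgeIn (x ∷ y ∷ p) u v
  first false _ h rec = there (rec h)
  first true e _ _ with isE-ends x y u v e
  ... | _ , inj₁ (refl , refl) = here
  ... | _ , inj₂ (refl , refl) = here′

EdgeIn⇒ec : ∀ {n} {u v : Fin n} {p} → Unique p → EdgeIn p u v → 1 ≤ ec u v p
EdgeIn⇒ec ((x≢y ∷ _) ∷ _) here = m≤n⇒m≤n+o _ (≤-reflexive (symm (cong b (isE-here x≢y))))
EdgeIn⇒ec ((x≢y ∷ _) ∷ _) (here′ {x} {y}) = m≤n⇒m≤n+o _ (≤-reflexive (symm (cong b (trans (isE-sym x y y x) (isE-here x≢y)))))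
EdgeIn⇒ec {p = x ∷ []} _ (there ())
EdgeIn⇒ec {u = v} {w} {p = x ∷ y ∷ p} (_ ∷ u) (there e) = ≤-trans (EdgeIn⇒ec u e) (m≤n+m _ (b (isE x y v w)))

ec⇒Linked : ∀ {n} {G : Graph n} {p} → Unique p → (∀ u v → 1 ≤ ec u v p → Adj G u v) → Linked G p
ec⇒Linked {p = []} _ _ = []
ec⇒Linked {p = x ∷ []} _ _ = [-]
ec⇒Linked {p = x ∷ y ∷ p} uq@(_ ∷ u) h =
  h x y (EdgeIn⇒ec uq here) ∷ ec⇒Linked u (λ v w k → h v w (≤-trans k (m≤n+m _ (b (isE x y v w)))))

Σ-index : ∀ {A : Set} (xs : List A) (f : A → ℕ) → 1 ≤ Σ[ xs ] f → Σ (Fin (length xs)) λ i → 1 ≤ f (lookup xs i)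
Σ-index xs f h with x , x∈ , k ← Σ-positive xs f h = Any.index x∈ , subst (λ z → 1 ≤ f z) (Anyₚ.lookup-index x∈) k

Σ-index-unique : ∀ {A : Set} (xs : List A) (f : A → ℕ) → Σ[ xs ] f ≤ 1 → ∀ i j → 1 ≤ f (lookup xs i) → 1 ≤ f (lookup xs j) → i ≡ j
Σ-index-unique (x ∷ xs) f h zero zero p q = refl
Σ-index-unique (x ∷ xs) f h zero (suc j) p q =
  ⊥-elim (1+n≰n (≤-trans (+-mono-≤ p (≤-trans q (Σ-member f (∈-lookup {xs = xs} j)))) h))
Σ-index-unique (x ∷ xs) f h (suc i) zero p q =
  ⊥-elim (1+n≰n (≤-trans (+-mono-≤ q (≤-trans p (Σ-member f (∈-lookup {xs = xs} i)))) h))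
Σ-index-unique (x ∷ xs) f h (suc i) (suc j) p q =
  cong suc (Σ-index-unique xs f (≤-trans (m≤n+m _ (f x)) h) i j p q)

b≤1 : ∀ x → b x ≤ 1
b≤1 true = ≤-refl
b≤1 false = z≤n

1≤b : ∀ {x} → 1 ≤ b x → x ≡ true
1≤b {true} _ = refl

Decomposes⇒IsPathDecomposition : ∀ {n} {G : Graph n} {ps} → Decomposes G ps → IsPathDecomposition G ps
Decomposes⇒IsPathDecomposition {G = G} {ps} (us , c) =
  All.tabulate (λ {p} p∈ → All.lookup us p∈ , ec⇒Linked (All.lookup us p∈)
    (λ u v h → 1≤b (subst (1 ≤_) (c u v) (≤-trans h (Σ-member (ec u v) p∈)))))
  , (λ u v a → let i , h = Σ-index ps (ec u v) (≤-reflexive (symm (trans (c u v) (cong b a)))) in i , ec⇒EdgeIn _ h)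
  , (λ i j u v p q → Σ-index-unique ps (ec u v) (≤-trans (≤-reflexive (c u v)) (b≤1 _)) i j
       (EdgeIn⇒ec (All.lookup us (∈-lookup i)) p) (EdgeIn⇒ec (All.lookup us (∈-lookup j)) q))

-- Adding edges at a vertex

roots tips : ∀ {A : Set} → List (List A) → List A
roots = concatMap hd
tips = concatMap lst

Flip : ∀ {A : Set} → List A → List A → Set
Flip α β = β ≡ α ⊎ β ≡ reverse α

lst-++ : ∀ {A : Set} (p : List A) x q → lst (p ++ x ∷ q) ≡ lst (x ∷ q)
lst-++ [] x q = refl
lst-++ (y ∷ []) x q = refl
lst-++ (y ∷ z ∷ p) x q = lst-++ (z ∷ p) x q

lst-reverse : ∀ {A : Set} (α : List A) → lst (reverse α) ≡ hd α
lst-reverse [] = refl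
lst-reverse (x ∷ p) = trans (cong lst (unfold-reverse x p)) (lst-++ (reverse p) x [])

hd-reverse : ∀ {A : Set} (α : List A) → hd (reverse α) ≡ lst α
hd-reverse α = trans (symm (lst-reverse (reverse α))) (cong lst (reverse-involutive α))

Pointwise-++⁻ : ∀ {A : Set} {R : A → A → Set} xs {ys zs} → Pointwise R (xs ++ ys) zs →
  ∃₂ λ zs₁ zs₂ → zs ≡ zs₁ ++ zs₂ × Pointwise R xs zs₁ × Pointwise R ys zs₂
Pointwise-++⁻ [] r = [] , _ , refl , [] , r
Pointwise-++⁻ (x ∷ xs) (p ∷ r) with zs₁ , zs₂ , refl , r₁ , r₂ ← Pointwise-++⁻ xs r = _ , zs₂ , refl , p ∷ r₁ , r₂

concatMap-insert : ∀ {A B : Set} (f : A → List B) xs {x} ys {z} → f x ≡ z ∷ [] →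
  concatMap f (xs ++ x ∷ ys) ↭ z ∷ concatMap f (xs ++ ys)
concatMap-insert f xs {x} ys {z} e = ↭-trans (↭-reflexive (trans (concatMap-++ f xs (x ∷ ys)) (cong (λ l → concatMap f xs ++ l ++ concatMap f ys) e)))
  (↭-trans (shift z (concatMap f xs) (concatMap f ys)) (↭-reflexive (cong (z ∷_) (symm (concatMap-++ f xs ys)))))

swap′ : ∀ {A : Set} {x y : A} {xs} → x ∷ y ∷ xs ↭ y ∷ x ∷ xs
swap′ = swap _ _ ↭-refl

tip-arm : ∀ {A : Set} {x : A} L → x ∈ tips L → ∃₂ λ r q → ∃₂ λ L₁ L₂ → L ≡ L₁ ++ (r ∷ q) ∷ L₂ × x ≡ last′ r q
tip-arm ([] ∷ L) x∈ with r , q , L₁ , L₂ , refl , e ← tip-arm L x∈ = r , q , [] ∷ L₁ , L₂ , refl , e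
tip-arm ((r ∷ q) ∷ L) (here e) = r , q , [] , L , refl , e
tip-arm ((r′ ∷ q′) ∷ L) (there x∈) with r , q , L₁ , L₂ , refl , e ← tip-arm L x∈ = r , q , (r′ ∷ q′) ∷ L₁ , L₂ , refl , e

-- An arm is a segment of a path on one side of a fixed vertex, listed from its root (next to the
-- vertex) to its tip (an end of the path).  Reversing arms exchanges roots and tips; `Fr` lists the
-- ends of the paths that avoid the vertex.
reach : ∀ {n} k (L : List (List (Fin n))) (Fr X Z : List (Fin n)) → length L ≤ k → Unique (X ++ roots L) →
  (∀ c → c ∈ roots L → c ∈ Z ⊎ c ∈ tips L ++ Fr) →
  length Z < Σ[ X ] (λ x → occ x (tips L ++ Fr)) →
  ∃₂ λ x y → x ∈ X × y ∈ Fr × ∃ λ L* →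
    Pointwise Flip L L* × y ∷ roots L* ↭ x ∷ roots L × x ∷ tips L* ↭ y ∷ tips L
reach {n} k L Fr X Z len uq cov big with Σ-positive X _ (≤-trans (s≤s z≤n) big)
... | x , x∈X , pos with ∈-++⁻ (tips L) (∈-occ (tips L ++ Fr) pos)
... | inj₂ x∈Fr = x , x , x∈X , x∈Fr , L , PW.refl (inj₁ refl) , ↭-refl , ↭-refl
... | inj₁ x∈tips with tip-arm L x∈tips
... | r , q , L₁ , L₂ , refl , refl = descend k len
  where
  L′ = L₁ ++ L₂
  D′ = tips L′ ++ Fr
  Goal = ∃₂ λ x y → x ∈ X × y ∈ Fr × ∃ λ L* →
    Pointwise Flip L L* × y ∷ roots L* ↭ x ∷ roots L × x ∷ tips L* ↭ y ∷ tips L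
  pr : roots L ↭ r ∷ roots L′
  pr = concatMap-insert hd L₁ L₂ refl
  pt : tips L ↭ x ∷ tips L′
  pt = concatMap-insert lst L₁ L₂ refl
  suc-len : length L ≡ suc (length L′)
  suc-len = trans (length-++ L₁) (trans (+-suc _ _) (cong suc (symm (length-++ L₁))))
  uq′ : Unique ((r ∷ X) ++ roots L′)
  uq′ = Unique-↭ (↭-trans (↭-++ˡ X pr) (shift r X (roots L′))) uq
  up : ∀ {c} → c ∈ roots L′ → c ∈ roots L
  up c∈ = ∈-resp-↭ (↭-sym pr) (there c∈)
  -- Only an end at `x` disappears with the arm, and `x`, being a candidate, is not a root.
  keep : ∀ {c} → c ∈ roots L → c ∈ tips L ++ Fr → c ∈ D′
  keep c∈ h with ∈-resp-↭ (↭-++ʳ Fr pt) h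
  ... | here refl = ⊥-elim (Unique-++-∉ X uq x∈X c∈)
  ... | there h′ = h′
  sum≤ : Σ[ X ] (λ z → occ z (tips L ++ Fr)) ≤ suc (Σ[ X ] (λ z → occ z D′))
  sum≤ = begin
    Σ[ X ] (λ z → occ z (tips L ++ Fr)) ≡⟨ Σ-cong X (λ z → Σ-↭ _ (↭-++ʳ Fr pt)) ⟩
    Σ[ X ] (λ z → b (z == x) + occ z D′) ≡⟨ Σ-+ X (λ z → b (z == x)) (λ z → occ z D′) ⟩
    Σ[ X ] (λ z → b (z == x)) + Σ[ X ] (λ z → occ z D′)
      ≤⟨ +-monoˡ-≤ _ (≤-trans (≤-reflexive (Σ-cong X (λ z → cong b (==-sym z x)))) (occ-Unique-≤1 x (Unique-++ˡ X uq))) ⟩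
    suc (Σ[ X ] (λ z → occ z D′)) ∎
    where open ≤-Reasoning
  -- The freed root `r` joins the candidates. The arm takes one end with it, that of its tip `x`;
  -- this is made up for by removing `r` from `Z` if it lies there, and otherwise by an end at `r`
  -- that is still present. So the inequality survives.
  Rest : Set
  Rest = ∃ λ Z′ → (∀ c → c ∈ roots L′ → c ∈ Z′ ⊎ c ∈ D′) × length Z′ < Σ[ r ∷ X ] (λ z → occ z D′)
  rest : Dec (r ∈ Z) → Rest
  rest (yes r∈Z) with Z′ , pz ← ∈⇒↭ r∈Z = Z′ , cov′ ,
      ≤-trans (≤-pred (≤-trans (≤-trans (≤-reflexive (cong suc (symm (↭-length pz)))) big) sum≤)) (m≤n+m _ (occ r D′))
    where
    cov′ : ∀ c → c ∈ roots L′ → c ∈ Z′ ⊎ c ∈ D′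
    cov′ c c∈ with cov c (up c∈)
    ... | inj₂ d = inj₂ (keep (up c∈) d)
    ... | inj₁ z with ∈-resp-↭ pz z
    ...   | here refl = ⊥-elim (Unique-++-∉ (r ∷ X) uq′ (here refl) c∈)
    ...   | there z′ = inj₁ z′
  rest (no r∉Z) = Z , cov′ , ≤-trans (≤-trans big sum≤) (+-monoˡ-≤ _ (occ-∈ r∈D′))
    where
    cov′ : ∀ c → c ∈ roots L′ → c ∈ Z ⊎ c ∈ D′
    cov′ c c∈ with cov c (up c∈)
    ... | inj₂ d = inj₂ (keep (up c∈) d)
    ... | inj₁ z = inj₁ z
    r∈D′ : r ∈ D′
    r∈D′ with cov r (∈-resp-↭ (↭-sym pr) (here refl))
    ... | inj₁ z = ⊥-elim (r∉Z z)
    ... | inj₂ d = keep (∈-resp-↭ (↭-sym pr) (here refl)) d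
  descend : ∀ k → length L ≤ k → Goal
  descend zero h = ⊥-elim (n≮0 (≤-trans (≤-reflexive (symm suc-len)) h))
  descend (suc k) h with rest (r ∈? Z)
  ... | Z′ , cov′ , big′ with reach k L′ Fr (r ∷ X) Z′ (≤-pred (≤-trans (≤-reflexive (symm suc-len)) h)) uq′ cov′ big′
  ... | x′ , y , x′∈ , y∈ , L′* , fl , er , et with Pointwise-++⁻ L₁ fl
  ... | L₁* , L₂* , refl , fl₁ , fl₂ = build x′∈
    where
    -- If the recursive call settles on a candidate in `X`, the arm stays as it is. If it settles on
    -- `r`, the arm is reversed: `x` replaces `r` among the roots, and `r` replaces `x` among the
    -- tips.
    build : x′ ∈ r ∷ X → Goal
    build (there x′∈X) = x′ , y , x′∈X , y∈ , L₁* ++ (r ∷ q) ∷ L₂* , PW.++⁺ fl₁ (inj₁ refl ∷ fl₂)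
      , ↭-trans (prep y (concatMap-insert hd L₁* L₂* refl)) (↭-trans swap′ (↭-trans (prep r er) (↭-trans swap′ (prep x′ (↭-sym pr)))))
      , ↭-trans (prep x′ (concatMap-insert lst L₁* L₂* refl)) (↭-trans swap′ (↭-trans (prep x et) (↭-trans swap′ (prep y (↭-sym pt)))))
    build (here refl) = x , y , x∈X , y∈ , L₁* ++ reverse (r ∷ q) ∷ L₂* , PW.++⁺ fl₁ (inj₂ refl ∷ fl₂)
      , ↭-trans (prep y (concatMap-insert hd L₁* L₂* (hd-reverse (r ∷ q)))) (↭-trans swap′ (prep x (↭-trans er (↭-sym pr))))
      , ↭-trans (prep x (concatMap-insert lst L₁* L₂* (lst-reverse (r ∷ q)))) (↭-trans (prep x et) (↭-trans swap′ (prep y (↭-sym pt))))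

-- Edge counts of concatenated and reversed paths

hd-∈ : ∀ {A : Set} {r : A} {α} → r ∈ hd α → r ∈ α
hd-∈ {α = _ ∷ _} (here e) = here e

ec-hd : ∀ {n} (u v : Fin n) a β → ec u v (a ∷ β) ≡ Σ[ hd β ] (λ r → b (isE a r u v)) + ec u v β
ec-hd u v a [] = refl
ec-hd u v a (r ∷ β) = cong (_+ ec u v (r ∷ β)) (symm (+-identityʳ _))

ec-++ : ∀ {n} (u v : Fin n) xs a ys → ec u v (xs ++ a ∷ ys) ≡ ec u v xs + Σ[ lst xs ] (λ r → b (isE r a u v)) + ec u v (a ∷ ys)
ec-++ u v [] a ys = refl
ec-++ u v (x ∷ []) a ys = cong (_+ ec u v (a ∷ ys)) (symm (+-identityʳ _))
ec-++ u v (x ∷ y ∷ xs) a ys = trans (cong (b (isE x y u v) +_) (ec-++ u v (y ∷ xs) a ys))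
  (trans (symm (+-assoc (b (isE x y u v)) _ _)) (cong (_+ ec u v (a ∷ ys)) (symm (+-assoc (b (isE x y u v)) _ _))))

ec-reverse : ∀ {n} (u v : Fin n) α → ec u v (reverse α) ≡ ec u v α
ec-reverse u v [] = refl
ec-reverse u v (x ∷ α) = begin
  ec u v (reverse (x ∷ α)) ≡⟨ cong (ec u v) (unfold-reverse x α) ⟩
  ec u v (reverse α ++ x ∷ []) ≡⟨ ec-++ u v (reverse α) x [] ⟩
  ec u v (reverse α) + Σ[ lst (reverse α) ] (λ r → b (isE r x u v)) + 0 ≡⟨ +-identityʳ _ ⟩
  ec u v (reverse α) + Σ[ lst (reverse α) ] (λ r → b (isE r x u v))
    ≡⟨ cong₂ _+_ (ec-reverse u v α) (trans (cong (λ l → Σ[ l ] (λ r → b (isE r x u v))) (lst-reverse α)) (Σ-cong (hd α) (λ r → cong b (isE-swap r x u v)))) ⟩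
  ec u v α + Σ[ hd α ] (λ r → b (isE x r u v)) ≡⟨ +-comm (ec u v α) _ ⟩
  Σ[ hd α ] (λ r → b (isE x r u v)) + ec u v α ≡⟨ symm (ec-hd u v x α) ⟩
  ec u v (x ∷ α) ∎
  where open ≡-Reasoning

-- The paths through a vertex, split into arms

module Star {n} (a : Fin n) where

  Arms : Set
  Arms = List (Fin n) × List (Fin n)

  join : Arms → List (Fin n)
  join (α , β) = reverse α ++ a ∷ β

  arms : List Arms → List (List (Fin n))
  arms = concatMap (λ (α , β) → α ∷ β ∷ [])

  -- An empty arm means that its path ends at `a` itself; applied to `lst α`, this function records
  -- that end.
  e₁ : List (Fin n) → List (Fin n)
  e₁ [] = a ∷ []
  e₁ (_ ∷ _) = []

  star-view : ∀ ps → ∃₂ λ T Av → ps ↭ map join T ++ Av × All (a ∉_) Av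
  star-view [] = [] , [] , ↭-refl , []
  star-view (p ∷ ps) with star-view ps
  ... | T , Av , perm , av with a ∈? p
  ... | no a∉p = T , p ∷ Av , ↭-trans (prep p perm) (↭-sym (shift p (map join T) Av)) , a∉p ∷ av
  ... | yes a∈p with xs , ys , refl ← ∈-∃++ a∈p =
    (reverse xs , ys) ∷ T , Av , ↭-trans (↭-reflexive (cong (λ l → (l ++ a ∷ ys) ∷ ps) (symm (reverse-involutive xs)))) (prep _ perm) , av

  ec-join : ∀ u v α β → ec u v (join (α , β)) ≡ (ec u v α + ec u v β) + (Σ[ hd α ] (λ r → b (isE a r u v)) + Σ[ hd β ] (λ r → b (isE a r u v)))
  ec-join u v α β = begin
    ec u v (reverse α ++ a ∷ β) ≡⟨ ec-++ u v (reverse α) a β ⟩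
    ec u v (reverse α) + Σ[ lst (reverse α) ] (λ r → b (isE r a u v)) + ec u v (a ∷ β)
      ≡⟨ cong₂ _+_ (cong₂ _+_ (ec-reverse u v α) (trans (cong (λ l → Σ[ l ] (λ r → b (isE r a u v))) (lst-reverse α)) (Σ-cong (hd α) (λ r → cong b (isE-swap r a u v))))) (ec-hd u v a β) ⟩
    (ec u v α + Σ[ hd α ] (λ r → b (isE a r u v))) + (Σ[ hd β ] (λ r → b (isE a r u v)) + ec u v β)
      ≡⟨ cong (ec u v α + Σ[ hd α ] (λ r → b (isE a r u v)) +_) (+-comm (Σ[ hd β ] (λ r → b (isE a r u v))) _) ⟩
    (ec u v α + Σ[ hd α ] (λ r → b (isE a r u v))) + (ec u v β + Σ[ hd β ] (λ r → b (isE a r u v)))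
      ≡⟨ interchange (ec u v α) _ (ec u v β) _ ⟩
    _ ∎
    where open ≡-Reasoning

  cnt-join : ∀ u v T → cnt u v (map join T) ≡ Σ[ arms T ] (ec u v) + Σ[ roots (arms T) ] (λ r → b (isE a r u v))
  cnt-join u v [] = refl
  cnt-join u v ((α , β) ∷ T) = begin
    ec u v (join (α , β)) + cnt u v (map join T) ≡⟨ cong₂ _+_ (ec-join u v α β) (cnt-join u v T) ⟩
    ((A + B) + (RA + RB)) + (S + R) ≡⟨ interchange (A + B) (RA + RB) S R ⟩
    ((A + B) + S) + ((RA + RB) + R) ≡⟨ cong₂ _+_ (+-assoc A B S) (trans (+-assoc RA RB R)
        (symm (trans (Σ-++ (hd α) (hd β ++ roots (arms T)) f) (cong (RA +_) (Σ-++ (hd β) (roots (arms T)) f))))) ⟩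
    _ ∎
    where
    open ≡-Reasoning
    f : Fin n → ℕ
    f r = b (isE a r u v)
    A = ec u v α
    B = ec u v β
    RA = Σ[ hd α ] f
    RB = Σ[ hd β ] f
    S = Σ[ arms T ] (ec u v)
    R = Σ[ roots (arms T) ] f

  ends-join : ∀ α β → ends (join (α , β)) ≡ (lst α ++ e₁ (lst α)) ++ (lst β ++ e₁ (lst β))
  ends-join α β = cong₂ _++_ (left α) (trans (lst-++ (reverse α) a β) (right β))
    where
    right : ∀ β → lst (a ∷ β) ≡ lst β ++ e₁ (lst β)
    right [] = refl
    right (_ ∷ _) = refl
    left : ∀ α → hd (reverse α ++ a ∷ β) ≡ lst α ++ e₁ (lst α)
    left [] = refl
    left (x ∷ α) with reverse (x ∷ α) | hd-reverse (x ∷ α)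
    ... | y ∷ ys | e = e

  occ-ends-join : ∀ v T → occ v (endsOf (map join T)) ≡ occ v (tips (arms T)) + Σ[ arms T ] (λ α → occ v (e₁ (lst α)))
  occ-ends-join v [] = refl
  occ-ends-join v ((α , β) ∷ T) = begin
    occ v (ends (join (α , β)) ++ endsOf (map join T)) ≡⟨ Σ-++ (ends (join (α , β))) _ _ ⟩
    occ v (ends (join (α , β))) + occ v (endsOf (map join T)) ≡⟨ cong₂ _+_ (trans (cong (occ v) (ends-join α β)) (trans (Σ-++ (lst α ++ _) _ _) (cong₂ _+_ (Σ-++ (lst α) _ _) (Σ-++ (lst β) _ _)))) (occ-ends-join v T) ⟩
    ((la + ea) + (lb + eb)) + (t + s) ≡⟨ cong (_+ (t + s)) (interchange la ea lb eb) ⟩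
    ((la + lb) + (ea + eb)) + (t + s) ≡⟨ interchange (la + lb) (ea + eb) t s ⟩
    ((la + lb) + t) + ((ea + eb) + s) ≡⟨ cong₂ _+_ (trans (+-assoc la lb t) (symm (trans (Σ-++ (lst α) _ _) (cong (la +_) (Σ-++ (lst β) _ _))))) (+-assoc ea eb s) ⟩
    _ ∎
    where
    open ≡-Reasoning
    la = occ v (lst α)
    lb = occ v (lst β)
    ea = occ v (e₁ (lst α))
    eb = occ v (e₁ (lst β))
    t = occ v (tips (arms T))
    s = Σ[ arms T ] (λ α → occ v (e₁ (lst α)))

  flip-Σ : ∀ {L L*} (f : List (Fin n) → ℕ) → (∀ α → f (reverse α) ≡ f α) → Pointwise Flip L L* → Σ[ L* ] f ≡ Σ[ L ] f
  flip-Σ f h [] = refl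
  flip-Σ f h (inj₁ refl ∷ fl) = cong₂ _+_ refl (flip-Σ f h fl)
  flip-Σ f h (inj₂ refl ∷ fl) = cong₂ _+_ (h _) (flip-Σ f h fl)

  Flip-↭ : ∀ {α β : List (Fin n)} → Flip α β → α ↭ β
  Flip-↭ (inj₁ refl) = ↭-refl
  Flip-↭ (inj₂ refl) = ↭-sym (↭-reverse _)

  -- Flipping arms permutes the vertices of a joined path, so the path stays simple whichever arms
  -- are flipped.
  unarms : ∀ T {L*} → Pointwise Flip (arms T) L* → All Unique (map join T) →
    ∃ λ T* → L* ≡ arms T* × All Unique (map join T*) × length T* ≡ length T
  unarms [] [] [] = [] , refl , [] , refl
  unarms ((α , β) ∷ T) {α* ∷ β* ∷ _} (f ∷ g ∷ fl) (u ∷ us) with unarms T fl us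
  ... | T* , refl , us* , len = (α* , β*) ∷ T* , refl , Unique-↭ same u ∷ us* , cong suc len
    where
    same : join (α , β) ↭ join (α* , β*)
    same = ↭-++ (↭-trans (↭-reverse α) (↭-trans (Flip-↭ f) (↭-sym (↭-reverse α*)))) (prep a (Flip-↭ g))

  e₁-reverse : ∀ α → e₁ (lst (reverse α)) ≡ e₁ (lst α)
  e₁-reverse α = trans (cong e₁ (lst-reverse α)) (e₁-hd α)
    where
    e₁-hd : ∀ α → e₁ (hd α) ≡ e₁ (lst α)
    e₁-hd [] = refl
    e₁-hd (_ ∷ _) = refl

  occ-e₁ : ∀ {v} → v ≢ a → ∀ L → Σ[ L ] (λ α → occ v (e₁ (lst α))) ≡ 0
  occ-e₁ {v} v≢a L = Σ-0 L (λ α → go (lst α))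
    where
    go : ∀ l → occ v (e₁ l) ≡ 0
    go [] = cong (λ k → b k + 0) (==-≢ v≢a)
    go (_ ∷ _) = refl

  orient : ∀ {y : Fin n} {p} → y ∈ ends p → ∃ λ q → p ↭ y ∷ q × (∀ u v → ec u v (y ∷ q) ≡ ec u v p) × (∀ v → occ v (ends p) ≡ b (v == y) + occ v (lst (y ∷ q)))
  orient {y} {x ∷ p} (here refl) = p , ↭-refl , (λ u v → refl) , λ v → refl
  orient {y} {x ∷ p} (there (here refl)) with reverse (x ∷ p) | hd-reverse (x ∷ p) | lst-reverse (x ∷ p) | ↭-reverse (x ∷ p) | (λ u v → ec-reverse u v (x ∷ p))
  ... | y ∷ q | refl | e₂ | p↭ | ecr = q , ↭-sym p↭ , ecr ,
    λ v → trans (+-comm (b (v == x)) _) (cong₂ _+_ (+-identityʳ _) (trans (symm (+-identityʳ _)) (cong (occ v) (symm e₂))))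

b-⊕ : ∀ {n} (G : Graph n) {a x : Fin n} → adj G a x ≡ false → ∀ u v → b (adj (G ⊕ (a , x)) u v) ≡ b (isE a x u v) + b (adj G u v)
b-⊕ G {a} {x} na u v with isE a x u v in e
... | false = cong b (xor-identityʳ _)
... | true with isE-ends a x u v e
...   | _ , inj₁ (refl , refl) rewrite na = refl
...   | _ , inj₂ (refl , refl) rewrite trans (Graph.sym G x a) na = refl

-- The paths through `a` are cut into arms, the others supply the free ends. After the flips found
-- by `reach`, the free path that ends at `y` is prolonged to `a`. In the balance of ends, `y` loses
-- its free end but gains the tip of an arm, so that in total one end moves from `x` to `a`; the
-- equation is additive to avoid subtraction.
add-edge : ∀ {n} {G : Graph n} {ps} → Decomposes G ps → (a : Fin n) (X Z : List (Fin n)) → Unique X →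
  (∀ {x} → x ∈ X → x ≢ a × adj G a x ≡ false) →
  (∀ c → adj G a c ≡ true → c ∈ Z ⊎ 1 ≤ occ c (endsOf ps)) →
  length Z < Σ[ X ] (λ x → occ x (endsOf ps)) →
  ∃₂ λ x ps* → x ∈ X × Decomposes (G ⊕ (a , x)) ps* × length ps* ≡ length ps
    × (∀ v → b (v == x) + occ v (endsOf ps*) ≡ b (v == a) + occ v (endsOf ps))
add-edge {n} {G} {ps} (us , c) a X Z uX nonadj cov big = finish
  where
  open Star {n} a
  T = proj₁ (star-view ps)
  Av = proj₁ (proj₂ (star-view ps))
  perm = proj₁ (proj₂ (proj₂ (star-view ps)))
  avoid = proj₂ (proj₂ (proj₂ (star-view ps)))
  L = arms T
  Fr = endsOf Av
  us′ = All-resp-↭ perm us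
  S = λ u v → Σ[ L ] (ec u v)
  R = λ (l : List (Fin n)) u v → Σ[ l ] (λ r → b (isE a r u v))
  emp = λ v → Σ[ L ] (λ α → occ v (e₁ (lst α)))

  cnt-split : ∀ u v → (S u v + R (roots L) u v) + cnt u v Av ≡ b (adj G u v)
  cnt-split u v = trans (symm (trans (Σ-↭ (ec u v) perm) (trans (Σ-++ (map join T) Av (ec u v)) (cong (_+ cnt u v Av) (cnt-join u v T))))) (c u v)

  occ-split : ∀ v → occ v (endsOf ps) ≡ (occ v (tips L) + emp v) + occ v Fr
  occ-split v = begin
    occ v (endsOf ps) ≡⟨ Σ-concatMap ends ps _ ⟩
    Σ[ ps ] (λ p → occ v (ends p)) ≡⟨ Σ-↭ _ perm ⟩
    Σ[ map join T ++ Av ] (λ p → occ v (ends p)) ≡⟨ Σ-++ (map join T) Av _ ⟩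
    Σ[ map join T ] (λ p → occ v (ends p)) + Σ[ Av ] (λ p → occ v (ends p)) ≡⟨ cong₂ _+_ (symm (Σ-concatMap ends (map join T) _)) (symm (Σ-concatMap ends Av _)) ⟩
    occ v (endsOf (map join T)) + occ v Fr ≡⟨ cong (_+ occ v Fr) (occ-ends-join v T) ⟩
    (occ v (tips L) + emp v) + occ v Fr ∎
    where open ≡-Reasoning

  occ-≢a : ∀ {v} → v ≢ a → occ v (endsOf ps) ≡ occ v (tips L ++ Fr)
  occ-≢a {v} v≢a = trans (occ-split v) (trans (cong (_+ occ v Fr) (trans (cong (occ v (tips L) +_) (occ-e₁ v≢a L)) (+-identityʳ _))) (symm (Σ-++ (tips L) Fr _)))

  R-occ : ∀ {v} → v ≢ a → ∀ l → occ v l ≤ R l a v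
  R-occ {v} v≢a l = Σ-mono l λ r → go r (v ≟ r)
    where
    go : ∀ r → Dec (v ≡ r) → b (v == r) ≤ b (isE a r a v)
    go r (no v≢r) = ≤-trans (≤-reflexive (cong b (==-≢ v≢r))) z≤n
    go r (yes refl) = ≤-trans (b≤1 (v == v)) (≤-reflexive (symm (cong b (isE-here (≢-sym v≢a)))))

  R≤adj : ∀ u v → R (roots L) u v ≤ b (adj G u v)
  R≤adj u v = ≤-trans (≤-trans (m≤n+m _ (S u v)) (m≤m+n _ (cnt u v Av))) (≤-reflexive (cnt-split u v))

  root≢a : ∀ {r} T → All Unique (map join T) → r ∈ roots (arms T) → r ≢ a
  root≢a ((α , β) ∷ T) (u ∷ us) r∈ refl with ∈-++⁻ (hd α) r∈
  ... | inj₁ q = Unique-++-∉ (reverse α) u (∈-resp-↭ (↭-sym (↭-reverse α)) (hd-∈ q)) (here refl)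
  ... | inj₂ r∈′ with ∈-++⁻ (hd β) r∈′
  ...   | inj₂ q = root≢a T us q refl
  ...   | inj₁ q = Uniqueₚ.Unique[x∷xs]⇒x∉xs (Unique-++ʳ (reverse α) u) (hd-∈ q)

  usT : All Unique (map join T)
  usT = Allₚ.++⁻ˡ (map join T) us′

  root-adj : ∀ {r} → r ∈ roots L → adj G a r ≡ true
  root-adj r∈ = 1≤b (≤-trans (≤-trans (occ-∈ r∈) (R-occ (root≢a T usT r∈) (roots L))) (R≤adj a _))

  uq : Unique (X ++ roots L)
  uq = Uniqueₚ.++⁺ uX (occ≤1⇒Unique (roots L) le) (λ (x∈ , r∈) → true≢false (root-adj r∈) (proj₂ (nonadj x∈)))
    where
    le : ∀ v → occ v (roots L) ≤ 1
    le v with v ≟ a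
    ... | yes refl = ≤-trans (≤-reflexive (occ-∉ (λ r∈ → root≢a T usT r∈ refl))) z≤n
    ... | no v≢a = ≤-trans (≤-trans (R-occ v≢a (roots L)) (R≤adj a v)) (b≤1 _)

  cov′ : ∀ c → c ∈ roots L → c ∈ Z ⊎ c ∈ tips L ++ Fr
  cov′ c c∈ with cov c (root-adj c∈)
  ... | inj₁ z = inj₁ z
  ... | inj₂ d = inj₂ (∈-occ (tips L ++ Fr) (subst (1 ≤_) (occ-≢a (root≢a T usT c∈)) d))

  big′ : length Z < Σ[ X ] (λ x → occ x (tips L ++ Fr))
  big′ = subst (length Z <_) (Σ-cong-∈ X (λ x∈ → occ-≢a (proj₁ (nonadj x∈)))) big
    where
    Σ-cong-∈ : ∀ {f g : Fin n → ℕ} xs → (∀ {x} → x ∈ xs → f x ≡ g x) → Σ[ xs ] f ≡ Σ[ xs ] g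
    Σ-cong-∈ [] h = refl
    Σ-cong-∈ (x ∷ xs) h = cong₂ _+_ (h (here refl)) (Σ-cong-∈ xs (h ∘ there))

  finish : ∃₂ λ x ps* → x ∈ X × Decomposes (G ⊕ (a , x)) ps* × length ps* ≡ length ps
    × (∀ v → b (v == x) + occ v (endsOf ps*) ≡ b (v == a) + occ v (endsOf ps))
  finish with reach (length L) L Fr X Z ≤-refl uq cov′ big′
  ... | x , y , x∈ , y∈ , L* , fl , er , et with unarms T fl usT
  ... | T* , refl , usT* , lenT with find-path Av y∈
    where
    find-path : ∀ Av {y} → y ∈ endsOf Av → ∃ λ p → p ∈ Av × y ∈ ends p
    find-path (p ∷ Av) y∈ with ∈-++⁻ (ends p) y∈
    ... | inj₁ q = p , here refl , q
    ... | inj₂ q with p′ , p′∈ , q′ ← find-path Av q = p′ , there p′∈ , q′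
  ... | p , p∈ , y∈p with ∈⇒↭ p∈ | orient {y} {p} y∈p
  ... | Av′ , pav | q , pq , ecq , endq =
    x , ps* , x∈ , (us* , cnt*) , len* , ends*
    where
    ps* = (a ∷ y ∷ q) ∷ map join T* ++ Av′
    us* : All Unique ps*
    us* with All-resp-↭ pav (Allₚ.++⁻ʳ (map join T) us′) | All-resp-↭ pav avoid
    ... | up ∷ uAv | a∉p ∷ _ = (All.tabulate (λ {z} z∈ a≡z → a∉p (∈-resp-↭ (↭-sym pq) (subst (_∈ y ∷ q) (symm a≡z) z∈))) ∷ Unique-↭ pq up) ∷ Allₚ.++⁺ usT* uAv
    len* : length ps* ≡ length ps
    len* = begin
      suc (length (map join T* ++ Av′)) ≡⟨ cong suc (trans (length-++ (map join T*)) (cong (_+ length Av′) (trans (length-map join T*) (trans lenT (symm (length-map join T)))))) ⟩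
      suc (length (map join T) + length Av′) ≡⟨ symm (+-suc _ _) ⟩
      length (map join T) + suc (length Av′) ≡⟨ cong (length (map join T) +_) (symm (↭-length pav)) ⟩
      length (map join T) + length Av ≡⟨ symm (length-++ (map join T)) ⟩
      length (map join T ++ Av) ≡⟨ symm (↭-length perm) ⟩
      length ps ∎
      where open ≡-Reasoning
    open +-*-Solver
    cnt* : ∀ u v → cnt u v ps* ≡ b (adj (G ⊕ (a , x)) u v)
    cnt* u v = begin
      b (isE a y u v) + ec u v (y ∷ q) + cnt u v (map join T* ++ Av′)
        ≡⟨ cong₂ (λ e k → b (isE a y u v) + e + k) (ecq u v) (trans (Σ-++ (map join T*) Av′ (ec u v)) (cong (_+ cnt u v Av′) (trans (cnt-join u v T*) (cong (_+ R (roots (arms T*)) u v) (flip-Σ (ec u v) (ec-reverse u v) fl))))) ⟩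
      b (isE a y u v) + ec u v p + ((S u v + R (roots (arms T*)) u v) + cnt u v Av′)
        ≡⟨ solve 5 (λ y e s r k → y :+ e :+ ((s :+ r) :+ k) := (s :+ (y :+ r)) :+ (e :+ k)) refl (b (isE a y u v)) (ec u v p) (S u v) (R (roots (arms T*)) u v) (cnt u v Av′) ⟩
      (S u v + R (y ∷ roots (arms T*)) u v) + (ec u v p + cnt u v Av′)
        ≡⟨ cong₂ (λ r k → (S u v + r) + k) (Σ-↭ _ er) (symm (Σ-↭ (ec u v) pav)) ⟩
      (S u v + (b (isE a x u v) + R (roots L) u v)) + cnt u v Av
        ≡⟨ solve 4 (λ s x r k → (s :+ (x :+ r)) :+ k := x :+ ((s :+ r) :+ k)) refl (S u v) (b (isE a x u v)) (R (roots L) u v) (cnt u v Av) ⟩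
      b (isE a x u v) + ((S u v + R (roots L) u v) + cnt u v Av) ≡⟨ cong (b (isE a x u v) +_) (cnt-split u v) ⟩
      b (isE a x u v) + b (adj G u v) ≡⟨ symm (b-⊕ G (proj₂ (nonadj x∈)) u v) ⟩
      _ ∎
      where open ≡-Reasoning
    ends* : ∀ v → b (v == x) + occ v (endsOf ps*) ≡ b (v == a) + occ v (endsOf ps)
    ends* v = begin
      bx + occ v (endsOf ps*) ≡⟨ cong (bx +_) (trans (Σ-++ (ends (a ∷ y ∷ q)) (endsOf (map join T* ++ Av′)) _) (cong (ba + l +_) E*)) ⟩
      bx + ((ba + l) + ((t* + emp v) + k)) ≡⟨ solve 6 (λ x a l t e k → x :+ ((a :+ l) :+ ((t :+ e) :+ k)) := a :+ (((x :+ t) :+ e) :+ (l :+ k))) refl bx ba l t* (emp v) k ⟩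
      ba + (((bx + t*) + emp v) + (l + k)) ≡⟨ cong (λ z → ba + ((z + emp v) + (l + k))) (Σ-↭ (λ z → b (v == z)) et) ⟩
      ba + (((by + t) + emp v) + (l + k)) ≡⟨ solve 6 (λ a y t e l k → a :+ (((y :+ t) :+ e) :+ (l :+ k)) := a :+ ((t :+ e) :+ ((y :+ l) :+ k))) refl ba by t (emp v) l k ⟩
      ba + ((t + emp v) + ((by + l) + k)) ≡⟨ cong (λ z → ba + ((t + emp v) + z)) (symm Fr-split) ⟩
      ba + ((t + emp v) + occ v Fr) ≡⟨ cong (ba +_) (symm (occ-split v)) ⟩
      ba + occ v (endsOf ps) ∎
      where
      open ≡-Reasoning
      bx = b (v == x)
      by = b (v == y)
      ba = b (v == a)
      l = occ v (lst (y ∷ q))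
      k = occ v (endsOf Av′)
      t = occ v (tips L)
      t* = occ v (tips (arms T*))
      Fr-split : occ v Fr ≡ (by + l) + k
      Fr-split = trans (Σ-concatMap ends Av _) (trans (Σ-↭ _ pav) (cong₂ _+_ (endq v) (symm (Σ-concatMap ends Av′ _))))
      E* : occ v (endsOf (map join T* ++ Av′)) ≡ (t* + emp v) + k
      E* = trans (cong (occ v) (concatMap-++ ends (map join T*) Av′)) (trans (Σ-++ (endsOf (map join T*)) (endsOf Av′) _)
        (cong (_+ k) (trans (occ-ends-join v T*) (cong (t* +_) (flip-Σ (λ α → occ v (e₁ (lst α))) (λ α → cong (occ v) (e₁-reverse α)) fl)))))

-- Decompositions with at most k paths, and restoring a deleted edge

record State {n} (G : Graph n) (k : ℕ) : Set where
  constructor state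
  field
    paths : List (List (Fin n))
    decomposes : Decomposes G paths
    bound : length paths ≤ k
open State

-- A path with a single vertex has two ends there.
D : ∀ {n} {G : Graph n} {k} → State G k → Fin n → ℕ
D s v = occ v (endsOf (paths s))

cast : ∀ {n} {G G′ : Graph n} {k} → G ≈ G′ → State G k → State G′ k
cast h (state ps (us , c) len) = state ps (us , λ u v → trans (c u v) (cong b (h u v))) len

par-D : ∀ {n} {G : Graph n} {k} (s : State G k) v → odd (D s v) ≡ par G v
par-D {G = G} s v = odd-ends {G = G} (decomposes s) v

odd-D : ∀ {n} {G : Graph n} {k} (s : State G k) {v} → par G v ≡ true → 1 ≤ D s v
odd-D s {v} p = odd⇒≥1 (trans (par-D s v) p)

Upd : ∀ {n} {G G′ : Graph n} {k} → Fin n → Fin n → State G k → State G′ k → Set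
Upd {n} a x s s′ = ∀ (v : Fin n) → b (v == x) + D s′ v ≡ b (v == a) + D s v

upd-≥ : ∀ {n} {G G′ : Graph n} {k} {a x} {s : State G k} {s′ : State G′ k} → Upd a x s s′ → ∀ {v} → v ≢ x → D s v ≤ D s′ v
upd-≥ {a = a} {x} {s} {s′} h {v} v≢x = ≤-trans (m≤n+m _ (b (v == a))) (≤-reflexive (trans (symm (h v)) (cong (λ c → b c + D s′ v) (==-≢ v≢x))))

upd-gain : ∀ {n} {G G′ : Graph n} {k} {a x} {s : State G k} {s′ : State G′ k} → Upd a x s s′ → a ≢ x → suc (D s a) ≤ D s′ a
upd-gain {a = a} {x} {s} {s′} h a≢x = ≤-reflexive (trans (cong (λ c → b c + D s a) (symm (==-refl a))) (trans (symm (h a)) (cong (λ c → b c + D s′ a) (==-≢ a≢x))))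

upd-loss : ∀ {n} {G G′ : Graph n} {k} {a x} {s : State G k} {s′ : State G′ k} → Upd a x s s′ → D s x ≤ suc (D s′ x)
upd-loss {a = a} {x} {s} {s′} h = ≤-trans (m≤n+m _ (b (x == a))) (≤-reflexive (trans (symm (h x)) (cong (λ c → b c + D s′ x) (==-refl x))))

abstract

  restore-any : ∀ {n} {Γ : Graph n} {k} (s : State Γ k) (a : Fin n) (X Z : List (Fin n)) → Unique X →
    (∀ {x} → x ∈ X → x ≢ a × adj Γ a x ≡ false) →
    (∀ c → adj Γ a c ≡ true → c ∈ Z ⊎ 1 ≤ D s c) →
    length Z < Σ[ X ] (D s) →
    ∃ λ x → x ∈ X × Σ (State (Γ ⊕ (a , x)) k) (Upd a x s)
  restore-any {Γ = Γ} (state ps d len) a X Z u na cov big with add-edge {G = Γ} {ps} d a X Z u na cov big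
  ... | x , ps* , x∈ , d* , len* , upd = x , x∈ , state ps* d* (≤-trans (≤-reflexive len*) len) , upd

adj-≢ : ∀ {n} (G : Graph n) {u v} → adj G u v ≡ true → u ≢ v
adj-≢ G e refl = true≢false e (irrefl G _)

removed : ∀ {n} (Γ : Graph n) {a x} → adj Γ a x ≡ true → adj (Γ ⊕ (a , x)) a x ≡ false
removed Γ {a} {x} e = cong₂ _xor_ e (isE-here (adj-≢ Γ e))

still-adj : ∀ {n} (Γ : Graph n) {a x} → adj Γ a x ≡ true → ∀ u v → adj (Γ ⊕ (a , x)) u v ≡ true → adj Γ u v ≡ true
still-adj Γ {a} {x} e u v h with isE a x u v in q
... | false = trans (symm (xor-identityʳ _)) h
... | true with isE-ends a x u v q
...   | _ , inj₁ (refl , refl) = e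
...   | _ , inj₂ (refl , refl) = trans (Graph.sym Γ x a) e

abstract

  -- With a single candidate, the ends at `x` alone must outnumber the neighbours of `a` that may
  -- lack one; the requirements of one, two or three ends further on come from here. The relation
  -- `Γ′ ≈ Γ ⊕ (a , x)` allows the edge to be added at either endpoint, whichever way round it was
  -- deleted.
  restore : ∀ {n} (Γ : Graph n) {Γ′ : Graph n} {k} (s : State Γ′ k) (a x : Fin n) → Γ′ ≈ Γ ⊕ (a , x) → adj Γ a x ≡ true → (Z : List (Fin n)) →
    (∀ c → adj Γ a c ≡ true → c ≢ x → c ∈ Z ⊎ 1 ≤ D s c) → length Z < D s x →
    Σ (State Γ k) (Upd a x s)
  restore Γ {Γ′} {k} s a x h e Z cov big =
    back (restore-any (cast {G = Γ′} {Γ ⊕ (a , x)} h s) a (x ∷ []) Z ([] ∷ []) (λ { (here refl) → ≢-sym (adj-≢ Γ e) , removed Γ e })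
      (λ c q → cov c (still-adj Γ e a c q) (λ { refl → true≢false q (removed Γ e) })) (≤-trans big (m≤m+n _ 0)))
    where
    back : (∃ λ z → z ∈ x ∷ [] × Σ (State (Γ ⊕ (a , x) ⊕ (a , z)) k) (Upd a z s)) → Σ (State Γ k) (Upd a x s)
    back (_ , here refl , s′ , upd) = cast {G = Γ ⊕ (a , x) ⊕ (a , x)} {Γ} (⊕-cancel Γ (a , x)) s′ , upd

-- The induction measure, and parities after one deletion

edges : ∀ {n} → Graph n → ℕ
edges {n} G = Σ[ allFin n ] (deg G)

Σ-< : ∀ {A : Set} {xs : List A} {f g : A → ℕ} {x} → (∀ x → f x ≤ g x) → x ∈ xs → f x < g x → Σ[ xs ] f < Σ[ xs ] g
Σ-< {xs = _ ∷ xs} h (here refl) lt = +-mono-<-≤ lt (Σ-mono xs h)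
Σ-< h (there x∈) lt = +-mono-≤-< (h _) (Σ-< h x∈ lt)

b-mono : ∀ {x y} → (x ≡ true → y ≡ true) → b x ≤ b y
b-mono {false} _ = z≤n
b-mono {true} h = ≤-reflexive (cong b (symm (h refl)))

edges-⊕ : ∀ {n} (G : Graph n) {a x} → adj G a x ≡ true → edges (G ⊕ (a , x)) < edges G
edges-⊕ {n} G {a} {x} e = Σ-< (λ v → Σ-mono (allFin n) (λ u → le v u)) (∈-allFin a)
  (Σ-< (le a) (∈-allFin x) (≤-trans (≤-reflexive (cong (suc ∘ b) (removed G e))) (≤-reflexive (cong b (symm e)))))
  where
  le : ∀ v u → b (adj (G ⊕ (a , x)) v u) ≤ b (adj G v u)
  le v u = b-mono (still-adj G e v u)

edges-≥1 : ∀ {n} (G : Graph n) {a x} → adj G a x ≡ true → 1 ≤ edges G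
edges-≥1 {n} G {a} {x} e = ≤-trans (≤-trans (≤-reflexive (cong b (symm e))) (Σ-member (λ u → b (adj G a u)) (∈-allFin x))) (Σ-member (deg G) (∈-allFin a))

par-end₁ : ∀ {n} (G : Graph n) {x y : Fin n} → x ≢ y → par (G ⊕ (x , y)) x ≡ not (par G x)
par-end₁ G {x} {y} x≢y rewrite par-⊕ G x≢y x | ==-refl x | ==-≢ x≢y = xor-comm (par G x) true

par-end₂ : ∀ {n} (G : Graph n) {x y : Fin n} → x ≢ y → par (G ⊕ (x , y)) y ≡ not (par G y)
par-end₂ G {x} {y} x≢y rewrite par-⊕ G x≢y y | ==-refl y | ==-≢ (≢-sym x≢y) = xor-comm (par G y) true

par-other : ∀ {n} (G : Graph n) {x y v : Fin n} → x ≢ y → v ≢ x → v ≢ y → par (G ⊕ (x , y)) v ≡ par G v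
par-other G {x} {y} {v} x≢y v≢x v≢y rewrite par-⊕ G x≢y v | ==-≢ v≢x | ==-≢ v≢y = xor-identityʳ _

adj-other : ∀ {n} (G : Graph n) {x y v : Fin n} → v ≢ x → v ≢ y → ∀ u → adj (G ⊕ (x , y)) v u ≡ adj G v u
adj-other G {x} {y} {v} v≢x v≢y u = trans (cong (adj G v u xor_) (isE-other v≢x v≢y u)) (xor-identityʳ _)

-- Lovász: graphs with at most one vertex of positive even degree

Isolated : ∀ {n} → Graph n → Fin n → Set
Isolated G v = ∀ u → adj G v u ≡ false

odd# : ∀ {n} → Graph n → ℕ
odd# {n} G = Σ[ allFin n ] (λ v → b (par G v))

odd#-move : ∀ {n} (G : Graph n) {z x} → z ≢ x → par G z ≡ true → par G x ≡ false → odd# (G ⊕ (z , x)) ≡ odd# G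
odd#-move {n} G {z} {x} z≢x pz px = +-cancelʳ-≡ 1 _ _ (begin
  odd# (G ⊕ (z , x)) + 1 ≡⟨ cong (odd# (G ⊕ (z , x)) +_) (symm (Σ-indicator z)) ⟩
  odd# (G ⊕ (z , x)) + Σ[ allFin n ] (λ v → b (v == z)) ≡⟨ symm (Σ-+ (allFin n) (λ v → b (par (G ⊕ (z , x)) v)) _) ⟩
  Σ[ allFin n ] (λ v → b (par (G ⊕ (z , x)) v) + b (v == z)) ≡⟨ Σ-cong (allFin n) pointwise ⟩
  Σ[ allFin n ] (λ v → b (par G v) + b (v == x)) ≡⟨ Σ-+ (allFin n) (λ v → b (par G v)) _ ⟩
  odd# G + Σ[ allFin n ] (λ v → b (v == x)) ≡⟨ cong (odd# G +_) (Σ-indicator x) ⟩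
  odd# G + 1 ∎)
  where
  open ≡-Reasoning
  pointwise : ∀ v → b (par (G ⊕ (z , x)) v) + b (v == z) ≡ b (par G v) + b (v == x)
  pointwise v rewrite par-⊕ G z≢x v with v ≟ z | v ≟ x
  ... | yes refl | yes e = contradiction e z≢x
  ... | yes refl | no _ rewrite pz = refl
  ... | no _ | yes refl rewrite px = refl
  ... | no _ | no _ = cong (_+ 0) (cong b (xor-identityʳ _))

odd#-drop : ∀ {n} (G : Graph n) {z x} → z ≢ x → par G z ≡ true → par G x ≡ true → odd# (G ⊕ (z , x)) + 2 ≡ odd# G
odd#-drop {n} G {z} {x} z≢x pz px = begin
  odd# (G ⊕ (z , x)) + 2 ≡⟨ cong (odd# (G ⊕ (z , x)) +_) (symm (trans (Σ-+ (allFin n) (λ v → b (v == z)) _) (cong₂ _+_ (Σ-indicator z) (Σ-indicator x)))) ⟩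
  odd# (G ⊕ (z , x)) + Σ[ allFin n ] (λ v → b (v == z) + b (v == x)) ≡⟨ symm (Σ-+ (allFin n) (λ v → b (par (G ⊕ (z , x)) v)) _) ⟩
  Σ[ allFin n ] (λ v → b (par (G ⊕ (z , x)) v) + (b (v == z) + b (v == x))) ≡⟨ Σ-cong (allFin n) pointwise ⟩
  odd# G ∎
  where
  open ≡-Reasoning
  pointwise : ∀ v → b (par (G ⊕ (z , x)) v) + (b (v == z) + b (v == x)) ≡ b (par G v)
  pointwise v rewrite par-⊕ G z≢x v with v ≟ z | v ≟ x
  ... | yes refl | yes e = contradiction e z≢x
  ... | yes refl | no _ rewrite pz = refl
  ... | no _ | yes refl rewrite px = refl
  ... | no _ | no _ = trans (+-identityʳ _) (cong b (xor-identityʳ _))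

isolated-⊕ : ∀ {n} (G : Graph n) {x y v} → adj G x y ≡ true → Isolated G v → Isolated (G ⊕ (x , y)) v
isolated-⊕ G {x} {y} {v} e iso u = ≢true λ h → true≢false (still-adj G e v u h) (iso u)

keeps : ∀ {n} (G : Graph n) {x y v} → adj G x y ≡ true → v ≢ x → v ≢ y →
  par G v ≡ true ⊎ Isolated G v → par (G ⊕ (x , y)) v ≡ true ⊎ Isolated (G ⊕ (x , y)) v
keeps G xy v≢x v≢y (inj₁ p) = inj₁ (trans (par-other G (adj-≢ G xy) v≢x v≢y) p)
keeps G xy v≢x v≢y (inj₂ iso) = inj₂ (isolated-⊕ G xy iso)

odd-or-isolated : ∀ {n} (G : Graph n) {v u} → par G v ≡ true ⊎ Isolated G v → adj G v u ≡ true → par G v ≡ true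
odd-or-isolated G (inj₁ p) e = p
odd-or-isolated G {u = u} (inj₂ iso) e = ⊥-elim (true≢false e (iso u))

empty-state : ∀ {n} {G : Graph n} → (∀ u v → adj G u v ≡ false) → State G 0
empty-state h = state [] ([] , λ u v → cong b (symm (h u v))) z≤n

trivial-path : ∀ {n} {G : Graph n} {k} (y : Fin n) → State G k → Σ (State G (suc k)) λ s → 1 ≤ D s y
trivial-path y (state ps (us , c) len) = state ((y ∷ []) ∷ ps) (([] ∷ []) ∷ us , c) (s≤s len) , occ-∈ {v = y} {endsOf ((y ∷ []) ∷ ps)} (here refl)

adj? : ∀ {n} (G : Graph n) u v → Dec (adj G u v ≡ true)
adj? G u v = adj G u v ≟ᵇ true

nbr? : ∀ {n} (G : Graph n) x → (∃ λ z → adj G x z ≡ true) ⊎ Isolated G x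
nbr? G x with any? (adj? G x)
... | yes p = inj₁ p
... | no ¬p = inj₂ λ u → ≢true λ e → ¬p (u , e)

mutual
  -- Deleting an edge `z x` at an even `x` makes `x` odd and `z` the new exception, while the number
  -- of odd vertices is unchanged. The edge can be added again at `z`, since all other neighbours of
  -- `z` are odd.
  lovász₁ : ∀ {n} f (G : Graph n) → edges G ≤ f → (x : Fin n) → (∀ v → v ≢ x → par G v ≡ true ⊎ Isolated G v) →
    ∃ λ k → State G k × k * 2 ≤ odd# G
  lovász₁ f G ef x hyp with par G x in px | nbr? G x
  ... | false | inj₁ (z , xz) = move f ef
    where
    zx : adj G z x ≡ true
    zx = trans (Graph.sym G z x) xz
    z≢x = adj-≢ G zx
    pz = odd-or-isolated G (hyp z z≢x) zx
    G₁ = G ⊕ (z , x)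
    hyp₁ : ∀ v → v ≢ z → par G₁ v ≡ true ⊎ Isolated G₁ v
    hyp₁ v v≢z = case v ≟ x of λ where
      (yes refl) → inj₁ (trans (par-end₂ G z≢x) (cong not px))
      (no v≢x) → keeps G zx v≢z v≢x (hyp v v≢x)
    move : ∀ f → edges G ≤ f → ∃ λ k → State G k × k * 2 ≤ odd# G
    move zero h = ⊥-elim (n≮0 (≤-trans (edges-≥1 G zx) h))
    move (suc f) h with lovász₁ f G₁ (≤-pred (≤-trans (edges-⊕ G zx) h)) z hyp₁
    ... | k , s , le = k , proj₁ (restore G s z x (λ _ _ → refl) zx [] cov (odd-D s (trans (par-end₂ G z≢x) (cong not px)))) , subst (k * 2 ≤_) (odd#-move G z≢x pz px) le
      where
      cov : ∀ c → adj G z c ≡ true → c ≢ x → c ∈ [] ⊎ 1 ≤ D s c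
      cov c e c≢x = inj₂ (odd-D s (trans (par-other G z≢x (≢-sym (adj-≢ G e)) c≢x) (odd-or-isolated G (hyp c c≢x) (trans (Graph.sym G c z) e))))
  ... | true | _ = lovász₀ f G ef λ v → case v ≟ x of λ where
    (yes refl) → inj₁ px
    (no v≢x) → hyp v v≢x
  ... | false | inj₂ iso = lovász₀ f G ef λ v → case v ≟ x of λ where
    (yes refl) → inj₂ iso
    (no v≢x) → hyp v v≢x

  -- Deleting an edge `x y` leaves two even vertices, one more than `lovász₁` tolerates; hence the
  -- variant `lovászₘ` with a prescribed end at `y`. The two odd vertices lost match the `+ 2` in
  -- its bound.
  lovász₀ : ∀ {n} f (G : Graph n) → edges G ≤ f → (∀ v → par G v ≡ true ⊎ Isolated G v) →
    ∃ λ k → State G k × k * 2 ≤ odd# G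
  lovász₀ f G ef hyp with any? (λ x → any? (λ y → adj? G x y))
  ... | no none = 0 , empty-state (λ u v → ≢true λ e → none (u , v , e)) , z≤n
  lovász₀ zero G ef hyp | yes (x , y , xy) = ⊥-elim (n≮0 (≤-trans (edges-≥1 G xy) ef))
  lovász₀ (suc f) G ef hyp | yes (x , y , xy) with lovászₘ f (G ⊕ (x , y)) (≤-pred (≤-trans (edges-⊕ G xy) ef)) y x x≢y py px hyp′
    where
    x≢y = adj-≢ G xy
    px : par (G ⊕ (x , y)) x ≡ false
    px = trans (par-end₁ G x≢y) (cong not (odd-or-isolated G (hyp x) xy))
    py : par (G ⊕ (x , y)) y ≡ false
    py = trans (par-end₂ G x≢y) (cong not (odd-or-isolated G (hyp y) (trans (Graph.sym G y x) xy)))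
    hyp′ : ∀ v → v ≢ y → v ≢ x → par (G ⊕ (x , y)) v ≡ true ⊎ Isolated (G ⊕ (x , y)) v
    hyp′ v v≢y v≢x = keeps G xy v≢x v≢y (hyp v)
  ... | k , s , le , dy = k , proj₁ (restore G s x y (λ _ _ → refl) xy [] cov dy) ,
      subst (k * 2 ≤_) (odd#-drop G (adj-≢ G xy) (odd-or-isolated G (hyp x) xy) (odd-or-isolated G (hyp y) (trans (Graph.sym G y x) xy))) le
    where
    cov : ∀ c → adj G x c ≡ true → c ≢ y → c ∈ [] ⊎ 1 ≤ D s c
    cov c e c≢y = inj₂ (odd-D s (trans (par-other G (adj-≢ G xy) (≢-sym (adj-≢ G e)) c≢y) (odd-or-isolated G (hyp c) (trans (Graph.sym G c x) e))))

  -- The prescribed end at y plays the role of a pendant edge at y.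
  lovászₘ : ∀ {n} f (G : Graph n) → edges G ≤ f → (y x : Fin n) → x ≢ y → par G y ≡ false → par G x ≡ false →
    (∀ v → v ≢ y → v ≢ x → par G v ≡ true ⊎ Isolated G v) →
    ∃ λ k → Σ (State G k) λ s → k * 2 ≤ odd# G + 2 × 1 ≤ D s y
  lovászₘ f G ef y x x≢y py px hyp with nbr? G x
  ... | inj₂ iso with lovász₁ f G ef y (λ v v≢y → case v ≟ x of λ where
                        (yes refl) → inj₂ iso
                        (no v≢x) → hyp v v≢y v≢x)
  -- The path consisting of `y` alone provides the end; it is the additional path that `+ 2` allows.
  ...   | k , s , le = suc k , proj₁ (trivial-path y s) , ≤-trans (+-monoʳ-≤ 2 le) (≤-reflexive (+-comm 2 (odd# G))) , proj₂ (trivial-path y s)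
  lovászₘ zero G ef y x x≢y py px hyp | inj₁ (z , xz) = ⊥-elim (n≮0 (≤-trans (edges-≥1 G xz) ef))
  lovászₘ (suc f) G ef y x x≢y py px hyp | inj₁ (z , xz) with z ≟ y
  -- Deleting `y x` makes both vertices odd, which accounts for `+ 2`; adding the edge again at `y`
  -- leaves an end there.
  ... | yes refl with lovász₁ f (G ⊕ (y , x)) (≤-pred (≤-trans (edges-⊕ G yx) ef)) y hyp′
    where
    yx = trans (Graph.sym G y x) xz
    hyp′ : ∀ v → v ≢ y → par (G ⊕ (y , x)) v ≡ true ⊎ Isolated (G ⊕ (y , x)) v
    hyp′ v v≢y = case v ≟ x of λ where
      (yes refl) → inj₁ (trans (par-end₂ G (≢-sym x≢y)) (cong not px))
      (no v≢x) → keeps G yx v≢y v≢x (hyp v v≢y v≢x)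
  ...   | k , s , le = k , proj₁ r , ≤-trans le (≤-reflexive odd#≡) , ≤-trans (s≤s z≤n) (upd-gain {s = s} {proj₁ r} (proj₂ r) (≢-sym x≢y))
    where
    y≢x = ≢-sym x≢y
    G₁ = G ⊕ (y , x)
    yx : adj G y x ≡ true
    yx = trans (Graph.sym G y x) xz
    cov : ∀ c → adj G y c ≡ true → c ≢ x → c ∈ [] ⊎ 1 ≤ D s c
    cov c e c≢x = inj₂ (odd-D s (trans (par-other G y≢x (≢-sym (adj-≢ G e)) c≢x) (odd-or-isolated G (hyp c (≢-sym (adj-≢ G e)) c≢x) (trans (Graph.sym G c y) e))))
    r = restore G s y x (λ _ _ → refl) yx [] cov (odd-D s (trans (par-end₂ G y≢x) (cong not px)))
    odd#≡ : odd# G₁ ≡ odd# G + 2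
    odd#≡ = trans (symm (odd#-drop G₁ y≢x (trans (par-end₁ G y≢x) (cong not py)) (trans (par-end₂ G y≢x) (cong not px))))
      (cong (_+ 2) (Σ-cong (allFin _) (λ v → cong b (par-≈ {G = G₁ ⊕ (y , x)} {G} (⊕-cancel G (y , x)) v))))
  lovászₘ (suc f) G ef y x x≢y py px hyp | inj₁ (z , xz) | no z≢y with lovászₘ f (G ⊕ (z , x)) (≤-pred (≤-trans (edges-⊕ G zx) ef)) y z z≢y py₁ pz₁ hyp′
    where
    zx = trans (Graph.sym G z x) xz
    z≢x = adj-≢ G zx
    py₁ : par (G ⊕ (z , x)) y ≡ false
    py₁ = trans (par-other G z≢x (≢-sym z≢y) (≢-sym x≢y)) py
    pz₁ : par (G ⊕ (z , x)) z ≡ false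
    pz₁ = trans (par-end₁ G z≢x) (cong not (odd-or-isolated G (hyp z z≢y z≢x) zx))
    hyp′ : ∀ v → v ≢ y → v ≢ z → par (G ⊕ (z , x)) v ≡ true ⊎ Isolated (G ⊕ (z , x)) v
    hyp′ v v≢y v≢z = case v ≟ x of λ where
      (yes refl) → inj₁ (trans (par-end₂ G z≢x) (cong not px))
      (no v≢x) → keeps G zx v≢z v≢x (hyp v v≢y v≢x)
  ... | k , s , le , dy = k , proj₁ r , subst (λ m → k * 2 ≤ m + 2) (odd#-move G z≢x pz px) le , ≤-trans dy (upd-≥ {s = s} {proj₁ r} (proj₂ r) (≢-sym x≢y))
    where
    zx : adj G z x ≡ true
    zx = trans (Graph.sym G z x) xz
    z≢x = adj-≢ G zx
    pz = odd-or-isolated G (hyp z z≢y z≢x) zx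
    cov : ∀ c → adj G z c ≡ true → c ≢ x → c ∈ [] ⊎ 1 ≤ D s c
    cov c e c≢x = case c ≟ y of λ where
      (yes refl) → inj₂ dy
      (no c≢y) → inj₂ (odd-D s (trans (par-other G z≢x (≢-sym (adj-≢ G e)) c≢x) (odd-or-isolated G (hyp c c≢y c≢x) (trans (Graph.sym G c z) e))))
    r = restore G s z x (λ _ _ → refl) zx [] cov (odd-D s (trans (par-end₂ G z≢x) (cong not px)))

odd#≤n : ∀ {n} (G : Graph n) → odd# G ≤ n
odd#≤n {n} G = ≤-trans (Σ-mono (allFin n) (λ v → b≤1 (par G v))) (≤-reflexive (trans (ones (allFin n)) (length-tabulate id)))
  where
  ones : ∀ (xs : List (Fin n)) → Σ[ xs ] (λ _ → 1) ≡ length xs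
  ones [] = refl
  ones (_ ∷ xs) = cong suc (ones xs)

weaken : ∀ {n} {G : Graph n} {k l} → k ≤ l → State G k → State G l
weaken h (state ps d len) = state ps d (≤-trans len h)

lovász : ∀ {n} (G : Graph n) → (∀ v → par G v ≡ true ⊎ Isolated G v) → State G (n / 2)
lovász {n} G hyp with lovász₀ (edges G) G ≤-refl hyp
... | k , s , le = weaken (≤-trans (≤-reflexive (symm (m*n/n≡m k 2))) (/-mono-≤ (≤-trans le (odd#≤n G)) ≤-refl)) s

-- Deleting several edges

eB : ∀ {n} → List (Edge n) → List (Fin n)
eB = concatMap (λ (a , x) → a ∷ x ∷ [])

-- The head is deleted last, so it must still be present after the deletion of the tail; in
-- particular no edge is listed twice.
Del : ∀ {n} → Graph n → List (Edge n) → Set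
Del G [] = ⊤
Del G ((a , x) ∷ B) = adj (G ⊕* B) a x ≡ true × Del G B

del-sub : ∀ {n} (G : Graph n) B → Del G B → ∀ {u v} → adj (G ⊕* B) u v ≡ true → adj G u v ≡ true
del-sub G [] _ h = h
del-sub G ((a , x) ∷ B) (e , d) {u} {v} h = del-sub G B d (still-adj (G ⊕* B) e u v h)

untouched-adj : ∀ {n} (G : Graph n) B {v} → v ∉ eB B → ∀ u → adj (G ⊕* B) v u ≡ adj G v u
untouched-adj G [] _ u = refl
untouched-adj G ((a , x) ∷ B) v∉ u =
  trans (adj-other (G ⊕* B) (λ e → v∉ (here e)) (λ e → v∉ (there (here e))) u) (untouched-adj G B (λ p → v∉ (there (there p))) u)

untouched-par : ∀ {n} (G : Graph n) B {v} → v ∉ eB B → par (G ⊕* B) v ≡ par G v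
untouched-par G B v∉ = par-row {G = G ⊕* B} {G} (untouched-adj G B v∉)

par-⊕* : ∀ {n} (G : Graph n) B → Del G B → ∀ v → par (G ⊕* B) v ≡ par G v xor odd (occ v (eB B))
par-⊕* G [] _ v = symm (xor-identityʳ _)
par-⊕* G ((a , x) ∷ B) (e , d) v = begin
  par (G ⊕* B ⊕ (a , x)) v ≡⟨ par-⊕ (G ⊕* B) (adj-≢ (G ⊕* B) e) v ⟩
  par (G ⊕* B) v xor ((v == a) xor (v == x)) ≡⟨ cong (_xor ((v == a) xor (v == x))) (par-⊕* G B d v) ⟩
  (par G v xor odd (occ v (eB B))) xor ((v == a) xor (v == x)) ≡⟨ xor-assoc (par G v) _ _ ⟩
  par G v xor (odd (occ v (eB B)) xor ((v == a) xor (v == x)))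
    ≡⟨ cong (par G v xor_) (trans (xor-comm (odd (occ v (eB B))) _) (trans (xor-assoc (v == a) _ _) (symm (two (v == a) (v == x))))) ⟩
  par G v xor odd (b (v == a) + (b (v == x) + occ v (eB B))) ∎
  where
  open ≡-Reasoning
  two : ∀ p q → odd (b p + (b q + occ v (eB B))) ≡ p xor (q xor odd (occ v (eB B)))
  two p q = trans (odd-+ (b p) _) (cong₂ _xor_ (odd-b p) (trans (odd-+ (b q) _) (cong (_xor odd (occ v (eB B))) (odd-b q))))

edges-⊕*-≤ : ∀ {n} (G : Graph n) B → Del G B → edges (G ⊕* B) ≤ edges G
edges-⊕*-≤ G [] _ = ≤-refl
edges-⊕*-≤ G (e ∷ B) (h , d) = ≤-trans (<⇒≤ (edges-⊕ (G ⊕* B) h)) (edges-⊕*-≤ G B d)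

edges-⊕* : ∀ {n} (G : Graph n) e B → Del G (e ∷ B) → edges (G ⊕* (e ∷ B)) < edges G
edges-⊕* G e B (h , d) = ≤-trans (edges-⊕ (G ⊕* B) h) (edges-⊕*-≤ G B d)

kept₁ : ∀ {n} (G : Graph n) B {a x} → adj G a x ≡ true → a ∉ eB B → adj (G ⊕* B) a x ≡ true
kept₁ G B {a} {x} e a∉ = trans (untouched-adj G B a∉ x) e

kept₂ : ∀ {n} (G : Graph n) B {a x} → adj G a x ≡ true → x ∉ eB B → adj (G ⊕* B) a x ≡ true
kept₂ G B {a} {x} e x∉ = trans (Graph.sym (G ⊕* B) a x) (kept₁ G B (trans (Graph.sym G x a) e) x∉)

star : ∀ {n} → Fin n → List (Fin n) → List (Edge n)
star w = map (w ,_)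

∈-star : ∀ {n} {w v : Fin n} X → v ∈ eB (star w X) → v ≡ w ⊎ v ∈ X
∈-star (x ∷ X) (here e) = inj₁ e
∈-star (x ∷ X) (there (here e)) = inj₂ (here e)
∈-star (x ∷ X) (there (there p)) with ∈-star X p
... | inj₁ e = inj₁ e
... | inj₂ q = inj₂ (there q)

∈-eB-star++ : ∀ {n} {w v : Fin n} X M → v ∈ eB (star w X ++ M) → v ≡ w ⊎ v ∈ X ++ eB M
∈-eB-star++ {w = w} X M v∈ with ∈-++⁻ (eB (star w X)) (subst (_ ∈_) (concatMap-++ _ (star w X) M) v∈)
... | inj₂ q = inj₂ (∈-++⁺ʳ X q)
... | inj₁ p with ∈-star X p
...   | inj₁ e = inj₁ e
...   | inj₂ q = inj₂ (∈-++⁺ˡ q)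

occ-star : ∀ {n} {w v : Fin n} X → v ≢ w → occ v (eB (star w X)) ≡ occ v X
occ-star [] _ = refl
occ-star {v = v} (x ∷ X) v≢w = cong₂ _+_ (cong b (==-≢ v≢w)) (cong (b (v == x) +_) (occ-star X v≢w))

occ-star-center : ∀ {n} {w : Fin n} X → w ∉ X → occ w (eB (star w X)) ≡ length X
occ-star-center [] _ = refl
occ-star-center {w = w} (x ∷ X) w∉ = cong₂ _+_ (cong b (==-refl w)) (cong₂ _+_ (cong b (==-≢ (w∉ ∘ here))) (occ-star-center X (w∉ ∘ there)))

del-matching : ∀ {n} (G : Graph n) M → Unique (eB M) → (∀ {a x} → (a , x) ∈ M → adj G a x ≡ true) → Del G M
del-matching G [] _ _ = tt
del-matching G ((a , x) ∷ M) ((_ ∷ a∉) ∷ _ ∷ u) h =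
  kept₁ G M (h (here refl)) (λ a∈ → All.lookup a∉ a∈ refl) , del-matching G M u (h ∘ there)

-- A star at `w` and a matching disjoint from it: every vertex touched other than `w` loses exactly
-- one edge and so changes parity, and the parity of `w` depends on the length of `X`.
module Cut {n} (G : Graph n) (w : Fin n) (X : List (Fin n)) (M : List (Edge n)) (uq : Unique (w ∷ X ++ eB M))
  (adjX : ∀ {x} → x ∈ X → adj G w x ≡ true) (adjM : ∀ {a x} → (a , x) ∈ M → adj G a x ≡ true) where

  B : List (Edge n)
  B = star w X ++ M

  w∉ : w ∉ X ++ eB M
  w∉ = Uniqueₚ.Unique[x∷xs]⇒x∉xs uq

  private
    uXM : Unique (X ++ eB M)
    uXM = Unique-++ʳ (w ∷ []) uq

    del-X : ∀ X → Unique (X ++ eB M) → w ∉ X ++ eB M → (∀ {x} → x ∈ X → adj G w x ≡ true) → Del G (star w X ++ M)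
    del-X [] u _ _ = del-matching G M u adjM
    del-X (x ∷ X) (x∉ ∷ u) w∉ h = kept₂ G (star w X ++ M) (h (here refl)) fresh , del-X X u (w∉ ∘ there) (h ∘ there)
      where
      fresh : x ∉ eB (star w X ++ M)
      fresh x∈ with ∈-eB-star++ X M x∈
      ... | inj₁ e = w∉ (here (symm e))
      ... | inj₂ q = All.lookup x∉ q refl

  del : Del G B
  del = del-X X uXM w∉ adjX

  occ-B : ∀ v → occ v (eB B) ≡ occ v (eB (star w X)) + occ v (eB M)
  occ-B v = trans (cong (occ v) (concatMap-++ _ (star w X) M)) (Σ-++ (eB (star w X)) (eB M) _)

  par-touched : ∀ {v} → v ∈ X ++ eB M → par (G ⊕* B) v ≡ not (par G v)
  par-touched {v} v∈ = trans (par-⊕* G B del v) (trans (cong (λ k → par G v xor odd k) once) (xor-comm (par G v) true))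
    where
    once : occ v (eB B) ≡ 1
    once = trans (occ-B v) (trans (cong (_+ occ v (eB M)) (occ-star {w = w} {v} X (λ { refl → w∉ v∈ })))
      (trans (symm (Σ-++ X (eB M) (λ x → b (v == x)))) (occ-Unique uXM v∈)))

  par-center : par (G ⊕* B) w ≡ par G w xor odd (length X)
  par-center = trans (par-⊕* G B del w) (cong (λ k → par G w xor odd k) (trans (occ-B w)
    (trans (cong₂ _+_ (occ-star-center X (w∉ ∘ ∈-++⁺ˡ)) (occ-∉ (w∉ ∘ ∈-++⁺ʳ X))) (+-identityʳ _))))

del-star : ∀ {n} (G : Graph n) {w} X → Unique (w ∷ X) → (∀ {x} → x ∈ X → adj G w x ≡ true) → Del G (star w X)
del-star G {w} X u h = subst (Del G) (++-identityʳ (star w X))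
  (Cut.del G w X [] (subst (λ l → Unique (w ∷ l)) (symm (++-identityʳ X)) u) h (λ ()))

-- The even subgraph and bad triangles

Ev Od : ∀ {n} → Graph n → Fin n → Set
Ev G v = par G v ≡ false
Od G v = par G v ≡ true

E : ∀ {n} → Graph n → Fin n → Fin n → Set
E G u v = adj G u v ≡ true × Ev G u × Ev G v

E? : ∀ {n} (G : Graph n) u v → Dec (E G u v)
E? G u v = adj? G u v ×-dec (par G u ≟ᵇ false) ×-dec (par G v ≟ᵇ false)

E-sym : ∀ {n} (G : Graph n) {u v} → E G u v → E G v u
E-sym G {u} {v} (e , p , q) = trans (Graph.sym G v u) e , q , p

E-≢ : ∀ {n} (G : Graph n) {u v} → E G u v → u ≢ v
E-≢ G (e , _) = adj-≢ G e

adj-sym : ∀ {n} (G : Graph n) {u v} → adj G u v ≡ true → adj G v u ≡ true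
adj-sym G {u} {v} e = trans (Graph.sym G v u) e

nbE : ∀ {n} → Graph n → Fin n → List (Fin n)
nbE {n} G v = filter (E? G v) (allFin n)

nbE-unique : ∀ {n} (G : Graph n) v → Unique (nbE G v)
nbE-unique {n} G v = Uniqueₚ.filter⁺ (E? G v) (Uniqueₚ.allFin⁺ n)

∈-nbE : ∀ {n} (G : Graph n) {v u} → E G v u → u ∈ nbE G v
∈-nbE G {v} e = ∈-filter⁺ (E? G v) (∈-allFin _) e

nbE-∈ : ∀ {n} (G : Graph n) {v u} → u ∈ nbE G v → E G v u
nbE-∈ G {v} u∈ = proj₂ (∈-filter⁻ (E? G v) {xs = allFin _} u∈)

Two : ∀ {n} → Graph n → Fin n → Fin n → Fin n → Fin n → Set
Two G a b c v = (Adj G v a × Adj G v b) ⊎ (Adj G v b × Adj G v c) ⊎ (Adj G v a × Adj G v c)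

K : ∀ {n} → Graph n → Fin n → Fin n → Fin n → Fin n → Set
K G a b c v = v ∈ a ∷ b ∷ c ∷ [] ⊎ (Od G v × Two G a b c v)

Triangle : ∀ {n} → Graph n → Fin n → Fin n → Fin n → Set
Triangle G a b c = E G a b × E G b c × E G a c

-- Every vertex of `K` lies on the triangle or is adjacent to it, so closure under adjacency makes
-- `K` a whole component. In this form badness is decidable without mention of walks.
Bad : ∀ {n} → Graph n → Fin n → Fin n → Fin n → Set
Bad G a b c = Triangle G a b c × (∀ v u → K G a b c v → adj G v u ≡ true → K G a b c u)

NoBad : ∀ {n} → Graph n → Set
NoBad G = ∀ a b c → ¬ Bad G a b c

K? : ∀ {n} (G : Graph n) a b c v → Dec (K G a b c v)
K? G a b c v = (v ∈? a ∷ b ∷ c ∷ []) ⊎-dec ((par G v ≟ᵇ true) ×-dec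
  ((adj? G v a ×-dec adj? G v b) ⊎-dec ((adj? G v b ×-dec adj? G v c) ⊎-dec (adj? G v a ×-dec adj? G v c))))

triangle? : ∀ {n} (G : Graph n) a b c → Dec (Triangle G a b c)
triangle? G a b c = E? G a b ×-dec E? G b c ×-dec E? G a c

bad? : ∀ {n} (G : Graph n) → Dec (∃ λ a → ∃ λ b → ∃ λ c → Bad G a b c)
bad? G = any? λ a → any? λ b → any? λ c → triangle? G a b c
  ×-dec all? λ v → all? λ u → K? G a b c v →-dec (adj? G v u →-dec K? G a b c u)

-- Nothing changes outside T, so a bad triangle of G′ whose component avoids T is bad in G.
bad-touched : ∀ {n} (G G′ : Graph n) (T : List (Fin n)) → (∀ {u v} → adj G′ u v ≡ true → adj G u v ≡ true) →
  (∀ {v} → v ∉ T → ∀ u → adj G′ v u ≡ adj G v u) → NoBad G → ∀ {p q r} → Bad G′ p q r → ∃ λ t → t ∈ T × K G′ p q r t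
bad-touched G G′ T sub agree nb {p} {q} {r} (tri , closed) with Any.any? (K? G′ p q r) T
... | yes any = find any
... | no none = ⊥-elim (nb p q r (tri₀ , closed₀))
  where
  clean : ∀ {v} → K G′ p q r v → v ∉ T
  clean k v∈ = none (Any.map (λ { refl → k }) v∈)
  same-par : ∀ {v} → K G′ p q r v → par G v ≡ par G′ v
  same-par k = symm (par-row {G = G′} {G} (agree (clean k)))
  Kp : K G′ p q r p
  Kp = inj₁ (here refl)
  Kq : K G′ p q r q
  Kq = inj₁ (there (here refl))
  Kr : K G′ p q r r
  Kr = inj₁ (there (there (here refl)))
  down : ∀ {u v} → K G′ p q r u → K G′ p q r v → E G′ u v → E G u v
  down ku kv (e , pu , pv) = sub e , trans (same-par ku) pu , trans (same-par kv) pv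
  tri₀ : Triangle G p q r
  tri₀ = let a , b , c = tri in down Kp Kq a , down Kq Kr b , down Kp Kr c
  back : ∀ {x v} → K G′ p q r x → adj G v x ≡ true → K G′ p q r v
  back {x} {v} kx e = closed x v kx (trans (agree (clean kx) v) (adj-sym G e))
  -- Oddness and the second neighbour need not be transported: one neighbour on the triangle
  -- suffices, by closure in `G′`.
  up : ∀ {v} → K G p q r v → K G′ p q r v
  up (inj₁ v∈) = inj₁ v∈
  up (inj₂ (_ , inj₁ (e , _))) = back Kp e
  up (inj₂ (_ , inj₂ (inj₁ (e , _)))) = back Kq e
  up (inj₂ (_ , inj₂ (inj₂ (e , _)))) = back Kp e
  two : ∀ {v} → Two G′ p q r v → Two G p q r v
  two (inj₁ (e , f)) = inj₁ (sub e , sub f)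
  two (inj₂ (inj₁ (e , f))) = inj₂ (inj₁ (sub e , sub f))
  two (inj₂ (inj₂ (e , f))) = inj₂ (inj₂ (sub e , sub f))
  lower : ∀ {v} → K G′ p q r v → K G p q r v
  lower (inj₁ v∈) = inj₁ v∈
  lower k@(inj₂ (o , t)) = inj₂ (trans (same-par k) o , two t)
  closed₀ : ∀ v u → K G p q r v → adj G v u ≡ true → K G p q r u
  closed₀ v u k e = lower (closed v u (up k) (trans (agree (clean (up k)) u) e))

del-removed : ∀ {n} (G : Graph n) B → Del G B → ∀ {a x} → (a , x) ∈ B → adj (G ⊕* B) a x ≡ false
del-removed G (_ ∷ B) (e , d) (here refl) = removed (G ⊕* B) e
del-removed G (_ ∷ B) (e , d) {a} {x} (there p) = ≢true λ h → true≢false (still-adj (G ⊕* B) e a x h) (del-removed G B d p)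

od-or-ev : ∀ {n} (G : Graph n) v → Od G v ⊎ Ev G v
od-or-ev G v with par G v
... | true = inj₁ refl
... | false = inj₂ refl

∉₁ : ∀ {A : Set} {v a : A} {l} → v ∉ a ∷ l → v ≢ a
∉₁ h e = h (here e)

∉₂ : ∀ {A : Set} {v a b : A} {l} → v ∉ a ∷ b ∷ l → v ≢ b
∉₂ h e = h (there (here e))

∉₃ : ∀ {A : Set} {v a b c : A} {l} → v ∉ a ∷ b ∷ c ∷ l → v ≢ c
∉₃ h e = h (there (there (here e)))

-- Three edges at x: two of them are added at x, the third one at its other end.
restore₃ : ∀ {n} (Γ : Graph n) {k} (x y v₁ v₂ : Fin n) → Unique (x ∷ y ∷ v₁ ∷ v₂ ∷ []) →
  adj Γ x y ≡ true → adj Γ x v₁ ≡ true → adj Γ x v₂ ≡ true →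
  (s : State (Γ ⊕* ((x , y) ∷ (x , v₁) ∷ (x , v₂) ∷ [])) k) →
  1 ≤ D s x → 1 ≤ D s y → 1 ≤ D s v₁ → 1 ≤ D s v₂ →
  (∀ c → adj Γ x c ≡ true → c ∉ y ∷ v₁ ∷ v₂ ∷ [] → 1 ≤ D s c) →
  (∀ v → v ∈ v₁ ∷ v₂ ∷ [] → ∃ λ Z → length Z ≤ 2 × (∀ c → adj Γ v c ≡ true → c ≢ x → c ∈ Z ⊎ (c ∉ y ∷ v₁ ∷ v₂ ∷ [] × 1 ≤ D s c))) →
  Σ (State Γ k) λ s′ → 2 ≤ D s′ x × (∀ c → c ∉ x ∷ y ∷ v₁ ∷ v₂ ∷ [] → D s c ≤ D s′ c)
restore₃ {n} Γ {k} x y v₁ v₂ ((x≢y ∷ x≢v₁ ∷ x≢v₂ ∷ []) ∷ (y≢v₁ ∷ y≢v₂ ∷ []) ∷ (v₁≢v₂ ∷ []) ∷ [] ∷ []) ey e₁ e₂ s dx dy d₁ d₂ hx hv = step₃ step₂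
  where
  Γ₂ = Γ ⊕ (x , v₂)
  Γ₁ = Γ ⊕ (x , v₂) ⊕ (x , v₁)
  B₁ : List (Edge n)
  B₁ = (x , v₁) ∷ (x , v₂) ∷ []
  del₁ : Del Γ B₁
  del₁ = kept₂ Γ ((x , v₂) ∷ []) e₁ (λ { (here e) → x≢v₁ (symm e) ; (there (here e)) → v₁≢v₂ e }) , e₂ , tt
  ey₁ : adj Γ₁ x y ≡ true
  ey₁ = kept₂ Γ B₁ ey (λ { (here e) → x≢y (symm e) ; (there (here e)) → y≢v₁ e ; (there (there (here e))) → x≢y (symm e) ; (there (there (there (here e)))) → y≢v₂ e })
  nbr₁ : ∀ c → adj Γ₁ x c ≡ true → c ≢ y → adj Γ x c ≡ true × c ∉ y ∷ v₁ ∷ v₂ ∷ []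
  nbr₁ c e c≢y = del-sub Γ B₁ del₁ e , λ where
    (here q) → c≢y q
    (there (here refl)) → true≢false e (del-removed Γ B₁ del₁ (here refl))
    (there (there (here refl))) → true≢false e (del-removed Γ B₁ del₁ (there (here refl)))
  r₁ : Σ (State Γ₁ k) (Upd x y s)
  r₁ = restore Γ₁ s x y (λ _ _ → refl) ey₁ [] (λ c e c≢y → let e′ , c∉ = nbr₁ c e c≢y in inj₂ (hx c e′ c∉)) dy
  s₁ = proj₁ r₁
  keep₁ : ∀ {c} → c ≢ y → D s c ≤ D s₁ c
  keep₁ = upd-≥ {s = s} {s₁} (proj₂ r₁)
  -- The first addition may have used up the end at `y`, so `y` is the one neighbour in `Z`. The two
  -- candidates carry an end each, which is enough, but which of them receives its edge cannot be
  -- prescribed.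
  step₂ : ∃ λ v → v ∈ v₁ ∷ v₂ ∷ [] × Σ (State (Γ₁ ⊕ (x , v)) k) (Upd x v s₁)
  step₂ = restore-any s₁ x (v₁ ∷ v₂ ∷ []) (y ∷ []) ((v₁≢v₂ ∷ []) ∷ [] ∷ [])
    (λ { (here refl) → ≢-sym x≢v₁ , del-removed Γ B₁ del₁ (here refl) ; (there (here refl)) → ≢-sym x≢v₂ , del-removed Γ B₁ del₁ (there (here refl)) })
    (λ c e → case c ≟ y of λ where
      (yes refl) → inj₁ (here refl)
      (no c≢y) → let e′ , c∉ = nbr₁ c e c≢y in inj₂ (≤-trans (hx c e′ c∉) (keep₁ c≢y)))
    (+-mono-≤ (≤-trans d₁ (keep₁ (≢-sym y≢v₁))) (≤-trans (≤-trans d₂ (keep₁ (≢-sym y≢v₂))) (m≤m+n _ 0)))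
  last : ∀ v v′ → v ∈ v₁ ∷ v₂ ∷ [] → v′ ∈ v₁ ∷ v₂ ∷ [] → v ≢ x → v′ ≢ x → adj Γ x v ≡ true → (s₂ : State (Γ ⊕ (x , v)) k) → Upd x v′ s₁ s₂ →
    Σ (State Γ k) λ s′ → 2 ≤ D s′ x × (∀ c → c ∉ x ∷ y ∷ v₁ ∷ v₂ ∷ [] → D s c ≤ D s′ c)
  last v v′ v∈ v′∈ v≢x v′≢x e s₂ upd₂ = proj₁ r₃ , ≤-pred (≤-trans dx₂ (upd-loss {s = s₂} {proj₁ r₃} (proj₂ r₃))) ,
      λ c c∉ → ≤-trans (keep₂ c (c∉ ∘ there)) (upd-≥ {s = s₂} {proj₁ r₃} (proj₂ r₃) (c∉ ∘ here))
    where
    keep₂ : ∀ c → c ∉ y ∷ v₁ ∷ v₂ ∷ [] → D s c ≤ D s₂ c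
    keep₂ c c∉ = ≤-trans (keep₁ (c∉ ∘ here)) (upd-≥ {s = s₁} {s₂} upd₂ {c} (λ { refl → c∉ (there v′∈) }))
    -- One end at `x` by hypothesis and one for each of the two edges added at `x`. Hence `v` may
    -- have two neighbours without ends, and two ends remain at `x` afterwards.
    dx₂ : 3 ≤ D s₂ x
    dx₂ = ≤-trans (s≤s (≤-trans (s≤s dx) (upd-gain {s = s} {s₁} (proj₂ r₁) x≢y))) (upd-gain {s = s₁} {s₂} upd₂ (≢-sym v′≢x))
    Z = proj₁ (hv v v∈)
    r₃ : Σ (State Γ k) (Upd v x s₂)
    r₃ = restore Γ s₂ v x (λ a b → cong (adj Γ a b xor_) (isE-swap x v a b)) (adj-sym Γ e) Z
      (λ c e′ c≢x → case proj₂ (proj₂ (hv v v∈)) c e′ c≢x of λ where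
        (inj₁ z) → inj₁ z
        (inj₂ (c∉ , d)) → inj₂ (≤-trans d (keep₂ c c∉)))
      (≤-trans (s≤s (proj₁ (proj₂ (hv v v∈)))) dx₂)
  step₃ : (∃ λ v → v ∈ v₁ ∷ v₂ ∷ [] × Σ (State (Γ₁ ⊕ (x , v)) k) (Upd x v s₁)) →
    Σ (State Γ k) λ s′ → 2 ≤ D s′ x × (∀ c → c ∉ x ∷ y ∷ v₁ ∷ v₂ ∷ [] → D s c ≤ D s′ c)
  step₃ (_ , here refl , s₂ , upd) = last v₂ v₁ (there (here refl)) (here refl) (≢-sym x≢v₂) (≢-sym x≢v₁) e₂
    (cast {G = Γ₁ ⊕ (x , v₁)} {Γ₂} (⊕-cancel Γ₂ (x , v₁)) s₂) upd
  step₃ (_ , there (here refl) , s₂ , upd) = last v₁ v₂ (here refl) (there (here refl)) (≢-sym x≢v₁) (≢-sym x≢v₂) e₁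
    (cast {G = Γ₁ ⊕ (x , v₂)} {Γ ⊕ (x , v₁)} (≈-trans {G = Γ₁ ⊕ (x , v₂)} {Γ ⊕ (x , v₁) ⊕ (x , v₂) ⊕ (x , v₂)} {Γ ⊕ (x , v₁)}
       (⊕-cong {G = Γ₁} {Γ ⊕ (x , v₁) ⊕ (x , v₂)} (x , v₂) (⊕-comm Γ (x , v₂) (x , v₁))) (⊕-cancel (Γ ⊕ (x , v₁)) (x , v₂))) s₂) upd

-- Restoring edges of the even subgraph

module Restore {n} (G : Graph n) {k : ℕ} where

  restore-leaf : ∀ {a x} → adj G a x ≡ true → Ev G x → (∀ u → adj G a u ≡ true → u ≢ x → Od G u) → State (G ⊕ (a , x)) k → State G k
  restore-leaf {a} {x} e ex h s = proj₁ (restore G s a x (λ _ _ → refl) e []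
      (λ c e′ c≢x → inj₂ (odd-D s (trans (par-other G a≢x (≢-sym (adj-≢ G e′)) c≢x) (h c e′ c≢x))))
      (odd-D s (trans (par-end₂ G a≢x) (cong not ex))))
    where a≢x = adj-≢ G e

  others : ∀ {v x} → E G v x → length (nbE G v) ≤ 3 → ∃ λ Z → length Z ≤ 2 × (∀ c → E G v c → c ≢ x → c ∈ Z)
  others {v} {x} e len with ∈⇒↭ (∈-nbE G e)
  ... | Z , p = Z , ≤-pred (≤-trans (≤-reflexive (symm (↭-length p))) len) , λ c ec c≢x → case ∈-resp-↭ p (∈-nbE G ec) of λ where
    (here q) → contradiction q c≢x
    (there q) → q

  module Deg3 {x y v₁ v₂} (uq : Unique (x ∷ y ∷ v₁ ∷ v₂ ∷ [])) (ey : E G x y) (e₁ : E G x v₁) (e₂ : E G x v₂) where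
    adjX : ∀ {z} → z ∈ y ∷ v₁ ∷ v₂ ∷ [] → adj G x z ≡ true
    adjX (here refl) = proj₁ ey
    adjX (there (here refl)) = proj₁ e₁
    adjX (there (there (here refl))) = proj₁ e₂
    open Cut G x (y ∷ v₁ ∷ v₂ ∷ []) [] uq adjX (λ ()) public
    evX : ∀ {z} → z ∈ y ∷ v₁ ∷ v₂ ∷ [] → Ev G z
    evX (here refl) = proj₂ (proj₂ ey)
    evX (there (here refl)) = proj₂ (proj₂ e₁)
    evX (there (there (here refl))) = proj₂ (proj₂ e₂)
    touched : ∀ {t} → t ∈ eB B → t ≡ x ⊎ t ∈ y ∷ v₁ ∷ v₂ ∷ []
    touched = ∈-star (y ∷ v₁ ∷ v₂ ∷ [])
    odd-touched : ∀ {t} → t ≡ x ⊎ t ∈ y ∷ v₁ ∷ v₂ ∷ [] → Ev G t × Od (G ⊕* B) t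
    odd-touched (inj₁ refl) = proj₁ (proj₂ ey) , trans par-center (cong (_xor true) (proj₁ (proj₂ ey)))
    odd-touched (inj₂ t∈) = evX t∈ , trans (par-touched t∈) (cong not (evX t∈))

    -- The degree of `y` is unrestricted because its edge is added at `x`. The third edge is added
    -- at `v₁` or `v₂`, whose even neighbours other than `x` are at most two.
    restore-deg3 : (∀ u → E G x u → u ∈ y ∷ v₁ ∷ v₂ ∷ []) → length (nbE G v₁) ≤ 3 → length (nbE G v₂) ≤ 3 → State (G ⊕* B) k → State G k
    restore-deg3 only l₁ l₂ s = proj₁ (restore₃ G x y v₁ v₂ uq (proj₁ ey) (proj₁ e₁) (proj₁ e₂) s
        (odd-D s (proj₂ (odd-touched (inj₁ refl)))) (dX (here refl)) (dX (there (here refl))) (dX (there (there (here refl))))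
        (λ c e c∉ → case od-or-ev G c of λ where
          (inj₁ o) → dO o
          (inj₂ ev) → contradiction (only c (e , proj₁ (proj₂ ey) , ev)) c∉)
        (λ where
          v (here refl) → nbrs v₁ e₁ l₁
          v (there (here refl)) → nbrs v₂ e₂ l₂))
      where
      dX : ∀ {t} → t ∈ y ∷ v₁ ∷ v₂ ∷ [] → 1 ≤ D s t
      dX t∈ = odd-D s (proj₂ (odd-touched (inj₂ t∈)))
      dO : ∀ {c} → Od G c → 1 ≤ D s c
      dO {c} o = odd-D s (trans (untouched-par G B (λ c∈ → true≢false o (proj₁ (odd-touched (touched c∈))))) o)
      nbrs : ∀ v → E G x v → length (nbE G v) ≤ 3 → ∃ λ Z → length Z ≤ 2 × (∀ c → adj G v c ≡ true → c ≢ x → c ∈ Z ⊎ (c ∉ y ∷ v₁ ∷ v₂ ∷ [] × 1 ≤ D s c))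
      nbrs v e l with others (E-sym G e) l
      ... | Z , len , h = Z , len , λ c e′ c≢x → case od-or-ev G c of λ where
        (inj₁ o) → inj₂ ((λ c∈ → true≢false o (evX c∈)) , dO o)
        (inj₂ ev) → inj₁ (h c (e′ , proj₂ (proj₂ e) , ev) c≢x)

  module Deg2 {x y v u} (uq : Unique (x ∷ y ∷ v ∷ u ∷ [])) (exy : E G x y) (evu : E G v u) where
    adjX : ∀ {z} → z ∈ y ∷ [] → adj G x z ≡ true
    adjX (here refl) = proj₁ exy
    adjM : ∀ {a z} → (a , z) ∈ (v , u) ∷ [] → adj G a z ≡ true
    adjM (here refl) = proj₁ evu
    open Cut G x (y ∷ []) ((v , u) ∷ []) uq adjX adjM public
    evX : ∀ {z} → z ∈ y ∷ v ∷ u ∷ [] → Ev G z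
    evX (here refl) = proj₂ (proj₂ exy)
    evX (there (here refl)) = proj₁ (proj₂ evu)
    evX (there (there (here refl))) = proj₂ (proj₂ evu)
    touched : ∀ {t} → t ∈ eB B → t ≡ x ⊎ t ∈ y ∷ v ∷ u ∷ []
    touched = ∈-eB-star++ (y ∷ []) ((v , u) ∷ [])
    odd-touched : ∀ {t} → t ≡ x ⊎ t ∈ y ∷ v ∷ u ∷ [] → Ev G t × Od (G ⊕* B) t
    odd-touched (inj₁ refl) = proj₁ (proj₂ exy) , trans par-center (cong (_xor true) (proj₁ (proj₂ exy)))
    odd-touched (inj₂ t∈) = evX t∈ , trans (par-touched t∈) (cong not (evX t∈))

    -- The edge `x v` stays. Adding `x y` at `x` may cost `y` its end but gives `x` a new one, so
    -- that `v u` can be added at `v`; for this `u` must still have its end, which is why `u` has to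
    -- differ from `y`.
    restore-deg2 : (∀ c → E G x c → c ∈ y ∷ v ∷ []) → (∀ c → E G v c → c ∈ x ∷ u ∷ []) → State (G ⊕* B) k → State G k
    restore-deg2 onlyx onlyv s = proj₁ r₂
      where
      x≢y : x ≢ y
      x≢y refl = w∉ (here refl)
      y≢u : y ≢ u
      y≢u refl = Unique-++-∉ (x ∷ y ∷ []) uq (there (here refl)) (there (here refl))
      dX : ∀ {t} → t ∈ y ∷ v ∷ u ∷ [] → 1 ≤ D s t
      dX t∈ = odd-D s (proj₂ (odd-touched (inj₂ t∈)))
      dO : ∀ {c} → Od G c → 1 ≤ D s c
      dO {c} o = odd-D s (trans (untouched-par G B (λ c∈ → true≢false o (proj₁ (odd-touched (touched c∈))))) o)
      r₁ : Σ (State (G ⊕ (v , u)) k) (Upd x y s)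
      r₁ = restore (G ⊕ (v , u)) s x y (λ _ _ → refl) (proj₁ del) []
        (λ c e c≢y → inj₂ (case od-or-ev G c of λ where
          (inj₁ o) → dO o
          (inj₂ ev) → case onlyx c (still-adj G (proj₁ evu) x c e , proj₁ (proj₂ exy) , ev) of λ where
            (here q) → contradiction q c≢y
            (there (here refl)) → dX (there (here refl))))
        (dX (here refl))
      s₁ = proj₁ r₁
      keep : ∀ {c} → c ≢ y → D s c ≤ D s₁ c
      keep = upd-≥ {s = s} {s₁} (proj₂ r₁)
      r₂ : Σ (State G k) (Upd v u s₁)
      r₂ = restore G s₁ v u (λ _ _ → refl) (proj₁ evu) []
        (λ c e c≢u → inj₂ (case od-or-ev G c of λ where
          (inj₁ o) → ≤-trans (dO o) (keep {c} (λ { refl → true≢false o (evX (here refl)) }))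
          (inj₂ ev) → case onlyv c (e , proj₁ (proj₂ evu) , ev) of λ where
            (here refl) → ≤-trans (s≤s z≤n) (upd-gain {s = s} {s₁} (proj₂ r₁) x≢y)
            (there (here q)) → contradiction q c≢u))
        (≤-trans (dX (there (there (here refl)))) (keep (≢-sym y≢u)))

-- The inductive step inside the even subgraph

Fam : ∀ {n} → (Fin n → Fin n → Set) → Graph n → Set
Fam E₀ G = ∀ {u v} → E G u v → E₀ u v

kept-edges : ∀ {n} (G : Graph n) B {u v} → (∀ {a x} → (a , x) ∈ B → isE a x u v ≡ false) → adj (G ⊕* B) u v ≡ adj G u v
kept-edges G [] _ = refl
kept-edges G ((a , x) ∷ B) {u} {v} h = trans (cong (adj (G ⊕* B) u v xor_) (h (here refl))) (trans (xor-identityʳ _) (kept-edges G B (h ∘ there)))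

-- Says, by way of neighbourhoods, that every component of the even subgraph is a single vertex or a
-- triangle.
Triangles : ∀ {n} → Graph n → Set
Triangles G = ∀ x → nbE G x ≡ [] ⊎ ∃₂ λ y v → nbE G x ≡ y ∷ v ∷ [] × E G y v

module Reduction {n} (E₀ : Fin n → Fin n → Set) (k : ℕ) (G : Graph n)
  (ih : ∀ G′ → edges G′ < edges G → Fam E₀ G′ → NoBad G′ → State G′ k) (fam : Fam E₀ G) (nb : NoBad G) where

  open Restore G {k}

  AllOdd : List (Edge n) → Set
  AllOdd B = ∀ {t} → t ∈ eB B → Ev G t × Od (G ⊕* B) t

  -- A deletion may create a bad triangle. For that event each step provides a decomposition of `G`
  -- obtained in another way, rather than a proof that it cannot happen.
  Rescue : List (Edge n) → Set
  Rescue B = ∀ p q r t → Bad (G ⊕* B) p q r → t ∈ eB B → K (G ⊕* B) p q r t → State G k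

  module _ (B : List (Edge n)) (d : Del G B) (allOdd : AllOdd B) where

    even-untouched : ∀ {u} → Ev (G ⊕* B) u → u ∉ eB B
    even-untouched e u∈ = true≢false (proj₂ (allOdd u∈)) e

    E-down : ∀ {u v} → E (G ⊕* B) u v → E G u v
    E-down (e , eu , ev) = del-sub G B d e , trans (symm (untouched-par G B (even-untouched eu))) eu , trans (symm (untouched-par G B (even-untouched ev))) ev

    touched-E : ∀ {t u} → t ∈ eB B → Ev (G ⊕* B) u → adj (G ⊕* B) t u ≡ true → E G t u
    touched-E t∈ eu e = del-sub G B d e , proj₁ (allOdd t∈) , trans (symm (untouched-par G B (even-untouched eu))) eu

    -- A touched vertex has become odd, so it enters `K` only through two neighbours on the
    -- triangle. Both edges belong to the even subgraph of `G`, where `t` and the triangle thus form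
    -- a diamond.
    K-odd : ∀ {p q r t} → Triangle (G ⊕* B) p q r → t ∈ eB B → K (G ⊕* B) p q r t → Two (G ⊕* B) p q r t × t ∉ p ∷ q ∷ r ∷ []
    K-odd ((_ , ep , eq) , (_ , _ , er) , _) t∈ k = go k , out
      where
      o = proj₂ (allOdd t∈)
      out : _ ∉ _
      out (here refl) = true≢false o ep
      out (there (here refl)) = true≢false o eq
      out (there (there (here refl))) = true≢false o er
      go : _ → _
      go (inj₁ x) = ⊥-elim (out x)
      go (inj₂ (_ , two)) = two

    reduce : edges (G ⊕* B) < edges G → Rescue B → (State (G ⊕* B) k → State G k) → State G k
    reduce lt rescue back = case bad? (G ⊕* B) of λ where
      (no none) → back (ih (G ⊕* B) lt (λ e → fam (E-down e)) (λ a b c h → none (a , b , c , h)))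
      (yes (p , q , r , h)) → let t , t∈ , kt = bad-touched G (G ⊕* B) (eB B) (del-sub G B d) (untouched-adj G B) nb h in rescue p q r t h t∈ kt

  four-nbrs : ∀ {v a b c d} → length (nbE G v) ≤ 3 → Unique (a ∷ b ∷ c ∷ d ∷ []) → E G v a → E G v b → E G v c → E G v d → ⊥
  four-nbrs {v} len uq ea eb ec ed = 1+n≰n (≤-trans (Unique-⊆-length uq sub) len)
    where
    sub : ∀ {x} → x ∈ _ → x ∈ nbE G v
    sub (here refl) = ∈-nbE G ea
    sub (there (here refl)) = ∈-nbE G eb
    sub (there (there (here refl))) = ∈-nbE G ec
    sub (there (there (there (here refl)))) = ∈-nbE G ed

  uniq₄ : ∀ {a b c d : Fin n} → a ≢ b → a ≢ c → a ≢ d → b ≢ c → b ≢ d → c ≢ d → Unique (a ∷ b ∷ c ∷ d ∷ [])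
  uniq₄ ab ac ad bc bd cd = (ab ∷ ac ∷ ad ∷ []) ∷ (bc ∷ bd ∷ []) ∷ (cd ∷ []) ∷ [] ∷ []

  -- The diamond p, q, r, s (with s possibly adjacent to r): p has degree 3 in the even subgraph, and
  -- no new bad triangle can reach p, q, r or s.
  diamond : ∀ {p q r s} → E G p q → E G p r → E G q r → E G s p → E G s q → s ≢ r →
    length (nbE G p) ≤ 3 → length (nbE G q) ≤ 3 → length (nbE G r) ≤ 3 →
    (∀ u u′ → E G s u → E G s u′ → u ∉ p ∷ q ∷ r ∷ [] → u′ ∉ p ∷ q ∷ r ∷ [] → u ≡ u′) → State G k
  diamond {p} {q} {r} {s} pq pr qr sp sq s≢r lp lq lr hs =
    reduce B del allOdd (edges-⊕* G _ _ del) rescue (restore-deg3 only lq lr)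
    where
    p≢q = E-≢ G pq
    p≢r = E-≢ G pr
    q≢r = E-≢ G qr
    p≢s = ≢-sym (E-≢ G sp)
    s≢q = E-≢ G sq
    uq : Unique (p ∷ s ∷ q ∷ r ∷ [])
    uq = uniq₄ p≢s p≢q p≢r s≢q s≢r q≢r
    open Deg3 uq (E-sym G sp) pq pr
    allOdd : AllOdd B
    allOdd t∈ = odd-touched (touched t∈)
    only : ∀ u → E G p u → u ∈ s ∷ q ∷ r ∷ []
    only u e = case u ∈? s ∷ q ∷ r ∷ [] of λ where
      (yes u∈) → u∈
      (no u∉) → ⊥-elim (four-nbrs lp (uniq₄ (λ { refl → u∉ (here refl) }) (λ { refl → u∉ (there (here refl)) }) (λ { refl → u∉ (there (there (here refl))) }) s≢q s≢r q≢r) e (E-sym G sp) pq pr)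
    fresh : ∀ {u x} → Ev (G ⊕* B) u → x ≡ p ⊎ x ∈ s ∷ q ∷ r ∷ [] → u ≢ x
    fresh eu x∈ refl = true≢false (proj₂ (odd-touched x∈)) eu
    P : p ≡ p ⊎ p ∈ s ∷ q ∷ r ∷ []
    P = inj₁ refl
    S : s ≡ p ⊎ s ∈ s ∷ q ∷ r ∷ []
    S = inj₂ (here refl)
    Q : q ≡ p ⊎ q ∈ s ∷ q ∷ r ∷ []
    Q = inj₂ (there (here refl))
    R : r ≡ p ⊎ r ∈ s ∷ q ∷ r ∷ []
    R = inj₂ (there (there (here refl)))
    outside : ∀ {u} → Ev (G ⊕* B) u → u ∉ p ∷ q ∷ r ∷ []
    outside eu (here e) = fresh eu P e
    outside eu (there (here e)) = fresh eu Q e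
    outside eu (there (there (here e))) = fresh eu R e
    -- A touched vertex of a bad component would have two neighbours `u`, `u′` in the even subgraph
    -- outside the four vertices, which are now odd. But `p` has none, `s` at most one by `hs`, and
    -- `q` or `r` would reach degree four.
    clash : ∀ {t u u′} → t ≡ p ⊎ t ∈ s ∷ q ∷ r ∷ [] → u ≢ u′ → Ev (G ⊕* B) u → Ev (G ⊕* B) u′ → E G t u → E G t u′ → ⊥
    clash (inj₁ refl) u≢u′ eu eu′ f f′ = case only _ f of λ where
      (here e) → fresh eu S e
      (there (here e)) → fresh eu Q e
      (there (there (here e))) → fresh eu R e
    clash (inj₂ (here refl)) u≢u′ eu eu′ f f′ = u≢u′ (hs _ _ f f′ (outside eu) (outside eu′))
    clash (inj₂ (there (here refl))) u≢u′ eu eu′ f f′ =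
      four-nbrs lq (uniq₄ (fresh eu P) (fresh eu S) (fresh eu R) p≢s p≢r s≢r) f (E-sym G pq) (E-sym G sq) qr
    clash (inj₂ (there (there (here refl)))) u≢u′ eu eu′ f f′ =
      four-nbrs lr (uniq₄ u≢u′ (fresh eu P) (fresh eu Q) (fresh eu′ P) (fresh eu′ Q) p≢q) f f′ (E-sym G pr) (E-sym G qr)
    rescue : Rescue B
    rescue p′ q′ r′ t (tri@((epq , ep , eq) , (eqr , _ , er) , (epr , _)) , _) t∈ kt = ⊥-elim (case proj₁ (K-odd B del allOdd tri t∈ kt) of λ where
      (inj₁ (e , f)) → clash (touched t∈) (adj-≢ G′ epq) ep eq (lift ep e) (lift eq f)
      (inj₂ (inj₁ (e , f))) → clash (touched t∈) (adj-≢ G′ eqr) eq er (lift eq e) (lift er f)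
      (inj₂ (inj₂ (e , f))) → clash (touched t∈) (adj-≢ G′ epr) ep er (lift ep e) (lift er f))
      where
      G′ = G ⊕* B
      lift : ∀ {u} → Ev G′ u → adj G′ t u ≡ true → E G t u
      lift = touched-E B del allOdd t∈

  to-diamond : ∀ {B} → Del G B → AllOdd B → ∀ {p q r t} → Triangle (G ⊕* B) p q r → t ∈ eB B → K (G ⊕* B) p q r t →
    length (nbE G p) ≤ 3 → length (nbE G q) ≤ 3 → length (nbE G r) ≤ 3 →
    (∀ u u′ → E G t u → E G t u′ → u ∉ p ∷ q ∷ r ∷ [] → u′ ∉ p ∷ q ∷ r ∷ [] → u ≡ u′) → State G k
  to-diamond {B} d ao {p} {q} {r} {t} tri@(pq′@(_ , ep , eq) , qr′@(_ , _ , er) , pr′) t∈ kt lp lq lr h =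
    case proj₁ two,out of λ where
      (inj₁ (e , f)) → diamond pq pr qr (lift ep e) (lift eq f) (∉₃ out) lp lq lr h
      (inj₂ (inj₁ (e , f))) → diamond qr (E-sym G pq) (E-sym G pr) (lift eq e) (lift er f) (∉₁ out) lq lr lp (rot₁ h)
      (inj₂ (inj₂ (e , f))) → diamond pr pq (E-sym G qr) (lift ep e) (lift er f) (∉₂ out) lp lr lq (rot₂ h)
    where
    G′ = G ⊕* B
    two,out = K-odd B d ao tri t∈ kt
    out : t ∉ p ∷ q ∷ r ∷ []
    out = proj₂ two,out
    pq = E-down B d ao pq′
    qr = E-down B d ao qr′
    pr = E-down B d ao pr′
    lift : ∀ {u} → Ev G′ u → adj G′ t u ≡ true → E G t u
    lift = touched-E B d ao t∈
    rot₁ : (∀ u u′ → E G t u → E G t u′ → u ∉ p ∷ q ∷ r ∷ [] → u′ ∉ p ∷ q ∷ r ∷ [] → u ≡ u′) →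
      ∀ u u′ → E G t u → E G t u′ → u ∉ q ∷ r ∷ p ∷ [] → u′ ∉ q ∷ r ∷ p ∷ [] → u ≡ u′
    rot₁ h u u′ e e′ n n′ = h u u′ e e′ (n ∘ σ) (n′ ∘ σ)
      where
      σ : ∀ {z} → z ∈ p ∷ q ∷ r ∷ [] → z ∈ q ∷ r ∷ p ∷ []
      σ (here e) = there (there (here e))
      σ (there (here e)) = here e
      σ (there (there (here e))) = there (here e)
    rot₂ : (∀ u u′ → E G t u → E G t u′ → u ∉ p ∷ q ∷ r ∷ [] → u′ ∉ p ∷ q ∷ r ∷ [] → u ≡ u′) →
      ∀ u u′ → E G t u → E G t u′ → u ∉ p ∷ r ∷ q ∷ [] → u′ ∉ p ∷ r ∷ q ∷ [] → u ≡ u′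
    rot₂ h u u′ e e′ n n′ = h u u′ e e′ (n ∘ σ) (n′ ∘ σ)
      where
      σ : ∀ {z} → z ∈ p ∷ q ∷ r ∷ [] → z ∈ p ∷ r ∷ q ∷ []
      σ (here e) = here e
      σ (there (here e)) = there (there (here e))
      σ (there (there (here e))) = there (here e)

  -- Two neighbours of `t` lie on the triangle, so degree three leaves at most one outside it, as
  -- the diamond step requires.
  rescue-deg≤3 : (∀ v → length (nbE G v) ≤ 3) → ∀ {B} → Del G B → AllOdd B → Rescue B
  rescue-deg≤3 deg3 {B} d ao p q r t (tri@((epq , ep , eq) , (eqr , _ , er) , (epr , _)) , _) t∈ kt =
    to-diamond d ao tri t∈ kt (deg3 p) (deg3 q) (deg3 r) same
    where
    G′ = G ⊕* B
    lift : ∀ {u} → Ev G′ u → adj G′ t u ≡ true → E G t u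
    lift = touched-E B d ao t∈
    same : ∀ u u′ → E G t u → E G t u′ → u ∉ p ∷ q ∷ r ∷ [] → u′ ∉ p ∷ q ∷ r ∷ [] → u ≡ u′
    same u u′ e e′ n n′ = case u ≟ u′ of λ where
      (yes h) → h
      (no u≢u′) → ⊥-elim (case proj₁ (K-odd B d ao tri t∈ kt) of λ where
        (inj₁ (f , g)) → four-nbrs (deg3 t) (uniq₄ u≢u′ (∉₁ n) (∉₂ n) (∉₁ n′) (∉₂ n′) (adj-≢ G′ epq)) e e′ (lift ep f) (lift eq g)
        (inj₂ (inj₁ (f , g))) → four-nbrs (deg3 t) (uniq₄ u≢u′ (∉₂ n) (∉₃ n) (∉₂ n′) (∉₃ n′) (adj-≢ G′ eqr)) e e′ (lift eq f) (lift er g)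
        (inj₂ (inj₂ (f , g))) → four-nbrs (deg3 t) (uniq₄ u≢u′ (∉₁ n) (∉₃ n) (∉₁ n′) (∉₃ n′) (adj-≢ G′ epr)) e e′ (lift ep f) (lift er g))

  deg3-step : ∀ {x y v₁ v₂} → nbE G x ↭ y ∷ v₁ ∷ v₂ ∷ [] → length (nbE G v₁) ≤ 3 → length (nbE G v₂) ≤ 3 →
    (∀ {B} → B ≡ star x (y ∷ v₁ ∷ v₂ ∷ []) → Del G B → AllOdd B → Rescue B) → State G k
  deg3-step {x} {y} {v₁} {v₂} perm l₁ l₂ rescue =
    reduce B del allOdd (edges-⊕* G _ _ del) (rescue refl del allOdd) (restore-deg3 (λ u e → ∈-resp-↭ perm (∈-nbE G e)) l₁ l₂)
    where
    e : ∀ {u} → u ∈ y ∷ v₁ ∷ v₂ ∷ [] → E G x u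
    e u∈ = nbE-∈ G (∈-resp-↭ (↭-sym perm) u∈)
    open Deg3 (All.tabulate (λ u∈ → E-≢ G (e u∈)) ∷ Unique-↭ perm (nbE-unique G x)) (e (here refl)) (e (there (here refl))) (e (there (there (here refl))))
    allOdd : AllOdd B
    allOdd t∈ = odd-touched (touched t∈)

  deg1-step : ∀ {a x} → nbE G a ≡ x ∷ [] → (∀ {B} → B ≡ (a , x) ∷ [] → Del G B → AllOdd B → Rescue B) → State G k
  deg1-step {a} {x} eq rescue = reduce ((a , x) ∷ []) del allOdd (edges-⊕* G _ [] del) (rescue refl del allOdd)
      (restore-leaf (proj₁ e) (proj₂ (proj₂ e)) only)
    where
    e : E G a x
    e = nbE-∈ G (subst (x ∈_) (symm eq) (here refl))
    del : Del G ((a , x) ∷ [])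
    del = proj₁ e , tt
    allOdd : AllOdd ((a , x) ∷ [])
    allOdd (here refl) = proj₁ (proj₂ e) , trans (par-end₁ G (E-≢ G e)) (cong not (proj₁ (proj₂ e)))
    allOdd (there (here refl)) = proj₂ (proj₂ e) , trans (par-end₂ G (E-≢ G e)) (cong not (proj₂ (proj₂ e)))
    only : ∀ u → adj G a u ≡ true → u ≢ x → Od G u
    only u f u≢x = ≢false λ ev → case subst (u ∈_) eq (∈-nbE G (f , proj₁ (proj₂ e) , ev)) of λ where
      (here h) → u≢x h

  deg2-step : ∀ {x y v u} → nbE G x ↭ y ∷ v ∷ [] → nbE G v ↭ x ∷ u ∷ [] → y ≢ u →
    (∀ {B} → B ≡ (x , y) ∷ (v , u) ∷ [] → Del G B → AllOdd B → Rescue B) → State G k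
  deg2-step {x} {y} {v} {u} px pv y≢u rescue =
    reduce B del allOdd (edges-⊕* G _ _ del) (rescue refl del allOdd)
      (restore-deg2 (λ c e → ∈-resp-↭ px (∈-nbE G e)) (λ c e → ∈-resp-↭ pv (∈-nbE G e)))
    where
    exy : E G x y
    exy = nbE-∈ G (∈-resp-↭ (↭-sym px) (here refl))
    exv : E G x v
    exv = nbE-∈ G (∈-resp-↭ (↭-sym px) (there (here refl)))
    evu : E G v u
    evu = nbE-∈ G (∈-resp-↭ (↭-sym pv) (there (here refl)))
    y≢v : y ≢ v
    y≢v with (h ∷ _) ∷ _ ← Unique-↭ px (nbE-unique G x) = h
    x≢u : x ≢ u
    x≢u with (h ∷ _) ∷ _ ← Unique-↭ pv (nbE-unique G v) = h
    open Deg2 (uniq₄ (E-≢ G exy) (E-≢ G exv) x≢u y≢v y≢u (E-≢ G evu)) exy evu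
    allOdd : AllOdd B
    allOdd t∈ = odd-touched (touched t∈)

  reduce-deg≤3 : (∀ v → length (nbE G v) ≤ 3) → State G k ⊎ Triangles G
  reduce-deg≤3 deg3 = stage₁ (any? λ x → length (nbE G x) ≟ℕ 3)
    where
    R : ∀ {B} → Del G B → AllOdd B → Rescue B
    R = rescue-deg≤3 deg3
    stage₃ : (∀ x → length (nbE G x) ≢ 3) → (∀ x → length (nbE G x) ≢ 1) →
      Dec (∃ λ x → ∃ λ y → ∃ λ v → (E G x y × E G x v × y ≢ v) × ¬ E G y v) → State G k ⊎ Triangles G
    stage₃ no3 no1 (no none) = inj₂ λ x → tri x (nbE G x) refl
      where
      tri : ∀ x l → nbE G x ≡ l → nbE G x ≡ [] ⊎ ∃₂ λ y v → nbE G x ≡ y ∷ v ∷ [] × E G y v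
      tri x [] eq = inj₁ eq
      tri x (y ∷ []) eq = ⊥-elim (no1 x (cong length eq))
      tri x (y ∷ v ∷ []) eq = inj₂ (y , v , eq , decidable-stable (E? G y v) λ ¬e → none (x , y , v ,
        (nbE-∈ G (subst (y ∈_) (symm eq) (here refl)) , nbE-∈ G (subst (v ∈_) (symm eq) (there (here refl))) , first≢ (subst Unique eq (nbE-unique G x))) , ¬e))
        where
        first≢ : ∀ {y v : Fin n} {l} → Unique (y ∷ v ∷ l) → y ≢ v
        first≢ ((h ∷ _) ∷ _) = h
      tri x (_ ∷ _ ∷ _ ∷ []) eq = ⊥-elim (no3 x (cong length eq))
      tri x (_ ∷ _ ∷ _ ∷ _ ∷ _) eq = case ≤-trans (≤-reflexive (cong length (symm eq))) (deg3 x) of λ { (s≤s (s≤s (s≤s ()))) }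
    stage₃ no3 no1 (yes (x , y , v , (exy , exv , y≢v) , ¬e)) = inj₁ (locate (nbE G x) refl (nbE G v) refl)
      where
      two : ∀ z l → nbE G z ≡ l → ∀ {a} → a ∈ l → ∃ λ u → nbE G z ↭ a ∷ u ∷ []
      two z (a ∷ []) eq _ = ⊥-elim (no1 z (cong length eq))
      two z (a ∷ u ∷ []) eq (here refl) = u , ↭-reflexive eq
      two z (u ∷ a ∷ []) eq (there (here refl)) = u , ↭-trans (↭-reflexive eq) swap′
      two z (_ ∷ _ ∷ _ ∷ []) eq _ = ⊥-elim (no3 z (cong length eq))
      two z (_ ∷ _ ∷ _ ∷ _ ∷ _) eq _ = case ≤-trans (≤-reflexive (cong length (symm eq))) (deg3 z) of λ { (s≤s (s≤s (s≤s ()))) }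
      locate : ∀ l → nbE G x ≡ l → ∀ l′ → nbE G v ≡ l′ → State G k
      locate l eq l′ eq′ with two x l eq (subst (y ∈_) eq (∈-nbE G exy)) | two v l′ eq′ (subst (x ∈_) eq′ (∈-nbE G (E-sym G exv)))
      ... | v′ , px | u , pv with ∈-resp-↭ px (∈-nbE G exv)
      ...   | here q = contradiction (symm q) y≢v
      ...   | there (here refl) = deg2-step px pv (λ { refl → ¬e (E-sym G (nbE-∈ G (∈-resp-↭ (↭-sym pv) (there (here refl))))) }) (λ _ → R)
    stage₂ : (∀ x → length (nbE G x) ≢ 3) → Dec (∃ λ x → length (nbE G x) ≡ 1) → State G k ⊎ Triangles G
    stage₂ no3 (yes (x , l)) = inj₁ (leaf (nbE G x) refl l)
      where
      leaf : ∀ l → nbE G x ≡ l → length l ≡ 1 → State G k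
      leaf (y ∷ []) eq _ = deg1-step eq (λ _ → R)
    stage₂ no3 (no no1) = stage₃ no3 (λ x h → no1 (x , h)) (any? λ x → any? λ y → any? λ v → (E? G x y ×-dec E? G x v ×-dec ¬? (y ≟ v)) ×-dec ¬? (E? G y v))
    stage₁ : Dec (∃ λ x → length (nbE G x) ≡ 3) → State G k ⊎ Triangles G
    stage₁ (yes (x , l)) = inj₁ (three (nbE G x) refl l)
      where
      three : ∀ l → nbE G x ≡ l → length l ≡ 3 → State G k
      three (y ∷ v₁ ∷ v₂ ∷ []) eq _ = deg3-step (↭-reflexive eq) (deg3 v₁) (deg3 v₂) (λ _ → R)
    stage₁ (no no3) = stage₂ (λ x h → no3 (x , h)) (any? λ x → length (nbE G x) ≟ℕ 1)

-- Triangle-free parts attached at one vertex of unrestricted degree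

record Side {n} (G : Graph n) : Set₁ where
  field
    L : Fin n → Set
    L? : ∀ v → Dec (L v)
    c : Fin n
    c∉L : ¬ L c
    closed : ∀ {l u} → L l → E G l u → L u ⊎ u ≡ c
    degL : ∀ {l} → L l → length (nbE G l) ≤ 3
    notri : ∀ {l p q} → L l → E G l p → E G l q → E G p q → ⊥
    l₀ u₀ : Fin n
    l₀∈L : L l₀
    l₀u₀ : E G l₀ u₀

module Hanging {n} (E₀ : Fin n → Fin n → Set) (k : ℕ) (G : Graph n)
  (ih : ∀ G′ → edges G′ < edges G → Fam E₀ G′ → NoBad G′ → State G′ k) (fam : Fam E₀ G) (nb : NoBad G) (side : Side G) where

  open Reduction E₀ k G ih fam nb
  open Side side

  -- Only c can lie in the component of a new bad triangle, and it has lost a single edge c x.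
  rescue-side : ∀ {B} → Del G B → AllOdd B → (∀ {t} → t ∈ eB B → L t ⊎ t ≡ c) →
    (x : Fin n) → (∀ u → adj G c u ≡ true → u ≢ x → adj (G ⊕* B) c u ≡ true) → Rescue B
  rescue-side {B} d ao inL x only p q r t (tri@(pq , qr , pr) , clos) t∈ kt =
    to-diamond d ao tri t∈ kt (small (here refl)) (small (there (here refl))) (small (there (there (here refl)))) same
    where
    G′ = G ⊕* B
    lift : ∀ {t u} → t ∈ eB B → Ev (G ⊕* B) u → adj (G ⊕* B) t u ≡ true → E G t u
    lift t∈ = touched-E B d ao t∈
    at-c : ∀ {t} → t ∈ eB B → K (G ⊕* B) p q r t → t ≡ c
    at-c t∈ kt with inL t∈
    ... | inj₂ e = e
    ... | inj₁ l = ⊥-elim (case proj₁ (K-odd B d ao tri t∈ kt) of λ where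
      (inj₁ (e , f)) → notri l (lift t∈ (proj₁ (proj₂ pq)) e) (lift t∈ (proj₂ (proj₂ pq)) f) (E-down B d ao pq)
      (inj₂ (inj₁ (e , f))) → notri l (lift t∈ (proj₁ (proj₂ qr)) e) (lift t∈ (proj₂ (proj₂ qr)) f) (E-down B d ao qr)
      (inj₂ (inj₂ (e , f))) → notri l (lift t∈ (proj₁ (proj₂ pr)) e) (lift t∈ (proj₂ (proj₂ pr)) f) (E-down B d ao pr))
    t≡c : t ≡ c
    t≡c = at-c t∈ kt
    even-K : ∀ {u} → Ev G u → K G′ p q r u → u ∈ p ∷ q ∷ r ∷ c ∷ []
    even-K ev (inj₁ u∈) = ∈-++⁺ˡ u∈
    even-K {u} ev ku@(inj₂ (o , _)) = case u ∈? eB B of λ where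
      (yes u∈) → there (there (there (here (at-c u∈ ku))))
      (no u∉) → ⊥-elim (true≢false (trans (symm (untouched-par G B u∉)) o) ev)
    evPQR : ∀ {z} → z ∈ p ∷ q ∷ r ∷ [] → Ev G′ z
    evPQR (here refl) = proj₁ (proj₂ pq)
    evPQR (there (here refl)) = proj₂ (proj₂ pq)
    evPQR (there (there (here refl))) = proj₂ (proj₂ qr)
    -- The triangle lies outside `L`, where degrees are not bounded. But a bad component is closed
    -- under adjacency, and its vertices that are even in `G` are only `p`, `q`, `r` and `c`.
    small : ∀ {z} → z ∈ p ∷ q ∷ r ∷ [] → length (nbE G z) ≤ 3
    small {z} z∈ = ≤-pred (Unique-⊆-length {xs = z ∷ nbE G z} {p ∷ q ∷ r ∷ c ∷ []} (All.tabulate (λ u∈ → E-≢ G (nbE-∈ G u∈)) ∷ nbE-unique G z) sub)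
      where
      sub : ∀ {u} → u ∈ z ∷ nbE G z → u ∈ p ∷ q ∷ r ∷ c ∷ []
      sub (here refl) = ∈-++⁺ˡ z∈
      sub {u} (there u∈) = let e = nbE-∈ G u∈ in even-K (proj₂ (proj₂ e))
        (clos z u (inj₁ z∈) (trans (untouched-adj G B (even-untouched B d ao (evPQR z∈)) u) (proj₁ e)))
    x-only : ∀ {u} → E G t u → u ∉ p ∷ q ∷ r ∷ [] → u ≡ x
    x-only {u} e u∉ = case u ≟ x of λ where
      (yes h) → h
      (no u≢x) → ⊥-elim (case even-K (proj₂ (proj₂ e)) (clos t u kt (subst (λ z → adj G′ z u ≡ true) (symm t≡c) (only u (subst (λ z → adj G z u ≡ true) t≡c (proj₁ e)) u≢x))) of λ where
        (here h) → ∉₁ u∉ h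
        (there (here h)) → ∉₂ u∉ h
        (there (there (here h))) → ∉₃ u∉ h
        (there (there (there (here h)))) → E-≢ G e (trans t≡c (symm h)))
    same : ∀ u u′ → E G t u → E G t u′ → u ∉ p ∷ q ∷ r ∷ [] → u′ ∉ p ∷ q ∷ r ∷ [] → u ≡ u′
    same u u′ e e′ n n′ = trans (x-only e n) (symm (x-only e′ n′))

  in-L : ∀ {l u} → L l → E G l u → u ≢ c → L u
  in-L l e u≢c = case closed l e of λ where
    (inj₁ h) → h
    (inj₂ h) → contradiction h u≢c

  L≢c : ∀ {l} → L l → c ≢ l
  L≢c l refl = c∉L l

  -- Among the three neighbours only `y` may be `c`, since `restore-deg3` puts no bound on the
  -- degree of `y`.
  side-deg3 : ∀ {x y v₁ v₂} → L x → nbE G x ↭ y ∷ v₁ ∷ v₂ ∷ [] → v₁ ≢ c → v₂ ≢ c → State G k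
  side-deg3 {x} {y} {v₁} {v₂} l perm n₁ n₂ = deg3-step perm (degL (in-L l (e (there (here refl))) n₁)) (degL (in-L l (e (there (there (here refl)))) n₂)) λ where
      refl d ao → rescue-side d ao (inL ∘ ∈-star _) x (λ u h u≢x → trans (kept-edges G (star x (y ∷ v₁ ∷ v₂ ∷ [])) (λ m → away u u≢x m)) h)
    where
    e : ∀ {u} → u ∈ y ∷ v₁ ∷ v₂ ∷ [] → E G x u
    e u∈ = nbE-∈ G (∈-resp-↭ (↭-sym perm) u∈)
    inL : ∀ {t} → t ≡ x ⊎ t ∈ y ∷ v₁ ∷ v₂ ∷ [] → L t ⊎ t ≡ c
    inL (inj₁ refl) = inj₁ l
    inL (inj₂ t∈) = closed l (e t∈)
    away : ∀ u → u ≢ x → ∀ {a z} → (a , z) ∈ star x (y ∷ v₁ ∷ v₂ ∷ []) → isE a z c u ≡ false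
    away u u≢x m with ∈-map⁻ (x ,_) m
    ... | z , _ , refl = ≢true λ h → case isE-ends x z c u h of λ where
      (_ , inj₁ (q , _)) → L≢c l q
      (_ , inj₂ (_ , q)) → u≢x q

  side-deg1 : ∀ {x y} → L x → nbE G x ≡ y ∷ [] → State G k
  side-deg1 {x} {y} l eq = deg1-step eq λ where
      refl d ao → rescue-side d ao inL x (λ u h u≢x → trans (kept-edges G ((x , y) ∷ []) (λ { (here refl) → away u u≢x })) h)
    where
    inL : ∀ {t} → t ∈ x ∷ y ∷ [] → L t ⊎ t ≡ c
    inL (here refl) = inj₁ l
    inL (there (here refl)) = closed l (nbE-∈ G (subst (y ∈_) (symm eq) (here refl)))
    away : ∀ u → u ≢ x → isE x y c u ≡ false
    away u u≢x = ≢true λ h → case isE-ends x y c u h of λ where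
      (_ , inj₁ (q , _)) → L≢c l q
      (_ , inj₂ (_ , q)) → u≢x q

  side-deg2 : ∀ {x y v u} → L x → L v → nbE G x ↭ y ∷ v ∷ [] → nbE G v ↭ x ∷ u ∷ [] → State G k
  side-deg2 {x} {y} {v} {u} l lv px pv = deg2-step px pv y≢u λ where
      -- As the side contains no triangle, `y` and `u` differ; so `c` can be only one of them and
      -- loses at most one edge, `c v` or `c x`.
      refl d ao → case c ≟ u of λ where
        (yes c≡u) → rescue-side d ao inL v (λ z h z≢v → trans (kept-edges G ((x , y) ∷ (v , u) ∷ []) (λ where
          (here refl) → avoid {x} {y} {z} l (λ (q , _) → y≢u (trans (symm q) c≡u))
          (there (here refl)) → avoid {v} {u} {z} lv (λ (_ , q) → z≢v q))) h)
        (no c≢u) → rescue-side d ao inL x (λ z h z≢x → trans (kept-edges G ((x , y) ∷ (v , u) ∷ []) (λ where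
          (here refl) → avoid {x} {y} {z} l (λ (_ , q) → z≢x q)
          (there (here refl)) → avoid {v} {u} {z} lv (λ (q , _) → c≢u q))) h)
    where
    exy : E G x y
    exy = nbE-∈ G (∈-resp-↭ (↭-sym px) (here refl))
    exv : E G x v
    exv = nbE-∈ G (∈-resp-↭ (↭-sym px) (there (here refl)))
    evu : E G v u
    evu = nbE-∈ G (∈-resp-↭ (↭-sym pv) (there (here refl)))
    y≢u : y ≢ u
    y≢u refl = notri l exy exv (E-sym G evu)
    avoid : ∀ {a b z} → L a → (c ≡ b × z ≡ a → ⊥) → isE a b c z ≡ false
    avoid {a} {b} {z} la off = ≢true λ h → case isE-ends a b c z h of λ where
      (_ , inj₁ (q , _)) → L≢c la q
      (_ , inj₂ q) → off q
    inL : ∀ {t} → t ∈ x ∷ y ∷ v ∷ u ∷ [] → L t ⊎ t ≡ c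
    inL (here refl) = inj₁ l
    inL (there (here refl)) = closed l exy
    inL (there (there (here refl))) = inj₁ lv
    inL (there (there (there (here refl)))) = closed lv evu

  reduce-side : State G k
  reduce-side = stage₁ (any? λ x → L? x ×-dec (length (nbE G x) ≟ℕ 3))
    where
    stage₃ : (∀ {x} → L x → length (nbE G x) ≢ 3) → (∀ {x} → L x → length (nbE G x) ≢ 1) → State G k
    stage₃ no3 no1 = start (nbE G l₀) refl (∈-nbE G l₀u₀)
      where
      two : ∀ {z} → L z → ∀ l → nbE G z ≡ l → ∀ {a} → a ∈ l → ∃ λ u → nbE G z ↭ a ∷ u ∷ []
      two lz (a ∷ []) eq _ = ⊥-elim (no1 lz (cong length eq))
      two lz (a ∷ u ∷ []) eq (here refl) = u , ↭-reflexive eq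
      two lz (u ∷ a ∷ []) eq (there (here refl)) = u , ↭-trans (↭-reflexive eq) swap′
      two lz (_ ∷ _ ∷ _ ∷ []) eq _ = ⊥-elim (no3 lz (cong length eq))
      two lz (_ ∷ _ ∷ _ ∷ _ ∷ _) eq _ = case ≤-trans (≤-reflexive (cong length (symm eq))) (degL lz) of λ { (s≤s (s≤s (s≤s ()))) }
      go : ∀ {y v} → nbE G l₀ ↭ y ∷ v ∷ [] → v ≢ c → State G k
      go {y} {v} p v≢c = let u , pv = two lv (nbE G v) refl (∈-nbE G (E-sym G e)) in side-deg2 l₀∈L lv p pv
        where
        e : E G l₀ v
        e = nbE-∈ G (∈-resp-↭ (↭-sym p) (there (here refl)))
        lv : L v
        lv = in-L l₀∈L e v≢c
      -- At this stage `l₀` has degree two and at most one of its neighbours is `c`; the other lies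
      -- in `L` and has degree two as well.
      start : ∀ l → nbE G l₀ ≡ l → u₀ ∈ nbE G l₀ → State G k
      start l eq u∈ with two l₀∈L l eq (subst (u₀ ∈_) eq u∈)
      ... | v , p with v ≟ c
      ...   | no v≢c = go p v≢c
      ...   | yes refl with (h ∷ _) ∷ _ ← Unique-↭ p (nbE-unique G l₀) = go (↭-trans p swap′) h
    stage₂ : (∀ {x} → L x → length (nbE G x) ≢ 3) → Dec (∃ λ x → L x × length (nbE G x) ≡ 1) → State G k
    stage₂ no3 (no no1) = stage₃ no3 (λ l h → no1 (_ , l , h))
    stage₂ no3 (yes (x , lx , len)) = leaf (nbE G x) refl len
      where
      leaf : ∀ l → nbE G x ≡ l → length l ≡ 1 → State G k
      leaf (y ∷ []) eq _ = side-deg1 lx eq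
    stage₁ : Dec (∃ λ x → L x × length (nbE G x) ≡ 3) → State G k
    stage₁ (no no3) = stage₂ (λ l h → no3 (_ , l , h)) (any? λ x → L? x ×-dec (length (nbE G x) ≟ℕ 1))
    stage₁ (yes (x , lx , len)) = three (nbE G x) refl len
      where
      three : ∀ l → nbE G x ≡ l → length l ≡ 3 → State G k
      -- If `c` is among the three neighbours, it goes to the front, the place without a degree
      -- bound.
      three (y₁ ∷ y₂ ∷ y₃ ∷ []) eq _ with y₂ ≟ c | y₃ ≟ c | subst Unique eq (nbE-unique G x)
      ... | no n₂ | no n₃ | _ = side-deg3 lx (↭-reflexive eq) n₂ n₃
      ... | yes refl | _ | (n₁₂ ∷ _) ∷ (n₂₃ ∷ _) ∷ _ = side-deg3 lx (↭-trans (↭-reflexive eq) swap′) n₁₂ (≢-sym n₂₃)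
      ... | no n₂ | yes refl | (_ ∷ n₁₃ ∷ _) ∷ (n₂₃ ∷ _) ∷ _ = side-deg3 lx (↭-trans (↭-reflexive eq) (↭-trans (prep y₁ swap′) swap′)) n₁₃ n₂₃

-- A vertex joined to a triangle: deleting and restoring edges around both

module TrianglePart {n} (Γ : Graph n) {k : ℕ} (w a b c : Fin n) (uq : Unique (w ∷ a ∷ b ∷ c ∷ []))
  (wa : adj Γ w a ≡ true) (wb : adj Γ w b ≡ true) (ac : adj Γ a c ≡ true) where

  -- An odd number of edges at `w` is deleted, so `w` changes parity too. The purpose is the second
  -- end that `back` leaves at `w`: it can pay for one further edge there.
  record Part : Set where
    field
      B : List (Edge n)
      del : Del Γ B
      shorter : edges (Γ ⊕* B) < edges Γ
      inside : ∀ {t} → t ∈ eB B → t ∈ w ∷ a ∷ b ∷ c ∷ []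
      toggles : ∀ {t} → t ∈ w ∷ a ∷ b ∷ c ∷ [] → par (Γ ⊕* B) t ≡ not (par Γ t)
      back : (s : State (Γ ⊕* B) k) → (∀ {t} → t ∈ w ∷ a ∷ b ∷ c ∷ [] → 1 ≤ D s t) →
        (∀ {v z} → v ∈ w ∷ a ∷ b ∷ c ∷ [] → adj Γ v z ≡ true → z ∉ w ∷ a ∷ b ∷ c ∷ [] → 1 ≤ D s z) →
        Σ (State Γ k) λ s′ → 2 ≤ D s′ w × (∀ z → z ∉ w ∷ a ∷ b ∷ c ∷ [] → D s z ≤ D s′ z)

  private
    in-b : b ∈ w ∷ a ∷ b ∷ c ∷ []
    in-b = there (there (here refl))
    in-c : c ∈ w ∷ a ∷ b ∷ c ∷ []
    in-c = there (there (there (here refl)))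

  all-adjacent : adj Γ w c ≡ true → Part
  all-adjacent wc = record
    { B = B ; del = del ; shorter = edges-⊕* Γ _ _ del
    ; inside = λ t∈ → case ∈-star (a ∷ b ∷ c ∷ []) t∈ of λ { (inj₁ e) → here e ; (inj₂ q) → there q }
    ; toggles = λ { (here refl) → trans par-center (xor-comm (par Γ w) true) ; (there t∈) → par-touched t∈ }
    ; back = λ s h nbr → restore₃ Γ w a b c uq wa wb wc s (h (here refl)) (h (there (here refl))) (h in-b) (h in-c)
        (λ z e z∉ → nbr (here refl) e (λ { (here refl) → adj-≢ Γ e refl ; (there q) → z∉ q }))
        (λ where
          v (here refl) → a ∷ c ∷ [] , ≤-refl , λ z e z≢w → case z ∈? a ∷ c ∷ [] of λ where
            (yes q) → inj₁ q
            (no q) → let z∉ = out z≢w (∉₁ q) (≢-sym (adj-≢ Γ e)) (∉₂ q) in inj₂ (z∉ ∘ there , nbr in-b e z∉)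
          v (there (here refl)) → a ∷ b ∷ [] , ≤-refl , λ z e z≢w → case z ∈? a ∷ b ∷ [] of λ where
            (yes q) → inj₁ q
            (no q) → let z∉ = out z≢w (∉₁ q) (∉₂ q) (≢-sym (adj-≢ Γ e)) in inj₂ (z∉ ∘ there , nbr in-c e z∉))
    }
    where
    adjX : ∀ {x} → x ∈ a ∷ b ∷ c ∷ [] → adj Γ w x ≡ true
    adjX (here refl) = wa
    adjX (there (here refl)) = wb
    adjX (there (there (here refl))) = wc
    open Cut Γ w (a ∷ b ∷ c ∷ []) [] uq adjX (λ ())
    out : ∀ {z} → z ≢ w → z ≢ a → z ≢ b → z ≢ c → z ∉ w ∷ a ∷ b ∷ c ∷ []
    out p q r s (here e) = p e
    out p q r s (there (here e)) = q e
    out p q r s (there (there (here e))) = r e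
    out p q r s (there (there (there (here e)))) = s e

  -- The edges `w b` and `a c` also meet each of the four vertices once. Adding `a c` at `a` may
  -- cost `c` its end, which does no harm because `c` is not adjacent to `w`; then `w b`, added at
  -- `w`, brings the second end.
  two-adjacent : adj Γ w c ≡ false → Part
  two-adjacent wc = record
    { B = B ; del = del ; shorter = edges-⊕* Γ _ _ del
    ; inside = λ t∈ → case ∈-eB-star++ (b ∷ []) ((a , c) ∷ []) t∈ of λ where
        (inj₁ e) → here e
        (inj₂ q) → there (∈-resp-↭ swap′ q)
    ; toggles = λ { (here refl) → trans par-center (xor-comm (par Γ w) true) ; (there t∈) → par-touched (∈-resp-↭ swap′ t∈) }
    ; back = restored
    }
    where
    uq′ : Unique (w ∷ b ∷ a ∷ c ∷ [])
    uq′ = Unique-↭ (prep w swap′) uq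
    adjX : ∀ {x} → x ∈ b ∷ [] → adj Γ w x ≡ true
    adjX (here refl) = wb
    adjM : ∀ {x y} → (x , y) ∈ (a , c) ∷ [] → adj Γ x y ≡ true
    adjM (here refl) = ac
    open Cut Γ w (b ∷ []) ((a , c) ∷ []) uq′ adjX adjM
    w≢b = adj-≢ Γ wb
    w≢a = adj-≢ Γ wa
    b≢c : b ≢ c
    b≢c refl = Unique-++-∉ (w ∷ a ∷ b ∷ []) uq in-b′ (here refl)
      where
      in-b′ : b ∈ w ∷ a ∷ b ∷ []
      in-b′ = there (there (here refl))
    a≢b : a ≢ b
    a≢b refl = Unique-++-∉ (w ∷ a ∷ []) uq (there (here refl)) (here refl)
    restored : (s : State (Γ ⊕* B) k) → (∀ {t} → t ∈ w ∷ a ∷ b ∷ c ∷ [] → 1 ≤ D s t) →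
        (∀ {v z} → v ∈ w ∷ a ∷ b ∷ c ∷ [] → adj Γ v z ≡ true → z ∉ w ∷ a ∷ b ∷ c ∷ [] → 1 ≤ D s z) →
        Σ (State Γ k) λ s′ → 2 ≤ D s′ w × (∀ z → z ∉ w ∷ a ∷ b ∷ c ∷ [] → D s z ≤ D s′ z)
    restored s h nbr = s₂ , ≤-trans (s≤s (≤-trans (h (here refl)) (keep₁ {w} (λ { refl → Unique-++-∉ (w ∷ []) uq (here refl) (there (there (here refl))) })))) (upd-gain {s = s₁} {s₂} (proj₂ r₂) w≢b)
        , λ z z∉ → ≤-trans (keep₁ (λ e → z∉ (there (there (there (here e)))))) (upd-≥ {s = s₁} {s₂} (proj₂ r₂) (λ e → z∉ (there (there (here e)))))
      where
      good : ∀ {v z} → v ∈ w ∷ a ∷ b ∷ c ∷ [] → adj Γ v z ≡ true → 1 ≤ D s z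
      good {v} {z} v∈ e = case z ∈? w ∷ a ∷ b ∷ c ∷ [] of λ where
        (yes q) → h q
        (no q) → nbr v∈ e q
      Γ₁ = Γ ⊕ (w , b)
      r₁ : Σ (State Γ₁ k) (Upd a c s)
      r₁ = restore Γ₁ s a c (⊕-comm Γ (a , c) (w , b)) (kept₁ Γ ((w , b) ∷ []) ac (λ { (here e) → w≢a (symm e) ; (there (here e)) → a≢b e })) []
        (λ z e _ → inj₂ (good (there (here refl)) (still-adj Γ wb a z e))) (h in-c)
      s₁ = proj₁ r₁
      keep₁ : ∀ {z} → z ≢ c → D s z ≤ D s₁ z
      keep₁ = upd-≥ {s = s} {s₁} (proj₂ r₁)
      r₂ : Σ (State Γ k) (Upd w b s₁)
      r₂ = restore Γ s₁ w b (λ _ _ → refl) wb []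
        (λ z e z≢b → inj₂ (≤-trans (good (here refl) e) (keep₁ {z} (λ { refl → true≢false e wc }))))
        (≤-trans (h in-b) (keep₁ b≢c))
      s₂ = proj₁ r₂

  part : Part
  part = go (adj Γ w c) refl
    where
    go : ∀ t → adj Γ w c ≡ t → Part
    go true = all-adjacent
    go false = two-adjacent

-- The inductive step for isolated vertices and triangles

module Triangular {n} (E₀ : Fin n → Fin n → Set) (k : ℕ) (G : Graph n)
  (ih : ∀ G′ → edges G′ < edges G → Fam E₀ G′ → NoBad G′ → State G′ k) (fam : Fam E₀ G) (nb : NoBad G) (tris : Triangles G) where

  deg≤2 : ∀ x → length (nbE G x) ≤ 2
  deg≤2 x with tris x
  ... | inj₁ eq = subst (λ l → length l ≤ 2) (symm eq) z≤n
  ... | inj₂ (_ , _ , eq , _) = subst (λ l → length l ≤ 2) (symm eq) ≤-refl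

  three-nbrs : ∀ {v a b c} → a ≢ b → a ≢ c → b ≢ c → E G v a → E G v b → E G v c → ⊥
  three-nbrs {v} ab ac bc ea eb ec = 1+n≰n (≤-trans (Unique-⊆-length ((ab ∷ ac ∷ []) ∷ (bc ∷ []) ∷ [] ∷ []) sub) (deg≤2 v))
    where
    sub : ∀ {x} → x ∈ _ → x ∈ nbE G v
    sub (here refl) = ∈-nbE G ea
    sub (there (here refl)) = ∈-nbE G eb
    sub (there (there (here refl))) = ∈-nbE G ec

  closed-triangle : ∀ {a b c} → E G a b → E G a c → E G b c → ∀ {u v} → u ∈ a ∷ b ∷ c ∷ [] → E G u v → v ∈ a ∷ b ∷ c ∷ []
  closed-triangle {a} {b} {c} ab ac bc {v = v} u∈ e = case v ∈? a ∷ b ∷ c ∷ [] of λ where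
      (yes q) → q
      (no q) → ⊥-elim (go q u∈ e)
    where
    go : v ∉ a ∷ b ∷ c ∷ [] → ∀ {u} → u ∈ a ∷ b ∷ c ∷ [] → E G u v → ⊥
    go q (here refl) f = three-nbrs (∉₂ q) (∉₃ q) (E-≢ G bc) f ab ac
    go q (there (here refl)) f = three-nbrs (∉₁ q) (∉₃ q) (E-≢ G ac) f (E-sym G ab) bc
    go q (there (there (here refl))) f = three-nbrs (∉₁ q) (∉₂ q) (E-≢ G ab) f (E-sym G ac) (E-sym G bc)

  even-triangle : ∀ {a b c} → E G a b → E G a c → ∀ {u} → u ∈ a ∷ b ∷ c ∷ [] → Ev G u
  even-triangle ab ac (here refl) = proj₁ (proj₂ ab)
  even-triangle ab ac (there (here refl)) = proj₂ (proj₂ ab)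
  even-triangle ab ac (there (there (here refl))) = proj₂ (proj₂ ac)

  third : ∀ {x a} → E G x a → ∃ λ u → E G x u × E G a u
  third {x} {a} e with tris x
  ... | inj₁ eq = case subst (a ∈_) eq (∈-nbE G e) of λ ()
  ... | inj₂ (y , v , eq , g) with subst (a ∈_) eq (∈-nbE G e)
  ...   | here refl = v , nbE-∈ G (subst (v ∈_) (symm eq) (there (here refl))) , g
  ...   | there (here refl) = y , nbE-∈ G (subst (y ∈_) (symm eq) (here refl)) , E-sym G g

  Kind : Graph n → Fin n → Set
  Kind G′ t = (Ev G t × Od G′ t) ⊎ (∀ c → adj G′ t c ≡ true → Od G′ c)

  reduce-triangular : (G′ : Graph n) (T : List (Fin n)) → (∀ {u v} → adj G′ u v ≡ true → adj G u v ≡ true) →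
    (∀ {v} → v ∉ T → ∀ u → adj G′ v u ≡ adj G v u) → edges G′ < edges G → (∀ {t} → t ∈ T → Kind G′ t) → State G′ k
  reduce-triangular G′ T sub agree lt kind = ih G′ lt (λ e → fam (down e)) nobad
    where
    same-par : ∀ {v} → v ∉ T → par G v ≡ par G′ v
    same-par v∉ = symm (par-row {G = G′} {G} (agree v∉))
    untouched : ∀ {u v} → E G′ u v → u ∉ T
    untouched (e , eu , ev) u∈ = case kind u∈ of λ where
      (inj₁ (_ , o)) → true≢false o eu
      (inj₂ h) → true≢false (h _ e) ev
    down : ∀ {u v} → E G′ u v → E G u v
    down e@(h , eu , ev) = sub h , trans (same-par (untouched e)) eu , trans (same-par (untouched (E-sym G′ e))) ev
    nobad : NoBad G′
    nobad p q r bad@(tri@(pq , qr , pr) , _) with bad-touched G G′ T sub agree nb bad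
    ... | t , t∈ , kt with kind t∈ | kt
    ...   | inj₂ h | inj₁ (here refl) = true≢false (h q (proj₁ pq)) (proj₂ (proj₂ pq))
    ...   | inj₂ h | inj₁ (there (here refl)) = true≢false (h r (proj₁ qr)) (proj₂ (proj₂ qr))
    ...   | inj₂ h | inj₁ (there (there (here refl))) = true≢false (h p (adj-sym G′ (proj₁ pr))) (proj₁ (proj₂ pr))
    ...   | inj₂ h | inj₂ (_ , inj₁ (e , _)) = true≢false (h p e) (proj₁ (proj₂ pq))
    ...   | inj₂ h | inj₂ (_ , inj₂ (inj₁ (e , _))) = true≢false (h q e) (proj₁ (proj₂ qr))
    ...   | inj₂ h | inj₂ (_ , inj₂ (inj₂ (e , _))) = true≢false (h p e) (proj₁ (proj₂ pq))
    ...   | inj₁ (_ , o) | inj₁ (here refl) = true≢false o (proj₁ (proj₂ pq))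
    ...   | inj₁ (_ , o) | inj₁ (there (here refl)) = true≢false o (proj₂ (proj₂ pq))
    ...   | inj₁ (_ , o) | inj₁ (there (there (here refl))) = true≢false o (proj₂ (proj₂ qr))
    ...   | inj₁ (et , o) | inj₂ (_ , two) = clash two
      where
      ne : ∀ {u} → Ev G′ u → t ≢ u
      ne eu refl = true≢false o eu
      clash : Two G′ p q r t → ⊥
      clash (inj₁ (e , _)) = three-nbrs (ne (proj₂ (proj₂ pq))) (ne (proj₂ (proj₂ pr))) (E-≢ G′ qr)
        (adj-sym G (sub e) , proj₁ (proj₂ (down pq)) , et) (down pq) (down pr)
      clash (inj₂ (inj₁ (e , _))) = three-nbrs (ne (proj₁ (proj₂ pq))) (ne (proj₂ (proj₂ qr))) (E-≢ G′ pr)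
        (adj-sym G (sub e) , proj₁ (proj₂ (down qr)) , et) (E-sym G (down pq)) (down qr)
      clash (inj₂ (inj₂ (e , _))) = three-nbrs (ne (proj₂ (proj₂ pq))) (ne (proj₂ (proj₂ pr))) (E-≢ G′ qr)
        (adj-sym G (sub e) , proj₁ (proj₂ (down pq)) , et) (down pq) (down pr)

  -- The deletion of `a x` makes `a` even, which does no harm: all neighbours that `a` keeps are
  -- odd.
  single-even : ∀ {a x} → Od G a → adj G a x ≡ true → Ev G x → (∀ u → adj G a u ≡ true → u ≢ x → Od G u) → State G k
  single-even {a} {x} oa e ex only = Restore.restore-leaf G e ex only
      (reduce-triangular (G ⊕ (a , x)) (a ∷ x ∷ []) (λ {u} {v} → still-adj G e u v) (λ v∉ → adj-other G (∉₁ v∉) (∉₂ v∉)) (edges-⊕ G e) kind)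
    where
    a≢x = adj-≢ G e
    kind : ∀ {t} → t ∈ a ∷ x ∷ [] → Kind (G ⊕ (a , x)) t
    kind (here refl) = inj₂ λ c h → let c≢x = λ { refl → true≢false h (removed G e) } in
      trans (par-other G a≢x (≢-sym (adj-≢ (G ⊕ (a , x)) h)) c≢x) (only c (still-adj G e a c h) c≢x)
    kind (there (here refl)) = inj₁ (ex , trans (par-end₂ G a≢x) (cong not ex))

  -- Restoring the edges around a b c leaves two path ends at w, one of which is spent on the edge w z.
  module BoostEdge {w a b c z : Fin n} (ab : E G a b) (ac : E G a c) (bc : E G b c)
    (ow : Od G w) (wa : adj G w a ≡ true) (wb : adj G w b ≡ true) (w-even : ∀ u → adj G w u ≡ true → Ev G u → u ∈ a ∷ b ∷ c ∷ [])
    (oz : Od G z) (wz : adj G w z ≡ true) (z-none : ∀ u → u ∈ a ∷ b ∷ c ∷ [] → adj G z u ≡ false)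
    where

    W : List (Fin n)
    W = w ∷ a ∷ b ∷ c ∷ []

    evT : ∀ {u} → u ∈ a ∷ b ∷ c ∷ [] → Ev G u
    evT = even-triangle ab ac

    closedT : ∀ {u v} → u ∈ a ∷ b ∷ c ∷ [] → adj G u v ≡ true → Ev G v → v ∈ a ∷ b ∷ c ∷ []
    closedT u∈ e ev = closed-triangle ab ac bc u∈ (e , evT u∈ , ev)

    od∉T : ∀ {v} → Od G v → v ∉ a ∷ b ∷ c ∷ []
    od∉T o v∈ = true≢false o (evT v∈)

    w≢z = adj-≢ G wz

    z∉W : z ∉ W
    z∉W (here e) = w≢z (symm e)
    z∉W (there q) = od∉T oz q

    uqW : Unique W
    uqW = All.tabulate (λ {u} u∈ e → od∉T ow (subst (_∈ _) (symm e) u∈)) ∷ (E-≢ G ab ∷ E-≢ G ac ∷ []) ∷ (E-≢ G bc ∷ []) ∷ [] ∷ []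

    -- G₁ lacks the edges that are restored only after w z (those around a second triangle seen by z).
    module Around (G₁ : Graph n) (T₁ : List (Fin n)) (sub₁ : ∀ {u v} → adj G₁ u v ≡ true → adj G u v ≡ true)
      (agree₁ : ∀ {v} → v ∉ T₁ → ∀ u → adj G₁ v u ≡ adj G v u) (le₁ : edges G₁ ≤ edges G)
      (w∉T₁ : w ∉ T₁) (T∉T₁ : ∀ {u} → u ∈ a ∷ b ∷ c ∷ [] → u ∉ T₁)
      (T₁-par : ∀ {u} → u ∈ T₁ → u ≢ z → Ev G u × Od G₁ u)
      (z-even : ∀ u → adj G₁ z u ≡ true → Ev G u → u ∈ T₁) where

      par₁ : ∀ {v} → v ∉ T₁ → par G₁ v ≡ par G v
      par₁ v∉ = par-row {G = G₁} {G} (agree₁ v∉)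

      wz₁ : adj G₁ w z ≡ true
      wz₁ = trans (agree₁ w∉T₁ z) wz
      G₂ = G₁ ⊕ (w , z)

      keep₂ : ∀ {u v} → u ∈ a ∷ b ∷ c ∷ [] → adj G v u ≡ true → adj G₂ v u ≡ true
      keep₂ {u} {v} u∈ e = trans (Graph.sym G₂ v u) (trans (adj-other G₁ (λ { refl → od∉T ow u∈ }) (λ { refl → od∉T oz u∈ }) v)
        (trans (agree₁ (T∉T₁ u∈) v) (adj-sym G e)))

      open TrianglePart G₂ {k} w a b c uqW (keep₂ (here refl) wa) (keep₂ (there (here refl)) wb) (keep₂ (there (there (here refl))) (proj₁ ac))
      open Part part

      G₃ = G₂ ⊕* B
      T₃ = W ++ z ∷ T₁

      sub₂ : ∀ {u v} → adj G₂ u v ≡ true → adj G u v ≡ true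
      sub₂ {u} {v} h = sub₁ (still-adj G₁ wz₁ u v h)

      sub₃ : ∀ {u v} → adj G₃ u v ≡ true → adj G u v ≡ true
      sub₃ h = sub₂ (del-sub G₂ B del h)

      agree₃ : ∀ {v} → v ∉ T₃ → ∀ u → adj G₃ v u ≡ adj G v u
      agree₃ v∉ u = trans (untouched-adj G₂ B (λ v∈ → v∉ (∈-++⁺ˡ (inside v∈))) u)
        (trans (adj-other G₁ (λ e → v∉ (here e)) (λ e → v∉ (∈-++⁺ʳ W (here e))) u) (agree₁ (λ v∈ → v∉ (∈-++⁺ʳ W (there v∈))) u))

      par₃-other : ∀ {v} → v ∉ W → par G₃ v ≡ par G₂ v
      par₃-other v∉ = untouched-par G₂ B (v∉ ∘ inside)

      -- The edge `w z` and the part around `a b c` each change the parity of `w`, so `w` stays odd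
      -- and has an end. Without the deletion of `w z` it would be even.
      par₃-w : Od G₃ w
      par₃-w = trans (toggles (here refl)) (trans (cong not (par-end₁ G₁ w≢z)) (trans (not-involutive _) (trans (par₁ w∉T₁) ow)))

      par₃-T : ∀ {u} → u ∈ a ∷ b ∷ c ∷ [] → Od G₃ u
      par₃-T u∈ = trans (toggles (there u∈)) (cong not (trans (par-other G₁ w≢z (λ { refl → od∉T ow u∈ }) (λ { refl → od∉T oz u∈ })) (trans (par₁ (T∉T₁ u∈)) (evT u∈))))

      par₃-W : ∀ {u} → u ∈ W → Od G₃ u
      par₃-W (here refl) = par₃-w
      par₃-W (there u∈) = par₃-T u∈

      par₃-T₁ : ∀ {u} → u ∈ T₁ → u ≢ z → Od G₃ u
      par₃-T₁ {u} u∈ u≢z = trans (par₃-other u∉W) (trans (par-other G₁ w≢z (λ { refl → w∉T₁ u∈ }) u≢z) (proj₂ (T₁-par u∈ u≢z)))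
        where
        u∉W : u ∉ W
        u∉W (here refl) = w∉T₁ u∈
        u∉W (there q) = T∉T₁ q u∈

      par₃-odd : ∀ {v} → Od G v → v ≢ z → Od G₃ v
      par₃-odd {v} o v≢z = case v ≟ w of λ where
        (yes refl) → par₃-w
        (no v≢w) → trans (par₃-other (λ { (here e) → v≢w e ; (there q) → od∉T o q })) (trans (par-other G₁ w≢z v≢w v≢z)
          (trans (par₁ (λ v∈ → true≢false o (proj₁ (T₁-par v∈ v≢z)))) o))

      lt₃ : edges G₃ < edges G
      lt₃ = ≤-trans shorter (≤-trans (<⇒≤ (edges-⊕ G₁ wz₁)) le₁)

      nbr-w : ∀ u → adj G₂ w u ≡ true → Od G₃ u
      nbr-w u h = case od-or-ev G u of λ where
        (inj₁ o) → par₃-odd o (λ { refl → true≢false h (removed G₁ wz₁) })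
        (inj₂ e) → par₃-T (w-even u (sub₂ h) e)

      nbr-z : ∀ u → adj G₁ z u ≡ true → Od G₃ u
      nbr-z u h = case od-or-ev G u of λ where
        (inj₁ o) → par₃-odd o (≢-sym (adj-≢ G₁ h))
        (inj₂ e) → par₃-T₁ (z-even u h e) (≢-sym (adj-≢ G₁ h))

      kind : ∀ {t} → t ∈ T₃ → Kind G₃ t
      kind (here refl) = inj₂ λ u h → nbr-w u (del-sub G₂ B del h)
      kind (there (here refl)) = inj₁ (evT (here refl) , par₃-T (here refl))
      kind (there (there (here refl))) = inj₁ (evT (there (here refl)) , par₃-T (there (here refl)))
      kind (there (there (there (here refl)))) = inj₁ (evT (there (there (here refl))) , par₃-T (there (there (here refl))))
      kind (there (there (there (there (here refl))))) = inj₂ λ u h → nbr-z u (still-adj G₁ wz₁ z u (del-sub G₂ B del h))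
      kind {t} (there (there (there (there (there t∈))))) = case t ≟ z of λ where
        (yes refl) → inj₂ λ u h → nbr-z u (still-adj G₁ wz₁ z u (del-sub G₂ B del h))
        (no t≢z) → inj₁ (proj₁ (T₁-par t∈ t≢z) , par₃-T₁ t∈ t≢z)

      s₃ : State G₃ k
      s₃ = reduce-triangular G₃ T₃ sub₃ agree₃ lt₃ kind

      nbr-W : ∀ {v u} → v ∈ W → adj G₂ v u ≡ true → u ∉ W → 1 ≤ D s₃ u
      nbr-W (here refl) h u∉ = odd-D s₃ (nbr-w _ h)
      nbr-W {v} {u} (there v∈) h u∉ = odd-D s₃ (case od-or-ev G u of λ where
        (inj₁ o) → par₃-odd o (λ { refl → true≢false (adj-sym G (sub₂ h)) (z-none v v∈) })
        (inj₂ e) → ⊥-elim (u∉ (there (closedT v∈ (sub₂ h) e))))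

      boosted : Σ (State G₁ k) λ s₁ → (1 ≤ D s₁ w) × suc (D s₃ z) ≤ D s₁ z × (∀ u → u ∉ W → D s₃ u ≤ D s₁ u)
      boosted = proj₁ r , ≤-pred (≤-trans dw (upd-loss {s = s₂} {proj₁ r} (proj₂ r))) ,
          ≤-trans (s≤s (keep z z∉W)) (upd-gain {s = s₂} {proj₁ r} (proj₂ r) (≢-sym w≢z)) ,
          λ u u∉ → ≤-trans (keep u u∉) (upd-≥ {s = s₂} {proj₁ r} (proj₂ r) (u∉ ∘ here))
        where
        q = back s₃ (λ t∈ → odd-D s₃ (par₃-W t∈)) nbr-W
        s₂ = proj₁ q
        dw : 2 ≤ D s₂ w
        dw = proj₁ (proj₂ q)
        keep : ∀ u → u ∉ W → D s₃ u ≤ D s₂ u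
        keep = proj₂ (proj₂ q)
        -- The edge is added at `z`, whose other neighbours are odd in `G₃` and do not lie on the
        -- triangle, so they still have their ends. Thus `z` gains an end whatever its parity.
        r : Σ (State G₁ k) (Upd z w s₂)
        r = restore G₁ s₂ z w (λ u v → cong (adj G₁ u v xor_) (isE-swap w z u v)) (adj-sym G₁ wz₁) []
          (λ u h u≢w → inj₂ (≤-trans (odd-D s₃ (nbr-z u h)) (keep u (λ where
            (here e) → u≢w e
            (there u∈) → true≢false (sub₁ h) (z-none u u∈)))))
          (≤-trans (s≤s z≤n) dw)

    no-even-nbrs : (∀ u → adj G z u ≡ true → Od G u) → State G k
    no-even-nbrs odds = proj₁ (Around.boosted G [] id (λ _ _ → refl) ≤-refl (λ ()) (λ _ ()) (λ ())
      (λ u h e → ⊥-elim (true≢false (odds u h) e)))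

    -- The part around the second triangle makes `z` even in `G₁`, so parity yields no end at `z`;
    -- the end gained with `w z` takes its place.
    second-triangle : ∀ {a′ b′ c′} → E G a′ b′ → E G a′ c′ → E G b′ c′ → adj G z a′ ≡ true → adj G z b′ ≡ true →
      (∀ u → adj G z u ≡ true → Ev G u → u ∈ a′ ∷ b′ ∷ c′ ∷ []) → State G k
    second-triangle {a′} {b′} {c′} ab′ ac′ bc′ za zb z-ev = proj₁ (P.back s₁ good nbr)
      where
      T′ = a′ ∷ b′ ∷ c′ ∷ []
      W′ = z ∷ T′
      evT′ : ∀ {u} → u ∈ T′ → Ev G u
      evT′ = even-triangle ab′ ac′
      a′∉T : ∀ {u} → u ∈ a′ ∷ b′ ∷ [] → u ∉ a ∷ b ∷ c ∷ []
      a′∉T (here refl) q = true≢false za (z-none _ q)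
      a′∉T (there (here refl)) q = true≢false zb (z-none _ q)
      disjoint : ∀ {u} → u ∈ T′ → u ∉ a ∷ b ∷ c ∷ []
      disjoint (here refl) = a′∉T (here refl)
      disjoint (there (here refl)) = a′∉T (there (here refl))
      disjoint (there (there (here refl))) q = a′∉T (here refl) (closedT q (adj-sym G (proj₁ ac′)) (proj₁ (proj₂ ab′)))
      uqW′ : Unique W′
      uqW′ = All.tabulate (λ {u} u∈ e → true≢false oz (evT′ (subst (_∈ _) (symm e) u∈))) ∷ (E-≢ G ab′ ∷ E-≢ G ac′ ∷ []) ∷ (E-≢ G bc′ ∷ []) ∷ [] ∷ []
      module P = TrianglePart.Part (TrianglePart.part G {k} z a′ b′ c′ uqW′ za zb (proj₁ ac′))
      G₁ = G ⊕* P.B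
      w∉W′ : w ∉ W′
      w∉W′ (here e) = w≢z e
      w∉W′ (there q) = true≢false ow (evT′ q)
      T₁-par : ∀ {u} → u ∈ W′ → u ≢ z → Ev G u × Od G₁ u
      T₁-par (here e) u≢z = contradiction e u≢z
      T₁-par (there q) _ = evT′ q , trans (P.toggles (there q)) (cong not (evT′ q))
      T∉W′ : ∀ {u} → u ∈ a ∷ b ∷ c ∷ [] → u ∉ W′
      T∉W′ q (here refl) = od∉T oz q
      T∉W′ q (there q′) = disjoint q′ q
      module A = Around G₁ W′ (λ h → del-sub G P.B P.del h) (λ v∉ → untouched-adj G P.B (v∉ ∘ P.inside)) (<⇒≤ P.shorter) w∉W′ T∉W′ T₁-par
        (λ u h e → there (z-ev u (del-sub G P.B P.del h) e))
      s₁ = proj₁ A.boosted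
      keep : ∀ u → u ∉ W → D A.s₃ u ≤ D s₁ u
      keep = proj₂ (proj₂ (proj₂ A.boosted))
      good : ∀ {t} → t ∈ W′ → 1 ≤ D s₁ t
      good (here refl) = ≤-trans (s≤s z≤n) (proj₁ (proj₂ (proj₂ A.boosted)))
      good {t} (there t∈) = ≤-trans (odd-D A.s₃ (A.par₃-T₁ (there t∈) (λ { refl → true≢false oz (evT′ t∈) })))
        (keep t (λ { (here refl) → w∉W′ (there t∈) ; (there q) → disjoint t∈ q }))
      closed′ : ∀ {v u} → v ∈ W′ → adj G v u ≡ true → Ev G u → u ∈ T′
      closed′ (here refl) h e = z-ev _ h e
      closed′ (there v∈) h e = closed-triangle ab′ ac′ bc′ v∈ (h , evT′ v∈ , e)
      nbr : ∀ {v u} → v ∈ W′ → adj G v u ≡ true → u ∉ W′ → 1 ≤ D s₁ u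
      nbr {v} {u} v∈ h u∉ = case od-or-ev G u of λ where
        (inj₂ e) → ⊥-elim (u∉ (there (closed′ v∈ h e)))
        (inj₁ o) → case u ≟ w of λ where
          (yes refl) → proj₁ (proj₂ A.boosted)
          (no u≢w) → ≤-trans (odd-D A.s₃ (A.par₃-odd o (u∉ ∘ here))) (keep u (λ { (here e) → u≢w e ; (there q) → od∉T o q }))

-- Restoring matchings and stars

⊕*-++ : ∀ {n} (G : Graph n) (B C : List (Edge n)) → G ⊕* (B ++ C) ≡ (G ⊕* C) ⊕* B
⊕*-++ G [] C = refl
⊕*-++ G (e ∷ B) C = cong (_⊕ e) (⊕*-++ G B C)

⊕*-≈ : ∀ {n} {G G′ : Graph n} → G ≡ G′ → G ≈ G′
⊕*-≈ refl u v = refl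

∈-concat⁺ : ∀ {A B : Set} {f : A → List B} {x xs y} → x ∈ xs → y ∈ f x → y ∈ concatMap f xs
∈-concat⁺ {f = f} {xs = x ∷ xs} (here refl) y∈ = ∈-++⁺ˡ y∈
∈-concat⁺ {f = f} {xs = x ∷ xs} (there x∈) y∈ = ∈-++⁺ʳ (f x) (∈-concat⁺ x∈ y∈)

∈-concat⁻ : ∀ {A B : Set} (f : A → List B) xs {y} → y ∈ concatMap f xs → ∃ λ x → x ∈ xs × y ∈ f x
∈-concat⁻ f (x ∷ xs) y∈ with ∈-++⁻ (f x) y∈
... | inj₁ q = x , here refl , q
... | inj₂ q with z , z∈ , r ← ∈-concat⁻ f xs q = z , there z∈ , r

-- Each edge `(t , t′)` is added at `t` and costs an end only at `t′`. The additions do not disturb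
-- each other because no `t` is adjacent to the second vertex of another edge of `M`.
restore-matching : ∀ {n} (H : Graph n) {k} M → Del H M → Unique (eB M) → (s : State (H ⊕* M) k) →
  (∀ {t t′} → (t , t′) ∈ M → 1 ≤ D s t′ × (∀ z → adj H t z ≡ true → z ≢ t′ → z ∉ map proj₂ M × 1 ≤ D s z)) →
  Σ (State H k) λ s′ → ∀ z → z ∉ map proj₂ M → D s z ≤ D s′ z
restore-matching H [] _ _ s _ = s , λ _ _ → ≤-refl
restore-matching {n} H {k} ((t , t′) ∷ M) (e , d) ((_ ∷ t∉) ∷ t′∉ ∷ u) s h = proj₁ r₂ , λ z z∉ → ≤-trans (keep (∉₁ z∉)) (proj₂ r₂ z (z∉ ∘ there))
  where
  r : Σ (State (H ⊕* M) k) (Upd t t′ s)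
  r = restore (H ⊕* M) s t t′ (λ _ _ → refl) e [] (λ z q z≢t′ → inj₂ (proj₂ (proj₂ (h (here refl)) z (del-sub H M d q) z≢t′))) (proj₁ (h (here refl)))
  keep : ∀ {z} → z ≢ t′ → D s z ≤ D (proj₁ r) z
  keep = upd-≥ {s = s} {proj₁ r} (proj₂ r)
  second-∈ : ∀ {x x′} {N : List (Edge n)} → (x , x′) ∈ N → x′ ∈ eB N
  second-∈ (here refl) = there (here refl)
  second-∈ (there q) = there (there (second-∈ q))
  r₂ : Σ (State H k) λ s′ → ∀ z → z ∉ map proj₂ M → D (proj₁ r) z ≤ D s′ z
  r₂ = restore-matching H M d u (proj₁ r) λ {x} {x′} m → let p , q = h (there m) in
    ≤-trans p (keep {x′} (λ { refl → All.lookup t′∉ (second-∈ m) refl })) ,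
    λ z f z≢x′ → let z∉ , dz = q z f z≢x′ in z∉ ∘ there , ≤-trans dz (keep (∉₁ z∉))

first∉seconds : ∀ {n} {M : List (Edge n)} {t t′} → Unique (eB M) → (t , t′) ∈ M → t ∉ map proj₂ M
first∉seconds {M = M} u m q = go M u m q
  where
  second-∈ : ∀ {x} M → x ∈ map proj₂ M → x ∈ eB M
  second-∈ (_ ∷ M) (here e) = there (here e)
  second-∈ (_ ∷ M) (there q) = there (there (second-∈ M q))
  first-∈ : ∀ {x x′} M → (x , x′) ∈ M → x ∈ eB M
  first-∈ (_ ∷ M) (here refl) = here refl
  first-∈ (_ ∷ M) (there q) = there (there (first-∈ M q))
  go : ∀ {t t′} M → Unique (eB M) → (t , t′) ∈ M → t ∉ map proj₂ M
  go (_ ∷ M) ((t≢t′ ∷ _) ∷ _) (here refl) (here e) = t≢t′ e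
  go (_ ∷ M) ((_ ∷ t∉) ∷ _) (here refl) (there q) = All.lookup t∉ (second-∈ M q) refl
  go (_ ∷ M) (_ ∷ t′∉ ∷ _) (there m) (here refl) = All.lookup t′∉ (first-∈ M m) refl
  go (_ ∷ M) (_ ∷ _ ∷ u) (there m) (there q) = go M u m q

length≤Σ-positive : ∀ {n} (f : Fin n → ℕ) R → (∀ {x} → x ∈ R → 1 ≤ f x) → length R ≤ Σ[ R ] f
length≤Σ-positive f [] h = z≤n
length≤Σ-positive f (x ∷ R) h = +-mono-≤ (h (here refl)) (length≤Σ-positive f R (h ∘ there))

-- Every edge added at w makes at most one neighbour of w run out of ends, so the process can only
-- stop when at least half of the edges have been added.
record Halved {n} (G : Graph n) (k : ℕ) (w : Fin n) (d : Fin n → ℕ) (X : List (Fin n)) : Set where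
  field
    A R : List (Fin n)
    st : State (G ⊕* star w R) k
    split : A ++ R ↭ X
    half : length R ≤ length A
    center : d w + length A ≤ D st w
    others : ∀ z → z ∉ A → d z ≤ D st z

halve : ∀ {n} (G : Graph n) {k} (w : Fin n) X (s : State (G ⊕* star w X) k) → Unique (w ∷ X) →
  (∀ {x} → x ∈ X → adj G w x ≡ true × 1 ≤ D s x) →
  (∀ z → adj G w z ≡ true → z ∉ X → 1 ≤ D s z) → Halved G k w (D s) X
halve {n} G {k} w X s uq hX hN = go (length X) [] X ≤-refl ↭-refl s (≤-reflexive (+-identityʳ _)) (λ z _ → ≤-refl)
  where
  w∉X : w ∉ X
  w∉X = Uniqueₚ.Unique[x∷xs]⇒x∉xs uq
  go : ∀ f A R → length R ≤ f → A ++ R ↭ X → (t : State (G ⊕* star w R) k) → D s w + length A ≤ D t w →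
    (∀ z → z ∉ A → D s z ≤ D t z) → Halved G k w (D s) X
  go f A R lf p t cw ot with length R ≤? length A
  ... | yes le = record { A = A ; R = R ; st = t ; split = p ; half = le ; center = cw ; others = ot }
  go zero A R lf p t cw ot | no nle = ⊥-elim (nle (≤-trans lf z≤n))
  go (suc f) A R lf p t cw ot | no nle = step (restore-any t w R A uR nonadj cov big)
    where
    uAR : Unique (A ++ R)
    uAR = Unique-↭ (↭-sym p) (Unique-++ʳ (w ∷ []) uq)
    uR = Unique-++ʳ A uAR
    inX : ∀ {x} → x ∈ R → x ∈ X
    inX x∈ = ∈-resp-↭ p (∈-++⁺ʳ A x∈)
    adjR : ∀ {x} → x ∈ R → adj G w x ≡ true
    adjR x∈ = proj₁ (hX (inX x∈))
    delR : Del G (star w R)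
    delR = del-star G R (All.tabulate (λ {x} x∈ e → w∉X (subst (_∈ X) (symm e) (inX x∈))) ∷ uR) adjR
    dR : ∀ {x} → x ∈ R → 1 ≤ D t x
    dR {x} x∈ = ≤-trans (proj₂ (hX (inX x∈))) (ot x (λ x∈A → Unique-++-∉ A uAR x∈A x∈))
    nonadj : ∀ {x} → x ∈ R → x ≢ w × adj (G ⊕* star w R) w x ≡ false
    nonadj x∈ = (λ { refl → w∉X (inX x∈) }) , del-removed G (star w R) delR (∈-map⁺ (w ,_) x∈)
    cov : ∀ z → adj (G ⊕* star w R) w z ≡ true → z ∈ A ⊎ 1 ≤ D t z
    cov z e = case z ∈? A of λ where
      (yes q) → inj₁ q
      (no q) → inj₂ (≤-trans (hN z (del-sub G (star w R) delR e) (λ z∈X → case ∈-++⁻ A (∈-resp-↭ (↭-sym p) z∈X) of λ where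
        (inj₁ a) → q a
        (inj₂ r) → true≢false e (proj₂ (nonadj r)))) (ot z q))
    big : length A < Σ[ R ] (D t)
    big = ≤-trans (≰⇒> nle) (length≤Σ-positive (D t) R dR)
    step : (∃ λ x → x ∈ R × Σ (State ((G ⊕* star w R) ⊕ (w , x)) k) (Upd w x t)) → Halved G k w (D s) X
    step (x , x∈ , t′ , upd) with ∈⇒↭ x∈
    ... | R′ , pR = go f (x ∷ A) R′ (≤-pred (≤-trans (≤-reflexive (symm (↭-length pR))) lf))
        (↭-trans (↭-sym (shift x A R′)) (↭-trans (↭-++ˡ A (↭-sym pR)) p))
        (cast {G = (G ⊕* star w R) ⊕ (w , x)} {G ⊕* star w R′} same t′)
        (≤-trans (≤-reflexive (+-suc (D s w) (length A))) (≤-trans (s≤s cw) (upd-gain {s = t} {t′} upd (λ { refl → w∉X (inX x∈) }))))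
        (λ z z∉ → ≤-trans (ot z (z∉ ∘ there)) (upd-≥ {s = t} {t′} upd (∉₁ z∉)))
      where
      same : (G ⊕* star w R) ⊕ (w , x) ≈ G ⊕* star w R′
      same = ≈-trans {G = (G ⊕* star w R) ⊕ (w , x)} {(G ⊕* star w R′) ⊕ (w , x) ⊕ (w , x)} {G ⊕* star w R′}
        (⊕-cong {G = G ⊕* star w R} {(G ⊕* star w R′) ⊕ (w , x)} (w , x) (⊕*-↭ G (↭-map (w ,_) pR)))
        (⊕-cancel (G ⊕* star w R′) (w , x))

-- Each edge is added at its outer vertex `r` and costs one end at `w`. As `r` may have two
-- neighbours without ends, three ends at `w` are needed even for the last edge: hence
-- `length R + 2`, and two ends are left.
restore-star : ∀ {n} (Γ : Graph n) {k} (w : Fin n) R → Del Γ (star w R) → (s : State (Γ ⊕* star w R) k) → w ∉ R →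
  (∀ {r} → r ∈ R → ∃ λ Z → length Z ≤ 2 × (∀ z → adj Γ r z ≡ true → z ≢ w → z ∈ Z ⊎ 1 ≤ D s z)) →
  length R + 2 ≤ D s w → Σ (State Γ k) λ s′ → 2 ≤ D s′ w × (∀ z → z ≢ w → D s z ≤ D s′ z)
restore-star Γ w [] _ s _ _ dw = s , dw , λ _ _ → ≤-refl
restore-star Γ {k} w (r ∷ R) (e , d) s w∉ h dw = proj₁ q , proj₁ (proj₂ q) , λ z z≢w → ≤-trans (keep z≢w) (proj₂ (proj₂ q) z z≢w)
  where
  Γ₁ = Γ ⊕* star w R
  Z = proj₁ (h (here refl))
  p : Σ (State Γ₁ k) (Upd r w s)
  p = restore Γ₁ s r w (λ u v → cong (adj Γ₁ u v xor_) (isE-swap w r u v)) (adj-sym Γ₁ e) Z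
    (λ z f z≢w → proj₂ (proj₂ (h (here refl))) z (del-sub Γ (star w R) d f) z≢w)
    (≤-trans (s≤s (≤-trans (proj₁ (proj₂ (h (here refl)))) (m≤n+m 2 (length R)))) dw)
  keep : ∀ {z} → z ≢ w → D s z ≤ D (proj₁ p) z
  keep = upd-≥ {s = s} {proj₁ p} (proj₂ p)
  q = restore-star Γ w R d (proj₁ p) (w∉ ∘ there)
    (λ r∈ → let Z , l , c = h (there r∈) in Z , l , λ z f z≢w → case c z f z≢w of λ where
      (inj₁ i) → inj₁ i
      (inj₂ i) → inj₂ (≤-trans i (keep z≢w)))
    (≤-pred (≤-trans dw (upd-loss {s = s} {proj₁ p} (proj₂ p))))

-- Odd vertices that meet several components of the even subgraph
module Hub {n} (E₀ : Fin n → Fin n → Set) (k : ℕ) (G : Graph n)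
  (ih : ∀ G′ → edges G′ < edges G → Fam E₀ G′ → NoBad G′ → State G′ k) (fam : Fam E₀ G) (nb : NoBad G) (tris : Triangles G)
  (w : Fin n) (ow : Od G w) where

  open Triangular E₀ k G ih fam nb tris

  -- How a component of the even subgraph that meets w is cut off: `tri s t t′` removes w s and t t′
  -- where t′ is not adjacent to w, the others remove only edges at w.
  data Gadget : Set where
    iso : Fin n → Gadget
    tri all two : Fin n → Fin n → Fin n → Gadget

  spokes verts firsts : Gadget → List (Fin n)
  spokes (iso s) = s ∷ []
  spokes (tri s t t′) = s ∷ []
  spokes (all a b c) = a ∷ b ∷ c ∷ []
  spokes (two a b c) = a ∷ b ∷ []
  verts (iso s) = s ∷ []
  verts (tri s t t′) = s ∷ t ∷ t′ ∷ []
  verts (all a b c) = a ∷ b ∷ c ∷ []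
  verts (two a b c) = a ∷ b ∷ c ∷ []
  firsts (tri s t t′) = t ∷ []
  firsts _ = []

  rims : Gadget → List (Edge n)
  rims (tri s t t′) = (t , t′) ∷ []
  rims _ = []

  -- A lower bound for the number of added spokes minus the number of left-over spokes of the gadget
  -- in the situation of `NoneNice`.
  weight : Gadget → ℕ
  weight (two _ _ _) = 0
  weight _ = 1

  Tri : Fin n → Fin n → Fin n → Set
  Tri a b c = E G a b × E G a c × E G b c

  Valid : Gadget → Set
  Valid (iso s) = adj G w s ≡ true × Ev G s × nbE G s ≡ []
  Valid (tri s t t′) = (adj G w s ≡ true × adj G w t′ ≡ false) × Tri s t t′
  Valid (all a b c) = (adj G w a ≡ true × adj G w b ≡ true × adj G w c ≡ true) × Tri a b c
  Valid (two a b c) = (adj G w a ≡ true × adj G w b ≡ true × adj G w c ≡ false) × Tri a b c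

  tri-even : ∀ {a b c v} → Tri a b c → v ∈ a ∷ b ∷ c ∷ [] → Ev G v
  tri-even (ab , ac , _) = even-triangle ab ac

  tri-closed : ∀ {a b c v u} → Tri a b c → v ∈ a ∷ b ∷ c ∷ [] → E G v u → u ∈ a ∷ b ∷ c ∷ []
  tri-closed (ab , ac , bc) = closed-triangle ab ac bc

  tri-linked : ∀ {a b c u v} → Tri a b c → u ∈ a ∷ b ∷ c ∷ [] → v ∈ a ∷ b ∷ c ∷ [] → u ≡ v ⊎ E G u v
  tri-linked (ab , ac , bc) (here refl) (here refl) = inj₁ refl
  tri-linked (ab , ac , bc) (here refl) (there (here refl)) = inj₂ ab
  tri-linked (ab , ac , bc) (here refl) (there (there (here refl))) = inj₂ ac
  tri-linked (ab , ac , bc) (there (here refl)) (here refl) = inj₂ (E-sym G ab)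
  tri-linked (ab , ac , bc) (there (here refl)) (there (here refl)) = inj₁ refl
  tri-linked (ab , ac , bc) (there (here refl)) (there (there (here refl))) = inj₂ bc
  tri-linked (ab , ac , bc) (there (there (here refl))) (here refl) = inj₂ (E-sym G ac)
  tri-linked (ab , ac , bc) (there (there (here refl))) (there (here refl)) = inj₂ (E-sym G bc)
  tri-linked (ab , ac , bc) (there (there (here refl))) (there (there (here refl))) = inj₁ refl

  even-verts : ∀ g → Valid g → ∀ {v} → v ∈ verts g → Ev G v
  even-verts (iso s) (_ , e , _) (here refl) = e
  even-verts (tri s t t′) (_ , T) = tri-even T
  even-verts (all a b c) (_ , T) = tri-even T
  even-verts (two a b c) (_ , T) = tri-even T

  closed-verts : ∀ g → Valid g → ∀ {v u} → v ∈ verts g → E G v u → u ∈ verts g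
  closed-verts (iso s) (_ , _ , eq) {u = u} (here refl) f = case subst (u ∈_) eq (∈-nbE G f) of λ ()
  closed-verts (tri s t t′) (_ , T) = tri-closed T
  closed-verts (all a b c) (_ , T) = tri-closed T
  closed-verts (two a b c) (_ , T) = tri-closed T

  linked-verts : ∀ g → Valid g → ∀ {u v} → u ∈ verts g → v ∈ verts g → u ≡ v ⊎ E G u v
  linked-verts (iso s) _ (here refl) (here refl) = inj₁ refl
  linked-verts (tri s t t′) (_ , T) = tri-linked T
  linked-verts (all a b c) (_ , T) = tri-linked T
  linked-verts (two a b c) (_ , T) = tri-linked T

  unique-verts : ∀ g → Valid g → Unique (verts g)
  unique-verts (iso s) _ = [] ∷ []
  unique-verts (tri s t t′) (_ , ab , ac , bc) = (E-≢ G ab ∷ E-≢ G ac ∷ []) ∷ (E-≢ G bc ∷ []) ∷ [] ∷ []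
  unique-verts (all a b c) (_ , ab , ac , bc) = (E-≢ G ab ∷ E-≢ G ac ∷ []) ∷ (E-≢ G bc ∷ []) ∷ [] ∷ []
  unique-verts (two a b c) (_ , ab , ac , bc) = (E-≢ G ab ∷ E-≢ G ac ∷ []) ∷ (E-≢ G bc ∷ []) ∷ [] ∷ []

  spokes-adj : ∀ g → Valid g → ∀ {x} → x ∈ spokes g → adj G w x ≡ true
  spokes-adj (iso s) (h , _) (here refl) = h
  spokes-adj (tri s t t′) ((h , _) , _) (here refl) = h
  spokes-adj (all a b c) ((h , _) , _) (here refl) = h
  spokes-adj (all a b c) ((_ , h , _) , _) (there (here refl)) = h
  spokes-adj (all a b c) ((_ , _ , h) , _) (there (there (here refl))) = h
  spokes-adj (two a b c) ((h , _) , _) (here refl) = h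
  spokes-adj (two a b c) ((_ , h , _) , _) (there (here refl)) = h

  rims-adj : ∀ g → Valid g → ∀ {t t′} → (t , t′) ∈ rims g → adj G t t′ ≡ true
  rims-adj (tri s t t′) (_ , _ , _ , bc) (here refl) = proj₁ bc

  handled : ∀ g → Valid g → ∀ {v} → v ∈ verts g → adj G w v ≡ true → v ∈ spokes g ⊎ v ∈ firsts g
  handled (iso s) _ q _ = inj₁ q
  handled (tri s t t′) _ (here e) _ = inj₁ (here e)
  handled (tri s t t′) _ (there (here e)) _ = inj₂ (here e)
  handled (tri s t t′) ((_ , na) , _) (there (there (here refl))) h = ⊥-elim (true≢false h na)
  handled (all a b c) _ q _ = inj₁ q
  handled (two a b c) _ (here e) _ = inj₁ (here e)
  handled (two a b c) _ (there (here e)) _ = inj₁ (there (here e))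
  handled (two a b c) ((_ , _ , na) , _) (there (there (here refl))) h = ⊥-elim (true≢false h na)

  occ-gadget : ∀ g v → occ v (spokes g) + occ v (eB (rims g)) ≤ occ v (verts g)
  occ-gadget (iso s) v = ≤-reflexive (+-identityʳ _)
  occ-gadget (tri s t t′) v = ≤-reflexive (+-assoc (b (v == s)) 0 _)
  occ-gadget (all p q r) v = ≤-reflexive (+-identityʳ _)
  occ-gadget (two p q r) v = ≤-trans (≤-reflexive (+-identityʳ _)) (+-monoʳ-≤ (b (v == p)) (+-monoʳ-≤ (b (v == q)) z≤n))

  record Config (gs : List Gadget) : Set where
    field
      valid : ∀ {g} → g ∈ gs → Valid g
      unique : Unique (concatMap verts gs)
      covers : ∀ {v} → adj G w v ≡ true → Ev G v → v ∈ concatMap verts gs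

  -- The ends at `w` must exceed the left-over spokes by two. If the number of spokes is even, `w`
  -- stays odd: parity gives one end and weight 1 the other. If it is odd, `w` becomes even and may
  -- have no end: both must come from the weights, and no rim may be added at a neighbour of `w`.
  -- These are the two cases of `cond`.
  module Solve (gs : List Gadget) (cfg : Config gs)
    (cond : (odd (length (concatMap spokes gs)) ≡ false × 1 ≤ Σ[ gs ] weight)
          ⊎ ((∀ {s t t′} → tri s t t′ ∈ gs → adj G w t ≡ false) × 2 ≤ Σ[ gs ] weight)) where
    open Config cfg

    X : List (Fin n)
    X = concatMap spokes gs
    M : List (Edge n)
    M = concatMap rims gs

    occ-XM : ∀ v → occ v (X ++ eB M) ≤ occ v (concatMap verts gs)
    occ-XM v = begin
      occ v (X ++ eB M) ≡⟨ Σ-++ X (eB M) _ ⟩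
      occ v X + occ v (eB M) ≡⟨ cong₂ _+_ (Σ-concatMap spokes gs _) (trans (Σ-concatMap _ M _) (trans (Σ-concatMap rims gs _) (Σ-cong gs (λ g → symm (Σ-concatMap _ (rims g) _))))) ⟩
      Σ[ gs ] (λ g → occ v (spokes g)) + Σ[ gs ] (λ g → occ v (eB (rims g))) ≡⟨ symm (Σ-+ gs _ _) ⟩
      Σ[ gs ] (λ g → occ v (spokes g) + occ v (eB (rims g))) ≤⟨ Σ-mono gs (λ g → occ-gadget g v) ⟩
      Σ[ gs ] (λ g → occ v (verts g)) ≡⟨ symm (Σ-concatMap verts gs _) ⟩
      occ v (concatMap verts gs) ∎
      where open ≤-Reasoning

    uXM : Unique (X ++ eB M)
    uXM = occ≤1⇒Unique _ (λ v → ≤-trans (occ-XM v) (occ-Unique-≤1 v unique))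

    even-XM : ∀ {v} → v ∈ X ++ eB M → Ev G v
    even-XM {v} v∈ with g , g∈ , q ← ∈-concat⁻ verts gs (∈-occ _ (≤-trans (occ-∈ v∈) (occ-XM v))) = even-verts g (valid g∈) q

    uq : Unique (w ∷ X ++ eB M)
    uq = All.tabulate (λ {x} x∈ e → true≢false ow (even-XM (subst (_∈ _) (symm e) x∈))) ∷ uXM

    adjX : ∀ {x} → x ∈ X → adj G w x ≡ true
    adjX x∈ with g , g∈ , q ← ∈-concat⁻ spokes gs x∈ = spokes-adj g (valid g∈) q

    adjM : ∀ {t t′} → (t , t′) ∈ M → adj G t t′ ≡ true
    adjM m with g , g∈ , q ← ∈-concat⁻ rims gs m = rims-adj g (valid g∈) q

    open Cut G w X M uq adjX adjM

    first-touched : ∀ {t} → t ∈ concatMap firsts gs → t ∈ eB M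
    first-touched t∈ with ∈-concat⁻ firsts gs t∈
    ... | tri s t t′ , g∈ , here refl = ∈-concat⁺ (∈-concat⁺ g∈ (here refl)) (here refl)

    nbr-w : ∀ {z} → adj G w z ≡ true → z ∉ X → Od G z ⊎ z ∈ concatMap firsts gs
    nbr-w {z} h z∉ with od-or-ev G z
    ... | inj₁ o = inj₁ o
    ... | inj₂ e with g , g∈ , q ← ∈-concat⁻ verts gs (covers h e) with handled g (valid g∈) q h
    ...   | inj₁ x = ⊥-elim (z∉ (∈-concat⁺ g∈ x))
    ...   | inj₂ f = inj₂ (∈-concat⁺ g∈ f)

    odd-touched : ∀ {v} → v ∈ X ++ eB M → Od (G ⊕* B) v
    odd-touched v∈ = trans (par-touched v∈) (cong not (even-XM v∈))

    odd-other : ∀ {v} → Od G v → v ≢ w → Od (G ⊕* B) v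
    odd-other o v≢w = trans (untouched-par G B (λ v∈ → case ∈-eB-star++ X M v∈ of λ where
      (inj₁ e) → v≢w e
      (inj₂ q) → true≢false o (even-XM q))) o

    kind : ∀ {t} → t ∈ eB B → Kind (G ⊕* B) t
    kind t∈ with ∈-eB-star++ X M t∈
    ... | inj₂ q = inj₁ (even-XM q , odd-touched q)
    ... | inj₁ refl = inj₂ λ c h → case nbr-w (del-sub G B del h) (λ x∈ → true≢false h (del-removed G B del (∈-++⁺ˡ (∈-map⁺ (w ,_) x∈)))) of λ where
      (inj₁ o) → odd-other o (≢-sym (adj-≢ (G ⊕* B) h))
      (inj₂ f) → odd-touched (∈-++⁺ʳ X (first-touched f))

    lt : edges (G ⊕* B) < edges G
    lt = go gs refl
      where
      go : ∀ l → gs ≡ l → edges (G ⊕* B) < edges G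
      go [] eq = case cond of λ where
        (inj₁ (_ , p)) → case subst (λ l → 1 ≤ Σ[ l ] weight) eq p of λ ()
        (inj₂ (_ , p)) → case subst (λ l → 2 ≤ Σ[ l ] weight) eq p of λ ()
      go (iso s ∷ l) refl = edges-⊕* G _ _ del
      go (tri _ _ _ ∷ l) refl = edges-⊕* G _ _ del
      go (all _ _ _ ∷ l) refl = edges-⊕* G _ _ del
      go (two _ _ _ ∷ l) refl = edges-⊕* G _ _ del

    H = G ⊕* star w X
    seconds : List (Fin n)
    seconds = map proj₂ M

    uM : Unique (eB M)
    uM = Unique-++ʳ X uXM

    seconds-M : ∀ {v} → v ∈ seconds → v ∈ eB M
    seconds-M v∈ with (t , t′) , m , refl ← ∈-map⁻ proj₂ v∈ = ∈-concat⁺ m (there (here refl))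

    odd∉seconds : ∀ {v} → Od G v → v ∉ seconds
    odd∉seconds o v∈ = true≢false o (even-XM (∈-++⁺ʳ X (seconds-M v∈)))

    X∉seconds : ∀ {v} → v ∈ X → v ∉ seconds
    X∉seconds v∈ q = Unique-++-∉ X uXM v∈ (seconds-M q)

    uwX : Unique (w ∷ X)
    uwX = Unique-++ˡ (w ∷ X) uq

    delX : Del G (star w X)
    delX = del-star G X uwX adjX

    delHM : Del H M
    delHM = del-matching H M uM λ {t} m → kept₁ G (star w X) (adjM m) λ t∈ →
      let q = ∈-concat⁺ m (here refl) in case ∈-star X t∈ of λ where
        (inj₁ refl) → w∉ (∈-++⁺ʳ X q)
        (inj₂ x∈) → Unique-++-∉ X uXM x∈ q

    module Spokes (s₁ : State H k) (dX₁ : ∀ {x} → x ∈ X → 1 ≤ D s₁ x) (dO₁ : ∀ {v} → Od G v → v ≢ w → 1 ≤ D s₁ v)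
      (dF₁ : ∀ {t} → t ∈ concatMap firsts gs → 1 ≤ D s₁ t) (dw₁ : odd (length X) ≡ false → 1 ≤ D s₁ w) (hv : Halved G k w (D s₁) X) where

      open Halved hv renaming (others to others₂)

      uAR : Unique (A ++ R)
      uAR = Unique-↭ (↭-sym split) (Unique-++ʳ (w ∷ []) uwX)

      R⊆X : ∀ {r} → r ∈ R → r ∈ X
      R⊆X r∈ = ∈-resp-↭ split (∈-++⁺ʳ A r∈)

      dR : ∀ {r} → r ∈ R → 1 ≤ D st r
      dR {r} r∈ = ≤-trans (dX₁ (R⊆X r∈)) (others₂ r (λ a → Unique-++-∉ A uAR a r∈))

      odd∉A : ∀ {v} → Od G v → v ∉ A
      odd∉A o v∈ = true≢false o (even-XM (∈-++⁺ˡ (∈-resp-↭ split (∈-++⁺ˡ v∈))))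

      dO₂ : ∀ {v} → Od G v → v ≢ w → 1 ≤ D st v
      dO₂ {v} o v≢w = ≤-trans (dO₁ o v≢w) (others₂ v (odd∉A o))

      dF₂ : ∀ {t} → t ∈ concatMap firsts gs → 1 ≤ D st t
      dF₂ {t} t∈ = ≤-trans (dF₁ t∈) (others₂ t (λ a → Unique-++-∉ X uXM (∈-resp-↭ split (∈-++⁺ˡ a)) (first-touched t∈)))

      adjR : ∀ {r} → r ∈ R → adj G w r ≡ true
      adjR r∈ = adjX (R⊆X r∈)

      w∉R : w ∉ R
      w∉R w∈ = w∉ (∈-++⁺ˡ (R⊆X w∈))

      uwR : Unique (w ∷ R)
      uwR = All.tabulate (λ {x} x∈ e → w∉R (subst (_∈ R) (symm e) x∈)) ∷ Unique-++ʳ A uAR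

      delR : Del G (star w R)
      delR = del-star G R uwR adjR

      -- `halve` gives `length R ≤ D st w`. Equality is impossible by parity, since `w` is odd in
      -- `G` and lacks exactly `length R` edges.
      center-odd : suc (length R) ≤ D st w
      center-odd = ≤∧≢⇒< (≤-trans half (≤-trans (m≤n+m _ (D s₁ w)) center)) λ eq →
        case trans (symm (trans (par-D st w) par-w)) (cong odd (symm eq)) of λ h → flips (odd (length R)) h
        where
        par-w : par (G ⊕* star w R) w ≡ true xor odd (length R)
        par-w = trans (par-⊕* G (star w R) delR w) (cong₂ _xor_ ow (cong odd (occ-star-center R w∉R)))
        flips : ∀ x → not x ≡ x → ⊥
        flips true ()
        flips false ()

      spoke-nbr : ∀ {r} → r ∈ R → ∀ z → adj G r z ≡ true → z ≢ w → z ∈ nbE G r ⊎ 1 ≤ D st z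
      spoke-nbr r∈ z h z≢w = case od-or-ev G z of λ where
        (inj₁ o) → inj₂ (dO₂ o z≢w)
        (inj₂ e) → inj₁ (∈-nbE G (h , even-XM (∈-++⁺ˡ (R⊆X r∈)) , e))

      -- Neighbours of `r` without an end, other than `w`, lie in `nbE G r`, which has length at
      -- most two. For a nice `r` at most one of them remains, so two ends at `w` suffice to add its
      -- edge.
      Nice : Fin n → Set
      Nice r = nbE G r ≡ [] ⊎ Any (λ m → 1 ≤ D st m) (nbE G r)

      nice? : ∀ r → Dec (Nice r)
      nice? r = empty? (nbE G r) ⊎-dec Any.any? (λ m → 1 ≤? D st m) (nbE G r)
        where
        empty? : (l : List (Fin n)) → Dec (l ≡ [])
        empty? [] = yes refl
        empty? (_ ∷ _) = no λ ()

      -- The last spoke is added when only two ends at w are left.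
      finish-nice : ∀ {r} → r ∈ R → Nice r → State G k
      finish-nice {r} r∈ nice with ∈⇒↭ r∈
      ... | R′ , p = proj₁ (restore G (proj₁ q) r w (λ u v → cong (adj G u v xor_) (isE-swap w r u v)) (adj-sym G wr) (proj₁ Z)
          (λ z h z≢w → case proj₂ (proj₂ Z) z h z≢w of λ where
            (inj₁ i) → inj₁ i
            (inj₂ i) → inj₂ (≤-trans i (proj₂ (proj₂ q) z z≢w)))
          (≤-trans (s≤s (proj₁ (proj₂ Z))) (proj₁ (proj₂ q))))
        where
        wr = adjR r∈
        Γ = G ⊕ (w , r)
        R′⊆R : ∀ {x} → x ∈ R′ → x ∈ R
        R′⊆R x∈ = ∈-resp-↭ (↭-sym p) (there x∈)
        uR′ : Unique (r ∷ R′)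
        uR′ = Unique-↭ p (Unique-++ʳ A uAR)
        same : G ⊕* star w R ≈ Γ ⊕* star w R′
        same = ≈-trans {G = G ⊕* star w R} {G ⊕* (star w R′ ++ (w , r) ∷ [])} {Γ ⊕* star w R′}
          (⊕*-↭ G (↭-trans (↭-map (w ,_) p) (↭-sym (↭-++-comm (star w R′) ((w , r) ∷ []))))) (⊕*-≈ (⊕*-++ G (star w R′) ((w , r) ∷ [])))
        delΓ : Del Γ (star w R′)
        delΓ = del-star Γ R′ (All.tabulate (λ {x} x∈ e → w∉R (R′⊆R (subst (_∈ R′) (symm e) x∈))) ∷ Unique-++ʳ (r ∷ []) uR′)
          (λ x∈ → kept₂ G ((w , r) ∷ []) (adjR (R′⊆R x∈)) (λ where
            (here refl) → w∉R (R′⊆R x∈)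
            (there (here refl)) → Uniqueₚ.Unique[x∷xs]⇒x∉xs uR′ x∈))
        q = restore-star Γ w R′ delΓ (cast {G = G ⊕* star w R} {Γ ⊕* star w R′} same st) (λ x∈ → w∉R (R′⊆R x∈))
          (λ {x} x∈ → nbE G x , deg≤2 x , λ z h z≢w → spoke-nbr (R′⊆R x∈) z (still-adj G wr x z h) z≢w)
          (≤-trans (≤-reflexive (trans (+-comm (length R′) 2) (cong suc (symm (↭-length p))))) center-odd)
        allowed : Nice r → ∃ λ Z → length Z ≤ 1 × (∀ z → adj G r z ≡ true → z ≢ w → z ∈ Z ⊎ 1 ≤ D st z)
        allowed (inj₁ eq) = [] , z≤n , λ z h z≢w → case spoke-nbr r∈ z h z≢w of λ where
          (inj₁ i) → inj₁ (subst (z ∈_) eq i)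
          (inj₂ i) → inj₂ i
        allowed (inj₂ any) with m , m∈ , dm ← find any with ∈⇒↭ m∈
        ... | Z , pz = Z , ≤-pred (≤-trans (≤-reflexive (symm (↭-length pz))) (deg≤2 r)) , λ z h z≢w → case spoke-nbr r∈ z h z≢w of λ where
          (inj₂ i) → inj₂ i
          (inj₁ i) → case ∈-resp-↭ pz i of λ where
            (here refl) → inj₂ dm
            (there j) → inj₁ j
        Z = allowed nice

      module NoneNice (none : ∀ {r} → r ∈ R → ¬ Nice r) where

        clash : ∀ {x y} → x ∈ R → E G x y → 1 ≤ D st y → ⊥
        clash x∈ e d = none x∈ (inj₂ (Any.map (λ { refl → d }) (∈-nbE G e)))

        -- A left-over spoke carries an end, so two of them in one triangle would make each other
        -- nice; the vertex `t` of a `tri` has the same effect, and an isolated vertex is always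
        -- nice. Hence a gadget leaves at most one spoke, and `iso` and `tri` leave none.
        count : ∀ g → g ∈ gs → length (filter (_∈? R) (spokes g)) + weight g ≤ length (filter (λ x → ¬? (x ∈? R)) (spokes g))
        count (iso s) g∈ with s ∈? R
        ... | yes s∈ = ⊥-elim (none s∈ (inj₁ (proj₂ (proj₂ (valid g∈)))))
        ... | no _ = ≤-refl
        count (tri s t t′) g∈ with s ∈? R
        ... | yes s∈ = ⊥-elim (clash s∈ (proj₁ (proj₂ (valid g∈))) (dF₂ (∈-concat⁺ g∈ (here refl))))
        ... | no _ = ≤-refl
        count (all a b c) g∈ with a ∈? R
        ... | yes p with b ∈? R
        ...   | yes q = ⊥-elim (clash p (proj₁ (proj₂ (valid g∈))) (dR q))
        ...   | no _ with c ∈? R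
        ...     | yes r = ⊥-elim (clash p (proj₁ (proj₂ (proj₂ (valid g∈)))) (dR r))
        ...     | no _ = ≤-refl
        count (all a b c) g∈ | no _ with b ∈? R
        ...   | yes q with c ∈? R
        ...     | yes r = ⊥-elim (clash q (proj₂ (proj₂ (proj₂ (valid g∈)))) (dR r))
        ...     | no _ = ≤-refl
        count (all a b c) g∈ | no _ | no _ with c ∈? R
        ...     | yes _ = ≤-refl
        ...     | no _ = s≤s z≤n
        count (two a b c) g∈ with a ∈? R
        ... | yes p with b ∈? R
        ...   | yes q = ⊥-elim (clash p (proj₁ (proj₂ (valid g∈))) (dR q))
        ...   | no _ = ≤-refl
        count (two a b c) g∈ | no _ with b ∈? R
        ...   | yes _ = ≤-refl
        ...   | no _ = z≤n

        total : ∀ l → (∀ {g} → g ∈ l → g ∈ gs) →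
          length (filter (_∈? R) (concatMap spokes l)) + Σ[ l ] weight ≤ length (filter (λ x → ¬? (x ∈? R)) (concatMap spokes l))
        total [] _ = z≤n
        total (g ∷ l) sub = begin
          length (filter P (spokes g ++ xs)) + (weight g + Σ[ l ] weight)
            ≡⟨ cong (_+ (weight g + Σ[ l ] weight)) (trans (cong length (filter-++ P (spokes g) xs)) (length-++ (filter P (spokes g)))) ⟩
          (length (filter P (spokes g)) + length (filter P xs)) + (weight g + Σ[ l ] weight) ≡⟨ interchange (length (filter P (spokes g))) _ (weight g) _ ⟩
          (length (filter P (spokes g)) + weight g) + (length (filter P xs) + Σ[ l ] weight) ≤⟨ +-mono-≤ (count g (sub (here refl))) (total l (sub ∘ there)) ⟩
          length (filter Q (spokes g)) + length (filter Q xs) ≡⟨ symm (trans (cong length (filter-++ Q (spokes g) xs)) (length-++ (filter Q (spokes g)))) ⟩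
          length (filter Q (spokes g ++ xs)) ∎
          where
          open ≤-Reasoning
          P = _∈? R
          Q = λ x → ¬? (x ∈? R)
          xs = concatMap spokes l

        surplus : length R + Σ[ gs ] weight ≤ length A
        surplus = ≤-trans (+-monoˡ-≤ _ (Unique-⊆-length (Unique-++ʳ A uAR) (λ r∈ → ∈-filter⁺ (_∈? R) (R⊆X r∈) r∈)))
          (≤-trans (total gs id) (Unique-⊆-length (Uniqueₚ.filter⁺ (λ x → ¬? (x ∈? R)) (Unique-++ʳ (w ∷ []) uwX)) inA))
          where
          inA : ∀ {x} → x ∈ filter (λ x → ¬? (x ∈? R)) X → x ∈ A
          inA x∈ with x∈X , x∉R ← ∈-filter⁻ (λ x → ¬? (x ∈? R)) {xs = X} x∈ with ∈-++⁻ A (∈-resp-↭ (↭-sym split) x∈X)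
          ... | inj₁ a = a
          ... | inj₂ r = ⊥-elim (x∉R r)

        rich : length R + 2 ≤ D st w
        rich = case cond of λ where
          (inj₁ (e , p)) → ≤-trans (≤-reflexive (+-suc (length R) 1)) (≤-trans (+-mono-≤ (dw₁ e) (≤-trans (+-monoʳ-≤ (length R) p) surplus)) center)
          (inj₂ (_ , p)) → ≤-trans (+-monoʳ-≤ (length R) p) (≤-trans surplus (≤-trans (m≤n+m _ (D s₁ w)) center))

        finish : State G k
        finish = proj₁ (restore-star G w R delR st w∉R (λ {r} r∈ → nbE G r , deg≤2 r , spoke-nbr r∈) rich)

      solution : State G k
      solution = case Any.any? nice? R of λ where
          (yes any) → let r , r∈ , nr = find any in finish-nice r∈ nr
          (no none) → NoneNice.finish (λ r∈ nr → none (Any.map (λ { refl → nr }) r∈))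

    module Rims (s₀ : State (G ⊕* B) k) where

      dX : ∀ {v} → v ∈ X ++ eB M → 1 ≤ D s₀ v
      dX v∈ = odd-D s₀ (odd-touched v∈)

      dO : ∀ {v} → Od G v → v ≢ w → 1 ≤ D s₀ v
      dO o v≢w = odd-D s₀ (odd-other o v≢w)

      dw-even : odd (length X) ≡ false → 1 ≤ D s₀ w
      dw-even e = odd-D s₀ (trans par-center (trans (cong₂ _xor_ ow e) refl))

      rim-ready : ∀ {t t′} → (t , t′) ∈ M → 1 ≤ D s₀ t′ × (∀ z → adj H t z ≡ true → z ≢ t′ → z ∉ seconds × 1 ≤ D s₀ z)
      rim-ready {t} {t′} m = dX (∈-++⁺ʳ X (∈-concat⁺ m (there (here refl)))) , nbr (∈-concat⁻ rims gs m)
        where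
        nbr : (∃ λ g → g ∈ gs × (t , t′) ∈ rims g) → ∀ z → adj H t z ≡ true → z ≢ t′ → z ∉ seconds × 1 ≤ D s₀ z
        nbr (tri s _ _ , g∈ , here refl) z h z≢t′ with od-or-ev G z
        ... | inj₁ o = odd∉seconds o , (case z ≟ w of λ where
              (no z≢w) → dO o z≢w
              (yes refl) → case cond of λ where
                (inj₁ (e , _)) → dw-even e
                (inj₂ (na , _)) → ⊥-elim (true≢false (adj-sym G (del-sub G (star w X) delX h)) (na g∈)))
        ... | inj₂ e with valid g∈
        ...   | _ , T@(st , _ , _) with closed-verts (tri s t t′) (valid g∈) (there (here refl)) (del-sub G (star w X) delX h , proj₂ (proj₂ st) , e)
        ...     | here refl = X∉seconds s∈ , dX (∈-++⁺ˡ s∈)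
          where s∈ = ∈-concat⁺ g∈ (here refl)
        ...     | there (here q) = contradiction (symm q) (adj-≢ H h)
        ...     | there (there (here q)) = contradiction q z≢t′

      s₀′ : State (H ⊕* M) k
      s₀′ = cast {G = G ⊕* B} {H ⊕* M} (≈-trans {G = G ⊕* B} {G ⊕* (M ++ star w X)} {H ⊕* M} (⊕*-↭ G (↭-++-comm (star w X) M)) (⊕*-≈ (⊕*-++ G M (star w X)))) s₀

      module _ (s₁ : State H k) (keep : ∀ z → z ∉ seconds → D s₀ z ≤ D s₁ z) where

        dX₁ : ∀ {x} → x ∈ X → 1 ≤ D s₁ x
        dX₁ {x} x∈ = ≤-trans (dX (∈-++⁺ˡ x∈)) (keep x (X∉seconds x∈))

        dO₁ : ∀ {v} → Od G v → v ≢ w → 1 ≤ D s₁ v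
        dO₁ {v} o v≢w = ≤-trans (dO o v≢w) (keep v (odd∉seconds o))

        dF₁ : ∀ {t} → t ∈ concatMap firsts gs → 1 ≤ D s₁ t
        dF₁ {t} t∈ with ∈-concat⁻ firsts gs t∈
        ... | tri s _ t′ , g∈ , here refl = ≤-trans (dX (∈-++⁺ʳ X (first-touched t∈))) (keep t (first∉seconds uM (∈-concat⁺ g∈ (here refl))))

        after-rims : State G k
        after-rims = Spokes.solution s₁ dX₁ dO₁ dF₁ (λ e → ≤-trans (dw-even e) (keep w (odd∉seconds ow)))
          (halve G w X s₁ uwX (λ x∈ → adjX x∈ , dX₁ x∈) (λ z h z∉ → case nbr-w h z∉ of λ where
            (inj₁ o) → dO₁ o (≢-sym (adj-≢ G h))
            (inj₂ f) → dF₁ f))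

      after : State G k
      after = let s₁ , keep = restore-matching H M delHM uM s₀′ rim-ready in after-rims s₁ keep

    solution : State G k
    solution = Rims.after (reduce-triangular (G ⊕* B) (eB B) (del-sub G B del) (untouched-adj G B) lt kind)

  -- Covering the even neighbours of a vertex by gadgets

  NotTwo : Gadget → Set
  NotTwo (two _ _ _) = ⊥
  NotTwo _ = ⊤

  gadget : ∀ v → adj G w v ≡ true → Ev G v → ∃ λ g → Valid g × NotTwo g × v ∈ verts g
  gadget v h e with tris v
  ... | inj₁ eq = iso v , (h , e , eq) , tt , here refl
  ... | inj₂ (y , u , eq , yu) = pick (adj G w y) refl (adj G w u) refl
    where
    vy : E G v y
    vy = nbE-∈ G (subst (y ∈_) (symm eq) (here refl))
    vu : E G v u
    vu = nbE-∈ G (subst (u ∈_) (symm eq) (there (here refl)))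
    pick : ∀ p → adj G w y ≡ p → ∀ q → adj G w u ≡ q → ∃ λ g → Valid g × NotTwo g × v ∈ verts g
    pick _ _ false q = tri v y u , ((h , q) , vy , vu , yu) , tt , here refl
    pick false p true _ = tri v u y , ((h , p) , vu , vy , E-sym G yu) , tt , here refl
    pick true p true q = all v y u , ((h , p , q) , vy , vu , yu) , tt , here refl

  record Partial (l : List (Fin n)) : Set where
    field
      gs : List Gadget
      valid : ∀ {g} → g ∈ gs → Valid g
      notTwo : ∀ {g} → g ∈ gs → NotTwo g
      unique : Unique (concatMap verts gs)
      covers : ∀ {v} → v ∈ l → adj G w v ≡ true → Ev G v → v ∈ concatMap verts gs

  gadgets : ∀ l → Partial l
  gadgets [] = record { gs = [] ; valid = λ () ; notTwo = λ () ; unique = [] ; covers = λ () }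
  gadgets (v ∷ l) with gadgets l
  ... | pa with v ∈? concatMap verts (Partial.gs pa) | adj? G w v | par G v ≟ᵇ false
  ...   | yes q | _ | _ = record { Partial pa ; covers = λ { (here refl) _ _ → q ; (there u∈) → Partial.covers pa u∈ } }
  ...   | no _ | no na | _ = record { Partial pa ; covers = λ { (here refl) h _ → contradiction h na ; (there u∈) → Partial.covers pa u∈ } }
  ...   | no _ | yes _ | no od = record { Partial pa ; covers = λ { (here refl) _ e → contradiction e od ; (there u∈) → Partial.covers pa u∈ } }
  ...   | no v∉ | yes h | yes e with gadget v h e
  ...     | g , vg , nt , v∈ = record
    { gs = g ∷ gs
    ; valid = λ { (here refl) → vg ; (there q) → valid q }
    ; notTwo = λ { (here refl) → nt ; (there q) → notTwo q }
    ; unique = Uniqueₚ.++⁺ (unique-verts g vg) unique disjoint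
    ; covers = λ { (here refl) _ _ → ∈-++⁺ˡ v∈ ; (there u∈) h e → ∈-++⁺ʳ (verts g) (covers u∈ h e) } }
    where
    open Partial pa
    disjoint : ∀ {u} → u ∈ verts g × u ∈ concatMap verts gs → ⊥
    disjoint (u∈ , q) with g′ , g′∈ , u∈′ ← ∈-concat⁻ verts gs q with linked-verts g vg u∈ v∈
    ... | inj₁ refl = v∉ q
    ... | inj₂ uv = v∉ (∈-concat⁺ g′∈ (closed-verts g′ (valid g′∈) u∈′ uv))

  reduce-hub : ∀ {s s′} → adj G w s ≡ true → Ev G s → adj G w s′ ≡ true → Ev G s′ → s ≢ s′ → ¬ E G s s′ → State G k
  reduce-hub {s} {s′} hs es hs′ es′ s≢s′ ¬ss′ = parity (odd (length (concatMap spokes gs))) refl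
    where
    open Partial (gadgets (allFin n))
    cov : ∀ {v} → adj G w v ≡ true → Ev G v → v ∈ concatMap verts gs
    cov h e = covers (∈-allFin _) h e
    cfg : Config gs
    cfg = record { valid = valid ; unique = unique ; covers = cov }
    -- Vertices of one gadget are equal or adjacent, so `s` and `s′` lie in different gadgets, and
    -- each gadget has weight 1 as long as no `two` is used.
    heavy : 2 ≤ Σ[ gs ] weight
    heavy = go gs valid notTwo (cov hs es) (cov hs′ es′)
      where
      one : ∀ g → NotTwo g → 1 ≤ weight g
      one (iso _) _ = ≤-refl
      one (tri _ _ _) _ = ≤-refl
      one (all _ _ _) _ = ≤-refl
      go : ∀ l → (∀ {g} → g ∈ l → Valid g) → (∀ {g} → g ∈ l → NotTwo g) → s ∈ concatMap verts l → s′ ∈ concatMap verts l → 2 ≤ Σ[ l ] weight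
      go (g ∷ []) va _ p q = case linked-verts g (va (here refl)) (subst (s ∈_) (++-identityʳ _) p) (subst (s′ ∈_) (++-identityʳ _) q) of λ where
        (inj₁ e) → contradiction e s≢s′
        (inj₂ e) → contradiction e ¬ss′
      go (g ∷ g′ ∷ l) _ nt _ _ = +-mono-≤ (one g (nt (here refl))) (≤-trans (one g′ (nt (there (here refl)))) (m≤m+n _ _))
    Near : Gadget → Set
    Near (tri _ t _) = adj G w t ≡ true
    Near _ = ⊥
    near? : ∀ g → Dec (Near g)
    near? (iso _) = no λ ()
    near? (tri _ t _) = adj? G w t
    near? (all _ _ _) = no λ ()
    near? (two _ _ _) = no λ ()
    parity : ∀ o → odd (length (concatMap spokes gs)) ≡ o → State G k
    parity false e = Solve.solution gs cfg (inj₁ (e , ≤-trans (s≤s z≤n) heavy))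
    parity true e = case Any.any? near? gs of λ where
        (no none) → Solve.solution gs cfg (inj₂ ((λ {s} {t} {t′} g∈ → ≢true λ h → none (Any.map (λ { refl → h }) g∈)) , heavy))
        (yes any) → change (find any)
      where
      -- Cutting both edges from w to one triangle instead of one edge makes the number of spokes even.
      change : (∃ λ g → g ∈ gs × Near g) → State G k
      change (tri s t t′ , g∈ , wt) with l₁ , l₂ , eq ← ∈-∃++ g∈ = Solve.solution gs′ cfg′ (inj₁ (even , light))
        where
        gs′ = l₁ ++ two s t t′ ∷ l₂
        same : concatMap verts gs ≡ concatMap verts gs′
        same = trans (cong (concatMap verts) eq) (trans (concatMap-++ verts l₁ (tri s t t′ ∷ l₂)) (symm (concatMap-++ verts l₁ (two s t t′ ∷ l₂))))
        vt : Valid (tri s t t′)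
        vt = valid g∈
        valid′ : ∀ {g} → g ∈ gs′ → Valid g
        valid′ q with ∈-++⁻ l₁ q
        ... | inj₁ p = valid (subst (_ ∈_) (symm eq) (∈-++⁺ˡ p))
        ... | inj₂ (here refl) = let (ws , na) , T = vt in (ws , wt , na) , T
        ... | inj₂ (there p) = valid (subst (_ ∈_) (symm eq) (∈-++⁺ʳ l₁ (there p)))
        cfg′ : Config gs′
        cfg′ = record { valid = valid′ ; unique = subst Unique same unique ; covers = λ h e → subst (_ ∈_) same (cov h e) }
        spokes-length : ∀ g → length (concatMap spokes (l₁ ++ g ∷ l₂)) ≡ length (spokes g) + (length (concatMap spokes l₁) + length (concatMap spokes l₂))
        spokes-length g = trans (cong length (concatMap-++ spokes l₁ (g ∷ l₂))) (trans (length-++ (concatMap spokes l₁))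
          (trans (cong (length (concatMap spokes l₁) +_) (length-++ (spokes g)))
            (trans (symm (+-assoc (length (concatMap spokes l₁)) (length (spokes g)) _))
              (trans (cong (_+ length (concatMap spokes l₂)) (+-comm (length (concatMap spokes l₁)) (length (spokes g)))) (+-assoc (length (spokes g)) _ _)))))
        even : odd (length (concatMap spokes gs′)) ≡ false
        even = trans (cong odd (spokes-length (two s t t′))) (cong not (trans (symm (cong odd (trans (cong (length ∘ concatMap spokes) eq) (spokes-length (tri s t t′))))) e))
        light : 1 ≤ Σ[ gs′ ] weight
        light = ≤-pred (≤-trans heavy (≤-reflexive (trans (cong (λ l → Σ[ l ] weight) eq) (trans (Σ-++ l₁ (tri s t t′ ∷ l₂) weight)
          (trans (+-suc _ _) (cong suc (symm (Σ-++ l₁ (two s t t′ ∷ l₂) weight))))))))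

-- Edges leaving the neighbourhood of a triangle

module Conclusion {n} (E₀ : Fin n → Fin n → Set) (G : Graph n)
  (ih : ∀ G′ → edges G′ < edges G → Fam E₀ G′ → NoBad G′ → State G′ (n / 2)) (fam : Fam E₀ G) (nb : NoBad G) (tris : Triangles G) where

  open Triangular E₀ (n / 2) G ih fam nb tris

  Two-of : ∀ {a b c z x y} → x ∈ a ∷ b ∷ c ∷ [] → y ∈ a ∷ b ∷ c ∷ [] → x ≢ y → adj G z x ≡ true → adj G z y ≡ true → Two G a b c z
  Two-of (here refl) (here refl) n _ _ = contradiction refl n
  Two-of (here refl) (there (here refl)) _ e f = inj₁ (e , f)
  Two-of (here refl) (there (there (here refl))) _ e f = inj₂ (inj₂ (e , f))
  Two-of (there (here refl)) (here refl) _ e f = inj₁ (f , e)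
  Two-of (there (here refl)) (there (here refl)) n _ _ = contradiction refl n
  Two-of (there (here refl)) (there (there (here refl))) _ e f = inj₂ (inj₁ (e , f))
  Two-of (there (there (here refl))) (here refl) _ e f = inj₂ (inj₂ (f , e))
  Two-of (there (there (here refl))) (there (here refl)) _ e f = inj₂ (inj₁ (f , e))
  Two-of (there (there (here refl))) (there (there (here refl))) n _ _ = contradiction refl n

  -- What remains after `single-even` and `reduce-hub`: the even neighbours of an odd vertex, if
  -- there are any, are two or three vertices of one triangle of the even subgraph.
  module Settled
    (H₁ : ∀ {a x} → Od G a → adj G a x ≡ true → Ev G x → ∃ λ u → adj G a u ≡ true × Ev G u × u ≢ x)
    (H₂ : ∀ {w s s′} → Od G w → adj G w s ≡ true → Ev G s → adj G w s′ ≡ true → Ev G s′ → s ≢ s′ → E G s s′) where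

    boost : ∀ {a b c w z} → E G a b → E G a c → E G b c → Od G w → adj G w a ≡ true → adj G w b ≡ true →
      (∀ u → adj G w u ≡ true → Ev G u → u ∈ a ∷ b ∷ c ∷ []) → Od G z → adj G w z ≡ true →
      (∀ u → u ∈ a ∷ b ∷ c ∷ [] → adj G z u ≡ false) → State G (n / 2)
    boost {z = z} ab ac bc ow wa wb w-even oz wz z-none = case any? (λ u → adj? G z u ×-dec (par G u ≟ᵇ false)) of λ where
        (no none) → B.no-even-nbrs (λ u h → ≢false λ e → none (u , h , e))
        (yes (a′ , h , e)) → second h e (H₁ oz h e)
      where
      module B = BoostEdge ab ac bc ow wa wb w-even oz wz z-none
      second : ∀ {a′} → adj G z a′ ≡ true → Ev G a′ → (∃ λ b′ → adj G z b′ ≡ true × Ev G b′ × b′ ≢ a′) → State G (n / 2)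
      second {a′} h e (b′ , h′ , e′ , b′≢a′) = B.second-triangle ab′ ac′ bc′ h h′ λ u hu eu → case u ≟ a′ of λ where
          (yes refl) → here refl
          (no u≢a′) → closed-triangle ab′ ac′ bc′ (here refl) (H₂ oz h e hu eu (≢-sym u≢a′))
        where
        ab′ = H₂ oz h e h′ e′ (≢-sym b′≢a′)
        ac′ = proj₁ (proj₂ (third ab′))
        bc′ = proj₂ (proj₂ (third ab′))

    at-triangle : ∀ {a b c} → E G a b → E G a c → E G b c → State G (n / 2)
    at-triangle {a} {b} {c} ab ac bc = case any? (λ w → any? (λ z → (K? G a b c w ×-dec adj? G w z) ×-dec ¬? (K? G a b c z))) of λ where
        (no none) → ⊥-elim (nb a b c ((ab , bc , ac) , λ v u kv h → decidable-stable (K? G a b c u) λ nk → none (v , u , (kv , h) , nk)))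
        (yes (w , z , (kw , wz) , nk)) → leave kw wz nk
      where
      T = a ∷ b ∷ c ∷ []
      evT : ∀ {u} → u ∈ T → Ev G u
      evT = even-triangle ab ac
      inK : ∀ {z u} → Od G z → u ∈ T → adj G z u ≡ true → K G a b c z
      inK oz u∈ h = let u′ , h′ , e′ , u′≢u = H₁ oz h (evT u∈) in
        inj₂ (oz , Two-of u∈ (closed-triangle ab ac bc u∈ (H₂ oz h (evT u∈) h′ e′ (≢-sym u′≢u))) (≢-sym u′≢u) h h′)
      leave : ∀ {w z} → K G a b c w → adj G w z ≡ true → ¬ K G a b c z → State G (n / 2)
      -- An edge leaving `K` cannot start on the triangle: its other endpoint has two neighbours
      -- there if it is odd, and lies on the triangle if it is even.
      leave {w} {z} (inj₁ w∈) wz nk = ⊥-elim (case od-or-ev G z of λ where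
        (inj₁ o) → nk (inK o w∈ (adj-sym G wz))
        (inj₂ e) → nk (inj₁ (closed-triangle ab ac bc w∈ (wz , evT w∈ , e))))
      leave {w} {z} (inj₂ (ow , two)) wz nk = sides two
        where
        w-even : ∀ {p} → p ∈ T → adj G w p ≡ true → ∀ u → adj G w u ≡ true → Ev G u → u ∈ T
        w-even {p} p∈ wp u h e = case u ≟ p of λ where
          (yes refl) → p∈
          (no u≢p) → closed-triangle ab ac bc p∈ (H₂ ow wp (evT p∈) h e (≢-sym u≢p))
        oz : ∀ {p} → p ∈ T → adj G w p ≡ true → Od G z
        oz p∈ wp = ≢false λ e → nk (inj₁ (w-even p∈ wp z wz e))
        z-none : ∀ {p} → p ∈ T → adj G w p ≡ true → ∀ u → u ∈ T → adj G z u ≡ false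
        z-none p∈ wp u u∈ = ≢true λ h → nk (inK (oz p∈ wp) u∈ h)
        sides : Two G a b c w → State G (n / 2)
        sides (inj₁ (wa , wb)) = boost ab ac bc ow wa wb (w-even i wa) (oz i wa) wz (z-none i wa)
          where i = here refl
        sides (inj₂ (inj₁ (wb , wc))) = boost bc (E-sym G ab) (E-sym G ac) ow wb wc (λ u h e → ∈-resp-↭ σ (w-even i wb u h e)) (oz i wb) wz (λ u u∈ → z-none i wb u (∈-resp-↭ (↭-sym σ) u∈))
          where
          i = there (here refl)
          σ : T ↭ b ∷ c ∷ a ∷ []
          σ = ↭-trans swap′ (prep b swap′)
        sides (inj₂ (inj₂ (wa , wc))) = boost ac ab (E-sym G bc) ow wa wc (λ u h e → ∈-resp-↭ σ (w-even i wa u h e)) (oz i wa) wz (λ u u∈ → z-none i wa u (∈-resp-↭ (↭-sym σ) u∈))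
          where
          i = here refl
          σ : T ↭ a ∷ c ∷ b ∷ []
          σ = prep a swap′

    -- If no two even vertices are adjacent, then an odd neighbour of an even vertex would have a
    -- second even neighbour by `H₁`, adjacent to the first by `H₂`. So all even vertices are
    -- isolated, as Lovász's theorem requires.
    settled : State G (n / 2)
    settled = case any? (λ a → any? (λ b → E? G a b)) of λ where
      (yes (a , b , ab)) → let c , ac , bc = third ab in at-triangle ab ac bc
      (no none) → lovász G λ v → case od-or-ev G v of λ where
        (inj₁ o) → inj₁ o
        (inj₂ e) → inj₂ λ u → ≢true λ h → case od-or-ev G u of λ where
          (inj₂ e′) → none (v , u , h , e , e′)
          (inj₁ o) → let v′ , h′ , e′ , v′≢v = H₁ o (adj-sym G h) e in none (v , v′ , H₂ o (adj-sym G h) e h′ e′ (≢-sym v′≢v))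

  conclude : State G (n / 2)
  conclude = case any? (λ a → any? (λ x → lonely? a x)) of λ where
      (yes (a , x , (oa , h , e) , only)) → single-even oa h e (λ u h′ u≢x → ≢false λ e′ → u≢x (only u h′ e′))
      (no none) → case any? (λ w → any? (λ s → any? (λ s′ → spread? w s s′))) of λ where
        (yes (w , s , s′ , ow , (h , e) , (h′ , e′) , s≢s′ , ¬ss′)) → Hub.reduce-hub E₀ (n / 2) G ih fam nb tris w ow h e h′ e′ s≢s′ ¬ss′
        (no none′) → Settled.settled
          (λ {a} {x} oa h e → case any? (λ u → adj? G a u ×-dec ((par G u ≟ᵇ false) ×-dec ¬? (u ≟ x))) of λ where
            (yes q) → q
            (no q) → ⊥-elim (none (a , x , (oa , h , e) , λ u h′ e′ → decidable-stable (u ≟ x) λ u≢x → q (u , h′ , e′ , u≢x))))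
          (λ {w} {s} {s′} ow h e h′ e′ s≢s′ → decidable-stable (E? G s s′) λ ¬ss′ → none′ (w , s , s′ , ow , (h , e) , (h′ , e′) , s≢s′ , ¬ss′))
    where
    lonely? : ∀ a x → Dec ((Od G a × adj G a x ≡ true × Ev G x) × (∀ u → adj G a u ≡ true → Ev G u → u ≡ x))
    lonely? a x = ((par G a ≟ᵇ true) ×-dec (adj? G a x ×-dec (par G x ≟ᵇ false))) ×-dec all? (λ u → adj? G a u →-dec ((par G u ≟ᵇ false) →-dec (u ≟ x)))
    spread? : ∀ w s s′ → Dec (Od G w × (adj G w s ≡ true × Ev G s) × (adj G w s′ ≡ true × Ev G s′) × s ≢ s′ × ¬ E G s s′)
    spread? w s s′ = (par G w ≟ᵇ true) ×-dec ((adj? G w s ×-dec (par G s ≟ᵇ false)) ×-dec ((adj? G w s′ ×-dec (par G s′ ≟ᵇ false)) ×-dec (¬? (s ≟ s′) ×-dec ¬? (E? G s s′))))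

-- Connectivity in subsets, and 2-connected sets

toSub : ∀ {m} {P : Fin m → Set} → (∀ v → Dec (P v)) → Subset m
toSub P? = tabulate (λ v → does (P? v))

∈-toSub : ∀ {m} {P : Fin m → Set} (P? : ∀ v → Dec (P v)) {v} → P v → v ∈ˢ toSub P?
∈-toSub P? {v} p = Vecₚ.lookup⇒[]= v _ (trans (Vecₚ.lookup∘tabulate _ v) (dec-true (P? v) p))

toSub-∈ : ∀ {m} {P : Fin m → Set} (P? : ∀ v → Dec (P v)) {v} → v ∈ˢ toSub P? → P v
toSub-∈ P? {v} h with P? v | trans (symm (Vecₚ.lookup∘tabulate (λ v → does (P? v)) v)) (Vecₚ.[]=⇒lookup h)
... | yes p | _ = p

x∉p-x : ∀ {m} (p : Subset m) x → x ∉ˢ p -ˢ x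
x∉p-x (_ Vec.∷ p) zero ()
x∉p-x (_ Vec.∷ p) (suc x) (Vec.there h) = x∉p-x p x h

∈-minus : ∀ {m} {p : Subset m} {x y} → y ∈ˢ p -ˢ x → y ∈ˢ p × y ≢ x
∈-minus {p = p} {x} h = Sub.p─q⊆p p ⁅ x ⁆ˢ h , λ { refl → x∉p-x p x h }

length≤∣∣ : ∀ {m} (l : List (Fin m)) (p : Subset m) → Unique l → (∀ {x} → x ∈ l → x ∈ˢ p) → length l ≤ ∣ p ∣
length≤∣∣ [] p _ _ = z≤n
length≤∣∣ (x ∷ l) p (x∉ ∷ u) h = ≤-trans (s≤s (length≤∣∣ l (p -ˢ x) u (λ y∈ → Sub.x∈p∧x≢y⇒x∈p-y (h (there y∈)) (λ { refl → All.lookup x∉ y∈ refl }))))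
  (Sub.x∈p⇒∣p-x∣<∣p∣ (h (here refl)))

⊆∧∣∣≤⇒≡ : ∀ {m} {p q : Subset m} → p ⊆ˢ q → ∣ q ∣ ≤ ∣ p ∣ → q ≡ p
⊆∧∣∣≤⇒≡ {p = p} sub le = Sub.⊆-antisym (λ {x} x∈ → decidable-stable (x Sub.∈? p) λ x∉ → 1+n≰n (≤-trans (Sub.p⊂q⇒∣p∣<∣q∣ (sub , x , x∈ , x∉)) le)) sub

module Walks {m} (H : Graph m) where

  walk-start : ∀ {S u v} → Walk H S u v → u ∈ˢ S
  walk-start (nil u∈) = u∈
  walk-start (cons u∈ _ _) = u∈

  walk-end : ∀ {S u v} → Walk H S u v → v ∈ˢ S
  walk-end (nil u∈) = u∈
  walk-end (cons _ _ p) = walk-end p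

  walk-trans : ∀ {S u v w} → Walk H S u v → Walk H S v w → Walk H S u w
  walk-trans (nil _) q = q
  walk-trans (cons u∈ e p) q = cons u∈ e (walk-trans p q)

  walk-edge : ∀ {S u v} → u ∈ˢ S → v ∈ˢ S → Adj H u v → Walk H S u v
  walk-edge u∈ v∈ e = cons u∈ e (nil v∈)

  walk-sym : ∀ {S u v} → Walk H S u v → Walk H S v u
  walk-sym (nil u∈) = nil u∈
  walk-sym (cons u∈ e p) = walk-trans (walk-sym p) (walk-edge (walk-start p) u∈ (adj-sym H e))

  walk-mono : ∀ {S T u v} → S ⊆ˢ T → Walk H S u v → Walk H T u v
  walk-mono s (nil u∈) = nil (s u∈)
  walk-mono s (cons u∈ e p) = cons (s u∈) e (walk-mono s p)

  star-connected : ∀ {S} c → (∀ {z} → z ∈ˢ S → Walk H S z c) → ConnectedSet H S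
  star-connected c h u v u∈ v∈ = walk-trans (h u∈) (walk-sym (h v∈))

  -- Cutting a walk at its last visit to `u` reduces walks in `S` to walks in `S -ˢ u`; this makes
  -- `walk?` a recursion on the size of `S`.
  last-visit : ∀ {S u w v} → Walk H S w v → Walk H (S -ˢ u) w v ⊎ (u ≡ v ⊎ ∃ λ x → Adj H u x × Walk H (S -ˢ u) x v)
  last-visit {u = u} (nil {w} w∈) = case w ≟ u of λ where
    (yes refl) → inj₂ (inj₁ refl)
    (no w≢u) → inj₁ (nil (Sub.x∈p∧x≢y⇒x∈p-y w∈ w≢u))
  last-visit {u = u} (cons {w} w∈ e p) = case last-visit {u = u} p of λ where
    (inj₂ q) → inj₂ q
    (inj₁ q) → case w ≟ u of λ where
      (yes refl) → inj₂ (inj₂ (_ , e , q))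
      (no w≢u) → inj₁ (cons (Sub.x∈p∧x≢y⇒x∈p-y w∈ w≢u) e q)

  walk? : ∀ S u v → Dec (Walk H S u v)
  walk? S = go ∣ S ∣ S ≤-refl
    where
    go : ∀ k S → ∣ S ∣ ≤ k → ∀ u v → Dec (Walk H S u v)
    go k S le u v with u Sub.∈? S
    ... | no u∉ = no (u∉ ∘ walk-start)
    go zero S le u v | yes u∈ = ⊥-elim (n≮0 (≤-trans (Sub.x∈p⇒∣p-x∣<∣p∣ u∈) le))
    go (suc k) S le u v | yes u∈ with u ≟ v
    ... | yes refl = yes (nil u∈)
    ... | no u≢v = map′ (λ (x , e , p) → cons u∈ e (walk-mono (Sub.p─q⊆p S ⁅ u ⁆ˢ) p)) first
        (any? λ x → adj? H u x ×-dec go k (S -ˢ u) (≤-pred (≤-trans (Sub.x∈p⇒∣p-x∣<∣p∣ u∈) le)) x v)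
      where
      first : Walk H S u v → ∃ λ x → Adj H u x × Walk H (S -ˢ u) x v
      first p with last-visit {u = u} p
      ... | inj₁ q = ⊥-elim (x∉p-x S u (walk-start q))
      ... | inj₂ (inj₁ e) = contradiction e u≢v
      ... | inj₂ (inj₂ q) = q

  abstract

    comp : Subset m → Fin m → Subset m
    comp S u = toSub (walk? S u)

    ∈-comp : ∀ {S u v} → Walk H S u v → v ∈ˢ comp S u
    ∈-comp {S} {u} = ∈-toSub (walk? S u)

    comp-∈ : ∀ {S u v} → v ∈ˢ comp S u → Walk H S u v
    comp-∈ {S} {u} = toSub-∈ (walk? S u)

  walk-in-comp : ∀ {S u w v} → Walk H S u w → Walk H S w v → Walk H (comp S u) w v
  walk-in-comp p (nil _) = nil (∈-comp p)
  walk-in-comp p (cons w∈ e q) = cons (∈-comp p) e (walk-in-comp (walk-trans p (walk-edge w∈ (walk-start q) e)) q)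

  comp-connected : ∀ {S u} → u ∈ˢ S → ConnectedSet H (comp S u)
  comp-connected {S} {u} u∈ = star-connected u λ z∈ → walk-sym (walk-in-comp (nil u∈) (comp-∈ z∈))

  ⊤-minus : ∀ {x y : Fin m} → y ≢ x → y ∈ˢ ⊤ˢ -ˢ x
  ⊤-minus y≢x = Sub.x∈p∧x≢y⇒x∈p-y Sub.∈⊤ y≢x

  minimal : ∀ k (l : List (Fin m)) R → ∣ R ∣ ≤ k → ConnectedSet H R → (∀ {u} → u ∈ l → u ∈ˢ R) →
    ∃ λ R′ → R′ ⊆ˢ R × ConnectedSet H R′ × (∀ {u} → u ∈ l → u ∈ˢ R′) ×
      (∀ x z → x ∈ˢ R′ → z ∈ˢ R′ → z ≢ x → Any (Walk H (R′ -ˢ x) z) l)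
  minimal k l R le conn l⊆ with any? (λ x → any? (λ z → ((x Sub.∈? R) ×-dec ((z Sub.∈? R) ×-dec ¬? (z ≟ x))) ×-dec ¬? (Any.any? (walk? (R -ˢ x) z) l)))
  ... | no none = R , id , conn , l⊆ , λ x z x∈ z∈ z≢x → decidable-stable (Any.any? (walk? (R -ˢ x) z) l) λ ¬any → none (x , z , (x∈ , z∈ , z≢x) , ¬any)
  minimal zero l R le conn l⊆ | yes (x , z , (x∈ , _) , _) = ⊥-elim (n≮0 (≤-trans (Sub.x∈p⇒∣p-x∣<∣p∣ x∈) le))
  minimal (suc k) l R le conn l⊆ | yes (x , z , (x∈ , z∈ , z≢x) , ¬any) =
    let R′ , sub , rest = minimal k l R₂ (≤-pred (≤-trans (Sub.p⊂q⇒∣p∣<∣q∣ (R₂⊆R , z , z∈ , λ h → proj₂ (toSub-∈ R₂? h) z∈C)) le)) (star-connected x to-x) l⊆R₂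
    in R′ , (λ h → R₂⊆R (sub h)) , rest
    where
    C = comp (R -ˢ x) z
    z∈C : z ∈ˢ C
    z∈C = ∈-comp (nil (Sub.x∈p∧x≢y⇒x∈p-y z∈ z≢x))
    R₂? : ∀ y → Dec (y ∈ˢ R × ¬ y ∈ˢ C)
    R₂? y = (y Sub.∈? R) ×-dec ¬? (y Sub.∈? C)
    R₂ = toSub R₂?
    R₂⊆R : R₂ ⊆ˢ R
    R₂⊆R h = proj₁ (toSub-∈ R₂? h)
    x∈R₂ : x ∈ˢ R₂
    x∈R₂ = ∈-toSub R₂? (x∈ , λ h → x∉p-x R x (walk-end (comp-∈ {S = R -ˢ x} h)))
    l⊆R₂ : ∀ {u} → u ∈ l → u ∈ˢ R₂
    l⊆R₂ u∈ = ∈-toSub R₂? (l⊆ u∈ , λ h → ¬any (Any.map (λ { refl → comp-∈ h }) u∈))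
    toward : ∀ {p} → p ∈ˢ R₂ → Walk H R p x → Walk H R₂ p x
    toward p∈ (nil _) = nil p∈
    toward {p} p∈ (cons {w = w} _ e q) = case p ≟ x of λ where
        (yes refl) → nil p∈
        (no p≢x) → case w ≟ x of λ where
          (yes refl) → walk-edge p∈ x∈R₂ e
          (no w≢x) → cons p∈ e (toward (∈-toSub R₂? (walk-start q , λ w∈C → proj₂ (toSub-∈ R₂? p∈)
            (∈-comp (walk-trans (comp-∈ w∈C) (walk-edge (Sub.x∈p∧x≢y⇒x∈p-y (walk-start q) w≢x) (Sub.x∈p∧x≢y⇒x∈p-y (R₂⊆R p∈) p≢x) (adj-sym H e)))))) q)
    to-x : ∀ {p} → p ∈ˢ R₂ → Walk H R₂ p x
    to-x {p} p∈ = toward p∈ (conn p x (R₂⊆R p∈) x∈)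

  -- In a minimal connected set outside v every part cut off by a vertex contains a neighbour of v.
  around : ∀ v u₁ u₂ us → Unique (u₁ ∷ u₂ ∷ us) → (∀ {u} → u ∈ u₁ ∷ u₂ ∷ us → Adj H v u) →
    (∀ {u} → u ∈ u₁ ∷ u₂ ∷ us → Walk H (⊤ˢ -ˢ v) u₁ u) →
    ∃ λ S → TwoConnected H S × v ∈ˢ S × (∀ {u} → u ∈ u₁ ∷ u₂ ∷ us → u ∈ˢ S)
  around v u₁ u₂ us uq adjv walks with minimal ∣ R₀ ∣ (u₁ ∷ u₂ ∷ us) R₀ ≤-refl (comp-connected (⊤-minus (≢-sym (adj-≢ H (adjv (here refl)))))) (λ u∈ → ∈-comp (walks u∈))
    where R₀ = comp (⊤ˢ -ˢ v) u₁
  ... | R , sub , conn , l⊆ , sep = S , (big , conn-S , conn-S-x) , v∈S , λ u∈ → R⊆S (l⊆ u∈)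
    where
    v∉R : v ∉ˢ R
    v∉R h = x∉p-x ⊤ˢ v (walk-end (comp-∈ (sub h)))
    S? : ∀ y → Dec (y ∈ˢ R ⊎ y ≡ v)
    S? y = (y Sub.∈? R) ⊎-dec (y ≟ v)
    S = toSub S?
    R⊆S : R ⊆ˢ S
    R⊆S h = ∈-toSub S? (inj₁ h)
    v∈S : v ∈ˢ S
    v∈S = ∈-toSub S? (inj₂ refl)
    big : 3 ≤ ∣ S ∣
    big = length≤∣∣ (v ∷ u₁ ∷ u₂ ∷ []) S (All.tabulate (λ u∈ → adj-≢ H (adjv (two u∈))) ∷ first₂ uq) λ where
        (here refl) → v∈S
        (there u∈) → R⊆S (l⊆ (two u∈))
      where
      two : ∀ {u} → u ∈ u₁ ∷ u₂ ∷ [] → u ∈ u₁ ∷ u₂ ∷ us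
      two = ∈-++⁺ˡ
      first₂ : Unique (u₁ ∷ u₂ ∷ us) → Unique (u₁ ∷ u₂ ∷ [])
      first₂ ((h ∷ _) ∷ _) = (h ∷ []) ∷ [] ∷ []
    conn-S : ConnectedSet H S
    conn-S = star-connected v λ {z} z∈ → case toSub-∈ S? z∈ of λ where
      (inj₂ refl) → nil v∈S
      (inj₁ z∈R) → walk-trans (walk-mono R⊆S (conn z u₁ z∈R (l⊆ (here refl)))) (walk-edge (R⊆S (l⊆ (here refl))) v∈S (adj-sym H (adjv (here refl))))
    conn-S-x : ∀ x → x ∈ˢ S → ConnectedSet H (S -ˢ x)
    conn-S-x x x∈ = case toSub-∈ S? x∈ of λ where
        (inj₂ refl) → λ p q p∈ q∈ → walk-mono (λ h → Sub.x∈p∧x≢y⇒x∈p-y (R⊆S h) (λ { refl → v∉R h })) (conn p q (inR p∈) (inR q∈))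
        (inj₁ x∈R) → star-connected v λ {z} z∈ → let z∈S , z≢x = ∈-minus z∈ in case toSub-∈ S? z∈S of λ where
          (inj₂ refl) → nil z∈
          (inj₁ z∈R) → let u , u∈ , p = find (sep x z x∈R z∈R z≢x) in
            walk-trans (walk-mono (λ h → let h′ , ne = ∈-minus h in Sub.x∈p∧x≢y⇒x∈p-y (R⊆S h′) ne) p)
              (walk-edge (let h′ , ne = ∈-minus (walk-end p) in Sub.x∈p∧x≢y⇒x∈p-y (R⊆S h′) ne) (Sub.x∈p∧x≢y⇒x∈p-y v∈S (λ { refl → v∉R x∈R })) (adj-sym H (adjv u∈)))
      where
      inR : ∀ {p} → p ∈ˢ S -ˢ v → p ∈ˢ R
      inR p∈ = let p∈S , p≢v = ∈-minus p∈ in case toSub-∈ S? p∈S of λ where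
        (inj₁ h) → h
        (inj₂ e) → contradiction e p≢v

  -- The existence of a block around `S` is stated in refutation form, so maximality need not be
  -- decided: if no block contains `S`, a larger 2-connected set is absurd by recursion on its size,
  -- which makes `S` itself a block.
  block⊇ : ∀ k S → m ∸ ∣ S ∣ ≤ k → TwoConnected H S → (∀ B → Block H B → S ⊆ˢ B → ⊥) → ⊥
  block⊇ k S le tc h = h S (tc , λ T S⊆T tT → case ∣ T ∣ ≤? ∣ S ∣ of λ where
      (yes le′) → ⊆∧∣∣≤⇒≡ S⊆T le′
      (no nle) → ⊥-elim (larger k le T S⊆T tT (≰⇒> nle))) id
    where
    larger : ∀ k → m ∸ ∣ S ∣ ≤ k → ∀ T → S ⊆ˢ T → TwoConnected H T → ∣ S ∣ < ∣ T ∣ → ⊥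
    larger zero le T _ _ lt = 1+n≰n (≤-trans lt (≤-trans (Sub.∣p∣≤n T) (m∸n≡0⇒m≤n (n≤0⇒n≡0 le))))
    larger (suc k) le T S⊆T tT lt = block⊇ k T (≤-pred (≤-trans (∸-monoʳ-< lt (Sub.∣p∣≤n T)) le)) tT (λ B bl T⊆B → h B bl (λ x → T⊆B (S⊆T x)))

  -- Consequences of the family condition

  module Family (fam : InFamily H) where

    -- Neighbours of `v` that are connected to one another outside `v` share a block with `v`, and
    -- the degree bound for blocks applies.
    few-nbrs : ∀ v u₁ u₂ us → Unique (u₁ ∷ u₂ ∷ us) → (∀ {u} → u ∈ u₁ ∷ u₂ ∷ us → Adj H v u) →
      (∀ {u} → u ∈ u₁ ∷ u₂ ∷ us → Walk H (⊤ˢ -ˢ v) u₁ u) → length (u₁ ∷ u₂ ∷ us) ≤ 3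
    few-nbrs v u₁ u₂ us uq adjv walks = decidable-stable (_ ≤? 3) λ many →
      let S , tc , v∈S , us∈S = around v u₁ u₂ us uq adjv walks in
      block⊇ (m ∸ ∣ S ∣) S ≤-refl tc λ B bl S⊆B → many (≤-trans
        (length≤Σ (u₁ ∷ u₂ ∷ us) (λ u → adj H v u ∧ Vec.lookup B u) uq (λ u∈ → cong₂ _∧_ (adjv u∈) (Vecₚ.[]=⇒lookup (S⊆B (us∈S u∈)))))
        (proj₁ fam B bl v (S⊆B v∈S)))

    HasTri : Subset m → Set
    HasTri C = ∃ λ a → ∃ λ b → ∃ λ c → a ∈ˢ C × Adj H a b × Adj H b c × Adj H a c

    hasTri? : ∀ C → Dec (HasTri C)
    hasTri? C = any? λ a → any? λ b → any? λ c → (a Sub.∈? C) ×-dec (adj? H a b ×-dec (adj? H b c ×-dec adj? H a c))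

    -- If every part around v contains a triangle, these triangles share a block, which connects the parts.
    free-part : ∀ v us → Unique us → 4 ≤ length us → (∀ {u} → u ∈ us → Adj H v u) →
      ∃ λ u → u ∈ us × ¬ HasTri (comp (⊤ˢ -ˢ v) u)
    free-part v us uq four adjv = case Any.any? (λ u → ¬? (hasTri? (comp (⊤ˢ -ˢ v) u))) us of λ where
        (yes any) → find any
        (no none) → ⊥-elim (case proj₂ fam C component of λ where
          (inj₁ small) → 1+n≰n (≤-trans (≤-trans four (length≤Σ us (adj H v) uq adjv)) (small v v∈C))
          (inj₂ same) → connected same (λ {u} u∈ → decidable-stable (hasTri? (comp (⊤ˢ -ˢ v) u)) λ ¬t → none (Any.map (λ { refl → ¬t }) u∈)))
      where
      C = comp ⊤ˢ v
      v∈C : v ∈ˢ C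
      v∈C = ∈-comp (nil Sub.∈⊤)
      component : Component H C
      component = (v , v∈C) , comp-connected Sub.∈⊤ , λ T C⊆T conn → Sub.⊆-antisym (λ {x} x∈ → ∈-comp (walk-mono Sub.⊆⊤ (conn v x (C⊆T v∈C) x∈))) C⊆T
      Same = ∀ B B′ → Block H B → B ⊆ˢ C → HasTriangle H B → Block H B′ → B′ ⊆ˢ C → HasTriangle H B′ → B ≡ B′
      AllTri = ∀ {u} → u ∈ us → HasTri (comp (⊤ˢ -ˢ v) u)
      tri-block : ∀ {u} → u ∈ us → HasTri (comp (⊤ˢ -ˢ v) u) →
        (∀ B → Block H B → B ⊆ˢ C → HasTriangle H B → (∃ λ a → a ∈ˢ B × Walk H (⊤ˢ -ˢ v) u a) → ⊥) → ⊥
      tri-block {u} u∈ (a , p , q , a∈ , ap , pq , aq) h =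
        let S , tc , a∈S , in-S = around a p q [] ((adj-≢ H pq ∷ []) ∷ [] ∷ []) (λ { (here refl) → ap ; (there (here refl)) → aq }) (λ where
              (here refl) → nil (⊤-minus (≢-sym (adj-≢ H ap)))
              (there (here refl)) → walk-edge (⊤-minus (≢-sym (adj-≢ H ap))) (⊤-minus (≢-sym (adj-≢ H aq))) pq)
        in block⊇ (m ∸ ∣ S ∣) S ≤-refl tc λ B bl S⊆B → h B bl
          (λ {y} y∈ → ∈-comp (cons Sub.∈⊤ (adjv u∈) (walk-trans (walk-mono Sub.⊆⊤ (comp-∈ a∈)) (walk-mono Sub.⊆⊤ (proj₁ (proj₂ (proj₁ bl)) a y (S⊆B a∈S) y∈)))))
          (a , p , q , S⊆B a∈S , S⊆B (in-S (here refl)) , S⊆B (in-S (there (here refl))) , ap , pq , aq)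
          (a , S⊆B a∈S , comp-∈ a∈)
      inside-block : ∀ {B a a′} → Block H B → a ∈ˢ B → a′ ∈ˢ B → a ≢ v → a′ ≢ v → Walk H (⊤ˢ -ˢ v) a a′
      inside-block {B} {a} {a′} ((_ , conn , conn-x) , _) a∈ a′∈ a≢v a′≢v = case v Sub.∈? B of λ where
        (yes v∈) → walk-mono (λ h → ⊤-minus (proj₂ (∈-minus h))) (conn-x v v∈ a a′ (Sub.x∈p∧x≢y⇒x∈p-y a∈ a≢v) (Sub.x∈p∧x≢y⇒x∈p-y a′∈ a′≢v))
        (no v∉) → walk-mono (λ h → ⊤-minus (λ { refl → v∉ h })) (conn a a′ a∈ a′∈)
      link : Same → AllTri → ∀ {u u′} → u ∈ us → u′ ∈ us → Walk H (⊤ˢ -ˢ v) u u′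
      link same tri {u} {u′} u∈ u′∈ = decidable-stable (walk? (⊤ˢ -ˢ v) u u′) λ ¬w →
        tri-block u∈ (tri u∈) λ B bl B⊆C tB (a , a∈ , ua) →
        tri-block u′∈ (tri u′∈) λ B′ bl′ B′⊆C tB′ (a′ , a′∈ , ua′) →
        ¬w (walk-trans ua (walk-trans (inside-block bl a∈ (subst (a′ ∈ˢ_) (symm (same B B′ bl B⊆C tB bl′ B′⊆C tB′)) a′∈)
          (proj₂ (∈-minus (walk-end ua))) (proj₂ (∈-minus (walk-end ua′)))) (walk-sym ua′)))
      connected : Same → AllTri → ⊥
      connected same tri = go us refl four
        where
        go : ∀ l → us ≡ l → 4 ≤ length l → ⊥
        go (u₁ ∷ u₂ ∷ l) refl len = 1+n≰n (≤-trans len (few-nbrs v u₁ u₂ l uq adjv (λ u∈ → link same tri (here refl) u∈)))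
        go (_ ∷ []) refl (s≤s ())

    -- If all these neighbours were connected to `x` outside `v`, they would be connected to one
    -- another, against `few-nbrs`.
    away-part : ∀ v x us → Unique us → 4 ≤ length us → (∀ {u} → u ∈ us → Adj H v u) → ∃ λ u → u ∈ us × ¬ Walk H (⊤ˢ -ˢ v) u x
    away-part v x us uq four adjv = case Any.any? (λ u → ¬? (walk? (⊤ˢ -ˢ v) u x)) us of λ where
        (yes any) → find any
        (no none) → ⊥-elim (go us refl four λ {u} u∈ → decidable-stable (walk? (⊤ˢ -ˢ v) u x) λ ¬w → none (Any.map (λ { refl → ¬w }) u∈))
      where
      go : ∀ l → us ≡ l → 4 ≤ length l → (∀ {u} → u ∈ us → Walk H (⊤ˢ -ˢ v) u x) → ⊥
      go (u₁ ∷ u₂ ∷ l) refl len h = 1+n≰n (≤-trans len (few-nbrs v u₁ u₂ l uq adjv (λ u∈ → walk-trans (h (here refl)) (walk-sym (h u∈)))))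
      go (_ ∷ []) refl (s≤s ()) _

-- From a vertex of large degree to a side, and the induction

module Embedded {n m} (E₀ : Fin n → Fin n → Set) (H : Graph m) (famH : InFamily H) (f : Fin n → Fin m)
  (hom : ∀ {u v} → E₀ u v → Adj H (f u) (f v)) (inj : ∀ {u u′ v v′} → E₀ u u′ → E₀ v v′ → f u ≡ f v → u ≡ v) where

  open Walks H
  open Family famH

  module _ (G : Graph n) (fam : Fam E₀ G) where

    images : Fin n → List (Fin m)
    images v = map f (nbE G v)

    images-unique : ∀ v → Unique (images v)
    images-unique v = go (nbE G v) (nbE-unique G v) (λ u∈ → nbE-∈ G u∈)
      where
      go : ∀ l → Unique l → (∀ {u} → u ∈ l → E G v u) → Unique (map f l)
      go [] _ _ = []
      go (u ∷ l) (u∉ ∷ uq) h = Allₚ.map⁺ (All.tabulate (λ x∈ e → All.lookup u∉ x∈ (inj (fam (E-sym G (h (here refl)))) (fam (E-sym G (h (there x∈)))) e))) ∷ go l uq (h ∘ there)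

    images-adj : ∀ v {x} → x ∈ images v → Adj H (f v) x
    images-adj v x∈ with u , u∈ , refl ← ∈-map⁻ f x∈ = hom (fam (nbE-∈ G u∈))

    images-many : ∀ {v} → 4 ≤ length (nbE G v) → 4 ≤ length (images v)
    images-many {v} le = ≤-trans le (≤-reflexive (symm (length-map f (nbE G v))))

    -- `C` is attached to the rest of `H` at `f v` only. If it contains the image of a vertex `x` of
    -- large degree, some part of `H` without `f x` misses `f v`; it lies properly inside `C`, is
    -- attached at `f x` only, and takes the place of `C`.
    shrink : ∀ k v (C : Subset m) → ∣ C ∣ ≤ k → (∀ {z z′} → z ∈ˢ C → Adj H z z′ → z′ ∈ˢ C ⊎ z′ ≡ f v) → ¬ HasTri C →
      (∃ λ u → E G v u × f u ∈ˢ C) → f v ∉ˢ C → Side G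
    shrink k v C le closed free (u , vu , u∈) v∉ with any? (λ l → (f l Sub.∈? C) ×-dec (4 ≤? length (nbE G l)))
    ... | no none = record
      { L = λ l → f l ∈ˢ C × ∃ (E G l)
      ; L? = λ l → (f l Sub.∈? C) ×-dec any? (E? G l)
      ; c = v
      ; c∉L = λ (h , _) → v∉ h
      ; closed = λ {l} {x} (h , _) e → case closed h (hom (fam e)) of λ where
          (inj₁ q) → inj₁ (q , l , E-sym G e)
          (inj₂ q) → inj₂ (inj (fam (E-sym G e)) (fam vu) q)
      ; degL = λ {l} (h , _) → ≮⇒≥ λ many → none (l , h , many)
      ; notri = λ {l} {p} {q} (h , _) lp lq pq → free (f l , f p , f q , h , hom (fam lp) , hom (fam pq) , hom (fam lq))
      ; l₀ = u ; u₀ = v ; l₀∈L = u∈ , v , E-sym G vu ; l₀u₀ = E-sym G vu }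
    shrink zero v C le closed free (u , vu , u∈) v∉ | yes (x , x∈ , many) = ⊥-elim (n≮0 (≤-trans (Sub.x∈p⇒∣p-x∣<∣p∣ x∈) le))
    shrink (suc k) v C le closed free (u , vu , u∈) v∉ | yes (x , x∈ , many) with away-part (f x) (f v) (images x) (images-unique x) (images-many many) (images-adj x)
    ... | _ , y∈ , ¬w with y , y∈′ , refl ← ∈-map⁻ f y∈ =
      shrink k x C′ (≤-pred (≤-trans (Sub.p⊂q⇒∣p∣<∣q∣ (C′⊆C , f x , x∈ , x∉C′)) le)) closed′
        (λ (a , b , c , a∈ , t) → free (a , b , c , C′⊆C a∈ , t)) (y , nbE-∈ G y∈′ , ∈-comp (nil y∈⊤)) x∉C′
      where
      C′ = comp (⊤ˢ -ˢ f x) (f y)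
      y∈⊤ : f y ∈ˢ ⊤ˢ -ˢ f x
      y∈⊤ = ⊤-minus (≢-sym (adj-≢ H (images-adj x y∈)))
      x∉C′ : f x ∉ˢ C′
      x∉C′ h = x∉p-x ⊤ˢ (f x) (walk-end (comp-∈ h))
      closed′ : ∀ {z z′} → z ∈ˢ C′ → Adj H z z′ → z′ ∈ˢ C′ ⊎ z′ ≡ f x
      closed′ {z} {z′} z∈ e = case z′ ≟ f x of λ where
        (yes q) → inj₂ q
        (no z′≢) → inj₁ (∈-comp (walk-trans (comp-∈ z∈) (walk-edge (walk-end (comp-∈ z∈)) (⊤-minus z′≢) e)))
      stay : ∀ {p z} → Walk H (⊤ˢ -ˢ f x) (f y) p → p ∈ˢ C → Walk H (⊤ˢ -ˢ f x) p z → z ∈ˢ C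
      stay pre p∈ (nil _) = p∈
      stay pre p∈ (cons {w = w} p∈′ e q) = case closed p∈ e of λ where
          (inj₁ w∈) → stay pre′ w∈ q
          (inj₂ refl) → ⊥-elim (¬w pre′)
        where
        pre′ : Walk H (⊤ˢ -ˢ f x) (f y) w
        pre′ = walk-trans pre (walk-edge p∈′ (walk-start q) e)
      C′⊆C : C′ ⊆ˢ C
      C′⊆C z∈ = case closed x∈ (images-adj x y∈) of λ where
        (inj₁ y∈C) → stay (nil y∈⊤) y∈C (comp-∈ z∈)
        (inj₂ e) → ⊥-elim (¬w (subst (Walk H (⊤ˢ -ˢ f x) (f y)) e (nil y∈⊤)))

    side : ∀ v → 4 ≤ length (nbE G v) → Side G
    side v many with free-part (f v) (images v) (images-unique v) (images-many many) (images-adj v)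
    ... | _ , y∈ , free with u , u∈ , refl ← ∈-map⁻ f y∈ =
      shrink ∣ C ∣ v C ≤-refl closed free (u , nbE-∈ G u∈ , ∈-comp (nil (⊤-minus (≢-sym (adj-≢ H (images-adj v y∈)))))) (λ h → x∉p-x ⊤ˢ (f v) (walk-end (comp-∈ h)))
      where
      C = comp (⊤ˢ -ˢ f v) (f u)
      closed : ∀ {z z′} → z ∈ˢ C → Adj H z z′ → z′ ∈ˢ C ⊎ z′ ≡ f v
      closed {z} {z′} z∈ e = case z′ ≟ f v of λ where
        (yes q) → inj₂ q
        (no z′≢) → inj₁ (∈-comp (walk-trans (comp-∈ z∈) (walk-edge (walk-end (comp-∈ z∈)) (⊤-minus z′≢) e)))

  decompose : ∀ G → Acc _<_ (edges G) → Fam E₀ G → NoBad G → State G (n / 2)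
  decompose G (acc rec) fam nb = case any? (λ v → 4 ≤? length (nbE G v)) of λ where
      (yes (v , many)) → Hanging.reduce-side E₀ (n / 2) G ih fam nb (side G fam v many)
      (no none) → case Reduction.reduce-deg≤3 E₀ (n / 2) G ih fam nb (λ v → ≮⇒≥ λ many → none (v , many)) of λ where
        (inj₁ s) → s
        (inj₂ tris) → Conclusion.conclude E₀ G ih fam nb tris
    where
    ih : ∀ G′ → edges G′ < edges G → Fam E₀ G′ → NoBad G′ → State G′ (n / 2)
    ih G′ lt fam′ nb′ = decompose G′ (rec lt) fam′ nb′

-- From a bad triangle to a SET graph, and the theorem

bad⇒SET : ∀ {n} (G : Graph n) → Connected G → ∀ {a b c} → Bad G a b c → SET G
bad⇒SET G conn {a} {b} {c} (((ab , ea , eb) , (bc , _ , ec) , (ac , _)) , closed) =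
  (a , b , c , ev a ea , ev b eb , ev c ec , ab , bc , ac , evens) , odds
  where
  ev : ∀ v → Ev G v → EvenV G v
  ev v e = even⇒2∣ (deg G v) e
  along : ∀ {S u v} → Walk G S u v → K G a b c u → K G a b c v
  along (nil _) k = k
  along (cons _ e p) k = along p (closed _ _ k e)
  -- Connectedness of the graph enters here: the component of the bad triangle is everything.
  inK : ∀ v → K G a b c v
  inK v = along (conn a v) (inj₁ (here refl))
  evens : ∀ v → EvenV G v → v ≡ a ⊎ v ≡ b ⊎ v ≡ c
  evens v e = case inK v of λ where
    (inj₁ (here q)) → inj₁ q
    (inj₁ (there (here q))) → inj₂ (inj₁ q)
    (inj₁ (there (there (here q)))) → inj₂ (inj₂ q)
    (inj₂ (o , _)) → ⊥-elim (true≢false o (2∣⇒even e))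
  odds : ∀ v → ¬ EvenV G v → Σ _ λ x → Σ _ λ y → ¬ x ≡ y × EvenV G x × EvenV G y × Adj G v x × Adj G v y
  odds v ¬e = case inK v of λ where
    (inj₁ (here refl)) → contradiction (ev a ea) ¬e
    (inj₁ (there (here refl))) → contradiction (ev b eb) ¬e
    (inj₁ (there (there (here refl)))) → contradiction (ev c ec) ¬e
    (inj₂ (_ , inj₁ (p , q))) → a , b , adj-≢ G ab , ev a ea , ev b eb , p , q
    (inj₂ (_ , inj₂ (inj₁ (p , q)))) → b , c , adj-≢ G bc , ev b eb , ev c ec , p , q
    (inj₂ (_ , inj₂ (inj₂ (p , q)))) → a , c , adj-≢ G ac , ev a ea , ev c ec , p , q

theorem1p5 : ∀ {n} (G : Graph n) → Connected G → EVSubgraphOfFamily G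
    → Gallai G ⊎ SET G
theorem1p5 G conn (m , H , famH , f , inj , hom) = case bad? G of λ where
    (yes (_ , _ , _ , bad)) → inj₂ (bad⇒SET G conn bad)
    (no none) → let s = Embedded.decompose (E G) H famH f
                          (λ {u} {v} (e , eu , ev) → hom u v (even⇒2∣ (deg G u) eu) (even⇒2∣ (deg G v) ev) e)
                          (λ {u} {_} {v} (_ , eu , _) (_ , ev , _) → inj u v (even⇒2∣ (deg G u) eu) (even⇒2∣ (deg G v) ev))
                          G (<-wellFounded _) id (λ a b c bad → none (a , b , c , bad))
                in inj₁ (State.paths s , Decomposes⇒IsPathDecomposition (State.decomposes s) , State.bound s)
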